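{- Let $r\in\mathbb{Q}$ with $H(r)>4$ and let $\mathfrak{m}$ be the set of Mersenne primes. Then $$(\log B)^{0.60839}\ll\#\Big\{t=((r^{q_1}+1)^{q_2}\cdots +1)^{q_s}+1 \;\Big|\; q_1,\dots, q_s\in\mathfrak{m},\ H(t)\leq B\Big\}\ll (\log B)^{0.60872},$$ where the set consists of the distinct rational numbers $t$ of the indicated form with $s$ arbitrary, and the implicit constants depend on $r$.
   Context: A Mersenne prime is a prime of the form $2^n-1$. The expression $((r^{q_1}+1)^{q_2}\cdots+1)^{q_s}+1$ denotes the value at $r$ of the composition $\theta_{q_s}\circ\cdots\circ\theta_{q_1}$, where $\theta_q(z)=z^q+1$. $H$ is the standard multiplicative Weil height on $\mathbb{Q}$: $H(a/b)=\max\{|a|,|b|\}$ for coprime integers $a,b$ with $b\ne0$. The notation $F(B)\ll G(B)$ means that there are a constant $c>0$ and a $B_0$ such that $F(B)\le c\,G(B)$ for all $B\ge B_0$. -}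

module Defs where

open import Data.Nat.Base as ℕ using (ℕ; zero; suc)
import Data.Nat.Properties as ℕ
open import Data.Nat.Primality using (Prime)
open import Data.Integer.Base as ℤ using (+_)
import Data.Integer.Properties as ℤ
open import Data.Rational.Base
import Data.Rational.Unnormalised.Base as ℚᵘ
import Data.Rational.Unnormalised.Properties as ℚᵘ
open import Data.Rational.Properties
open import Data.Rational.Solver using (module +-*-Solver)
open import Data.List.Base as List using (List; length; foldl)
open import Data.List.NonEmpty.Base using (List⁺; toList)
open import Data.List.Relation.Unary.All using (All)
open import Data.List.Relation.Unary.Unique.Propositional using (Unique)
open import Data.Product.Base using (Σ; ∃; Σ-syntax; ∃-syntax; _×_; _,_; proj₁; proj₂)
open import Data.Sum.Base as Sum using (_⊎_; inj₁; inj₂)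
open import Data.Empty using (⊥; ⊥-elim)
open import Function.Base using (_∘_)
open import Level using (0ℓ)
open import Relation.Nullary using (¬_; yes; no)
open import Relation.Unary using (Pred)
open import Relation.Binary.PropositionalEquality
open import Algebra.Bundles using (CommutativeRing)
open import Algebra.Definitions.RawSemiring +-*-rawSemiring using (_^_)
import Algebra.Properties.Semiring.Exp as SemiringExp
import Algebra.Properties.CommutativeSemiring.Exp as CommutativeSemiringExp

private
  module Exp  = SemiringExp (CommutativeRing.semiring +-*-commutativeRing)
  module CExp = CommutativeSemiringExp (CommutativeRing.commutativeSemiring +-*-commutativeRing)

fromℕ : ℕ → ℚ
fromℕ n = + n / 1

module Auxiliary where

  fromℕ-suc : ∀ n → fromℕ (suc n) ≡ 1ℚ + fromℕ n
  fromℕ-suc n = toℚᵘ-injective (begin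
    toℚᵘ (fromℕ (suc n))               ≈⟨ toℚᵘ-fromℚᵘ (ℚᵘ.mkℚᵘ (+ suc n) 0) ⟩
    ℚᵘ.mkℚᵘ (+ suc n) 0                ≈⟨ ℚᵘ.*≡* (cong (ℤ._* + 1) (sym (cong (λ z → + 1 ℤ.+ z) (ℤ.*-identityʳ (+ n))))) ⟩
    ℚᵘ.1ℚᵘ ℚᵘ.+ ℚᵘ.mkℚᵘ (+ n) 0        ≈⟨ ℚᵘ.+-congʳ ℚᵘ.1ℚᵘ (ℚᵘ.≃-sym (toℚᵘ-fromℚᵘ (ℚᵘ.mkℚᵘ (+ n) 0))) ⟩
    toℚᵘ 1ℚ ℚᵘ.+ toℚᵘ (fromℕ n)        ≈⟨ ℚᵘ.≃-sym (toℚᵘ-homo-+ 1ℚ (fromℕ n)) ⟩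
    toℚᵘ (1ℚ + fromℕ n)                ∎)
    where open ℚᵘ.≃-Reasoning

  fromℕ-inverse : ∀ k → fromℕ (suc k) * (+ 1 / suc k) ≡ 1ℚ
  fromℕ-inverse k = toℚᵘ-injective (begin
    toℚᵘ (fromℕ (suc k) * (+ 1 / suc k))
      ≈⟨ toℚᵘ-homo-* (fromℕ (suc k)) (+ 1 / suc k) ⟩
    toℚᵘ (fromℕ (suc k)) ℚᵘ.* toℚᵘ (+ 1 / suc k)
      ≈⟨ ℚᵘ.*-cong (toℚᵘ-fromℚᵘ (ℚᵘ.mkℚᵘ (+ suc k) 0)) (toℚᵘ-fromℚᵘ (ℚᵘ.mkℚᵘ (+ 1) k)) ⟩
    ℚᵘ.mkℚᵘ (+ suc k) 0 ℚᵘ.* ℚᵘ.mkℚᵘ (+ 1) k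
      ≈⟨ ℚᵘ.*≡* (trans (ℤ.*-identityʳ (+ suc k ℤ.* + 1))
                 (trans (ℤ.*-identityʳ (+ suc k))
                 (sym (trans (ℤ.*-identityˡ _) (cong +_ (ℕ.*-identityˡ (suc k))))))) ⟩
    ℚᵘ.1ℚᵘ ∎)
    where open ℚᵘ.≃-Reasoning

  0<1 : 0ℚ < 1ℚ
  0<1 = positive⁻¹ 1ℚ

  0<1/suc : ∀ k → 0ℚ < + 1 / suc k
  0<1/suc k = positive⁻¹ (+ 1 / suc k) {{normalize-pos 1 (suc k)}}

  0≤fromℕ : ∀ n → 0ℚ ≤ fromℕ n
  0≤fromℕ n = nonNegative⁻¹ (fromℕ n) {{normalize-nonNeg n 1}}

  0<fromℕ : ∀ n → 0ℚ < fromℕ (suc n)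
  0<fromℕ n = positive⁻¹ (fromℕ (suc n)) {{normalize-pos (suc n) 1}}

  *-mono-<ˡ : ∀ {c a b} → 0ℚ < c → a < b → c * a < c * b
  *-mono-<ˡ {c} 0<c = *-monoʳ-<-pos c {{positive 0<c}}

  *-mono-<ʳ : ∀ {c a b} → 0ℚ < c → a < b → a * c < b * c
  *-mono-<ʳ {c} 0<c = *-monoˡ-<-pos c {{positive 0<c}}

  *-cancel-<ʳ : ∀ {c a b} → 0ℚ ≤ c → a * c < b * c → a < b
  *-cancel-<ʳ {c} 0≤c = *-cancelʳ-<-nonNeg c {{nonNegative 0≤c}}

  *-mono-≤² : ∀ {a b c d} → 0ℚ ≤ a → a ≤ b → 0ℚ ≤ c → c ≤ d → a * c ≤ b * d
  *-mono-≤² {a} {b} {c} {d} 0≤a a≤b 0≤c c≤d =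
    ≤-trans (*-monoˡ-≤-nonNeg a {{nonNegative 0≤a}} c≤d)
            (*-monoʳ-≤-nonNeg d {{nonNegative (≤-trans 0≤c c≤d)}} a≤b)

  *-pos : ∀ {a b} → 0ℚ < a → 0ℚ < b → 0ℚ < a * b
  *-pos {a} {b} 0<a 0<b = subst (_< a * b) (*-zeroʳ a) (*-mono-<ˡ 0<a 0<b)

  *-nonNeg : ∀ {a b} → 0ℚ ≤ a → 0ℚ ≤ b → 0ℚ ≤ a * b
  *-nonNeg {a} {b} 0≤a 0≤b =
    subst (_≤ a * b) (*-zeroʳ a) (*-monoˡ-≤-nonNeg a {{nonNegative 0≤a}} 0≤b)

  inverse : ∀ {a} → 0ℚ < a → ∃[ i ] 0ℚ < i × a * i ≡ 1ℚ
  inverse {a} 0<a = 1/ a , positive⁻¹ (1/ a) {{1/pos⇒pos a}} , *-inverseʳ a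
    where instance
            a-pos     = positive 0<a
            a-nonZero = pos⇒nonZero a

  -- u < a b  gives  u / b < a, with i the inverse of b
  divide-< : ∀ {u a b i} → 0ℚ < i → b * i ≡ 1ℚ → u < a * b → u * i < a
  divide-< {u} {a} {b} {i} 0<i bi≡1 u<ab = subst (u * i <_) eq (*-mono-<ʳ 0<i u<ab)
    where
    eq : a * b * i ≡ a
    eq = trans (*-assoc a b i) (trans (cong (a *_) bi≡1) (*-identityʳ a))

  undivide-< : ∀ {u a b i} → 0ℚ < b → b * i ≡ 1ℚ → u * i < a → u < a * b
  undivide-< {u} {a} {b} {i} 0<b bi≡1 ui<a = subst (_< a * b) eq (*-mono-<ʳ 0<b ui<a)
    where
    eq : u * i * b ≡ u
    eq = trans (*-assoc u i b)
        (trans (cong (u *_) (trans (*-comm i b) bi≡1)) (*-identityʳ u))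

  p<q⇒0<q-p : ∀ {p q} → p < q → 0ℚ < q - p
  p<q⇒0<q-p {p} {q} p<q = subst (_< q - p) (+-inverseʳ p) (+-monoˡ-< (- p) p<q)

  0<q-p⇒p<q : ∀ {p q} → 0ℚ < q - p → p < q
  0<q-p⇒p<q {p} {q} 0<d =
    subst₂ _<_ (+-identityˡ p)
      (solve 2 (λ q p → q :- p :+ p := q) refl q p) (+-monoˡ-< p 0<d)
    where open +-*-Solver

  p<p+1 : ∀ p → p < p + 1ℚ
  p<p+1 p = subst (_< p + 1ℚ) (+-identityʳ p) (+-monoʳ-< p 0<1)

  p≤p+q : ∀ p {q} → 0ℚ ≤ q → p ≤ p + q
  p≤p+q p {q} 0≤q = subst (_≤ p + q) (+-identityʳ p) (+-monoʳ-≤ p 0≤q)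

  p≤∣p∣ : ∀ p → p ≤ ∣ p ∣
  p≤∣p∣ p with ≤-total 0ℚ p
  ... | inj₁ 0≤p = ≤-reflexive (sym (0≤p⇒∣p∣≡p 0≤p))
  ... | inj₂ p≤0 = ≤-trans p≤0 (0≤∣p∣ p)

  -p≤∣p∣ : ∀ p → - p ≤ ∣ p ∣
  -p≤∣p∣ p = subst (- p ≤_) (∣-p∣≡∣p∣ p) (p≤∣p∣ (- p))

  archimedean : ∀ p → ∃[ k ] p < fromℕ (suc k)
  archimedean p@(mkℚ n d-1 c) = ℤ.∣ n ∣ , toℚᵘ-cancel-< (begin-strict
    toℚᵘ p                          <⟨ ℚᵘ.*<* bound ⟩
    ℚᵘ.mkℚᵘ (+ suc ℤ.∣ n ∣) 0       ≃⟨ ℚᵘ.≃-sym (toℚᵘ-fromℚᵘ (ℚᵘ.mkℚᵘ (+ suc ℤ.∣ n ∣) 0)) ⟩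
    toℚᵘ (fromℕ (suc ℤ.∣ n ∣))      ∎)
    where
    open ℚᵘ.≤-Reasoning
    abs-bound : ∀ i → i ℤ.≤ + ℤ.∣ i ∣
    abs-bound (+ n)        = ℤ.≤-refl
    abs-bound (ℤ.-[1+ n ]) = ℤ.-≤+
    bound : n ℤ.* + 1 ℤ.< + suc ℤ.∣ n ∣ ℤ.* + suc d-1
    bound = subst (ℤ._< + suc ℤ.∣ n ∣ ℤ.* + suc d-1) (sym (ℤ.*-identityʳ n))
      (ℤ.≤-<-trans (abs-bound n) (ℤ.+<+ (ℕ.m≤m*n (suc ℤ.∣ n ∣) (suc d-1))))

  ^-pos : ∀ {x} n → 0ℚ < x → 0ℚ < x ^ n
  ^-pos zero    0<x = 0<1
  ^-pos (suc n) 0<x = *-pos 0<x (^-pos n 0<x)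

  ^-nonNeg : ∀ {x} n → 0ℚ ≤ x → 0ℚ ≤ x ^ n
  ^-nonNeg zero    0≤x = <⇒≤ 0<1
  ^-nonNeg (suc n) 0≤x = *-nonNeg 0≤x (^-nonNeg n 0≤x)

  ^-mono-≤ : ∀ {x y} n → 0ℚ ≤ x → x ≤ y → x ^ n ≤ y ^ n
  ^-mono-≤ zero    0≤x x≤y = ≤-refl
  ^-mono-≤ (suc n) 0≤x x≤y = *-mono-≤² 0≤x x≤y (^-nonNeg n 0≤x) (^-mono-≤ n 0≤x x≤y)

  ^-mono-< : ∀ {x y} n → 0ℚ ≤ x → x < y → x ^ suc n < y ^ suc n
  ^-mono-< {x} {y} n 0≤x x<y = ≤-<-trans
    (*-monoˡ-≤-nonNeg x {{nonNegative 0≤x}} (^-mono-≤ n 0≤x (<⇒≤ x<y)))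
    (*-mono-<ʳ (^-pos n (≤-<-trans 0≤x x<y)) x<y)

  1^n≡1 : ∀ n → 1ℚ ^ n ≡ 1ℚ
  1^n≡1 zero    = refl
  1^n≡1 (suc n) = trans (*-identityˡ (1ℚ ^ n)) (1^n≡1 n)

  x≤x^n : ∀ {x} n → 1ℚ ≤ x → x ≤ x ^ suc n
  x≤x^n {x} n 1≤x = subst (_≤ x ^ suc n) (*-identityʳ x)
    (*-monoˡ-≤-nonNeg x {{nonNegative (≤-trans (<⇒≤ 0<1) 1≤x)}}
      (subst (_≤ x ^ n) (1^n≡1 n) (^-mono-≤ n (<⇒≤ 0<1) 1≤x)))

  x^n≤x : ∀ {x} n → 0ℚ ≤ x → x ≤ 1ℚ → x ^ suc n ≤ x
  x^n≤x {x} n 0≤x x≤1 = subst (x ^ suc n ≤_) (*-identityʳ x)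
    (*-monoˡ-≤-nonNeg x {{nonNegative 0≤x}}
      (subst (x ^ n ≤_) (1^n≡1 n) (^-mono-≤ n 0≤x x≤1)))

  0≤x² : ∀ x → 0ℚ ≤ x * x
  0≤x² x with ≤-total 0ℚ x
  ... | inj₁ 0≤x = *-nonNeg 0≤x 0≤x
  ... | inj₂ x≤0 = nonNegative⁻¹ (x * x)
                     {{nonPos*nonPos⇒nonPos x {{nonPositive x≤0}} x {{nonPositive x≤0}}}}

  bernoulli : ∀ {x} n → 0ℚ ≤ 1ℚ + x → 1ℚ + fromℕ n * x ≤ (1ℚ + x) ^ n
  bernoulli {x} zero 0≤1+x =
    ≤-reflexive (trans (cong (λ z → 1ℚ + z) (*-zeroˡ x)) (+-identityʳ 1ℚ))
  bernoulli {x} (suc n) 0≤1+x = begin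
    1ℚ + fromℕ (suc n) * x                   ≡⟨ cong (λ z → 1ℚ + z * x) (fromℕ-suc n) ⟩
    1ℚ + (1ℚ + fromℕ n) * x                  ≤⟨ p≤p+q _ (*-nonNeg (0≤fromℕ n) (0≤x² x)) ⟩
    1ℚ + (1ℚ + fromℕ n) * x + fromℕ n * (x * x)
      ≡⟨ solve 2 (λ n x → con 1ℚ :+ (con 1ℚ :+ n) :* x :+ n :* (x :* x)
                       := (con 1ℚ :+ x) :* (con 1ℚ :+ n :* x)) refl (fromℕ n) x ⟩
    (1ℚ + x) * (1ℚ + fromℕ n * x)
      ≤⟨ *-monoˡ-≤-nonNeg (1ℚ + x) {{nonNegative 0≤1+x}} (bernoulli n 0≤1+x) ⟩
    (1ℚ + x) ^ suc n                         ∎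
    where
    open ≤-Reasoning
    open +-*-Solver using (solve; con; _:=_; _:+_; _:*_)

  shrink-factors : ∀ {u a b} → 0ℚ ≤ u → 0ℚ < a → 0ℚ < b → u < a * b →
    ∃[ a′ ] ∃[ b′ ] 0ℚ < a′ × a′ < a × b′ < b × u < a′ * b′
  shrink-factors {u} {a} {b} 0≤u 0<a 0<b u<ab =
    let (i , 0<i , bi≡1)    = inverse 0<b
        (a′ , ui<a′ , a′<a) = <-dense (divide-< 0<i bi≡1 u<ab)
        0<a′                = ≤-<-trans (*-nonNeg 0≤u (<⇒≤ 0<i)) ui<a′
        (j , 0<j , a′j≡1)   = inverse 0<a′
        u<a′b               = undivide-< {a = a′} 0<b bi≡1 ui<a′
        (b′ , uj<b′ , b′<b) =
          <-dense (divide-< 0<j a′j≡1 (subst (u <_) (*-comm a′ b) u<a′b))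
        u<b′a′              = undivide-< {a = b′} 0<a′ a′j≡1 uj<b′
    in a′ , b′ , 0<a′ , a′<a , b′<b , subst (u <_) (*-comm b′ a′) u<b′a′

  grow-factors : ∀ {a b v} → 0ℚ ≤ a → 0ℚ ≤ b → a * b < v →
    ∃[ a′ ] ∃[ b′ ] a < a′ × b < b′ × a′ * b′ < v
  grow-factors {a} {b} {v} 0≤a 0≤b ab<v = main (v - a * b) refl (p<q⇒0<q-p ab<v)
    where
    open ≤-Reasoning
    open +-*-Solver using (solve; _:=_; _:+_; _:*_; _:-_)
    expand : ∀ e → (a + e) * (b + e) ≡ a * b + e * (a + b + e)
    expand = solve 3 (λ a b e → (a :+ e) :* (b :+ e) := a :* b :+ e :* (a :+ b :+ e)) refl a b
    cancel : ∀ p → p + (v - p) ≡ v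
    cancel = solve 2 (λ v p → p :+ (v :- p) := v) refl v
    with-step : ∀ ε → 0ℚ < ε → ε < 1ℚ → ε * (a + b + 1ℚ) < v - a * b →
      ∃[ a′ ] ∃[ b′ ] a < a′ × b < b′ × a′ * b′ < v
    with-step ε 0<ε ε<1 small = a + ε , b + ε , grow a , grow b , (begin-strict
      (a + ε) * (b + ε)         ≡⟨ expand ε ⟩
      a * b + ε * (a + b + ε)   <⟨ +-monoʳ-< (a * b) (*-mono-<ˡ 0<ε (+-monoʳ-< (a + b) ε<1)) ⟩
      a * b + ε * (a + b + 1ℚ)  <⟨ +-monoʳ-< (a * b) small ⟩
      a * b + (v - a * b)       ≡⟨ cancel (a * b) ⟩
      v                         ∎)
      where
      grow : ∀ x → x < x + ε
      grow x = subst (_< x + ε) (+-identityʳ x) (+-monoʳ-< x 0<ε)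
    -- ε = d / (s + d) is below 1, and ε s is below d
    fraction : ∀ {s d i} → 0ℚ < s → 0ℚ < d → 0ℚ < i → (s + d) * i ≡ 1ℚ →
      d * i < 1ℚ × d * i * s < d
    fraction {s} {d} {i} 0<s 0<d 0<i inv≡1 =
        subst (d * i <_) inv≡1 (*-mono-<ʳ 0<i
          (subst (_< s + d) (+-identityˡ d) (+-monoˡ-< d 0<s)))
      , (begin-strict
          d * i * s         <⟨ *-mono-<ˡ (*-pos 0<d 0<i)
                                (subst (_< s + d) (+-identityʳ s) (+-monoʳ-< s 0<d)) ⟩
          d * i * (s + d)   ≡⟨ *-assoc d i (s + d) ⟩
          d * (i * (s + d)) ≡⟨ cong (d *_) (trans (*-comm i (s + d)) inv≡1) ⟩
          d * 1ℚ            ≡⟨ *-identityʳ d ⟩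
          d                 ∎)
    main : ∀ d → v - a * b ≡ d → 0ℚ < d →
      ∃[ a′ ] ∃[ b′ ] a < a′ × b < b′ × a′ * b′ < v
    main d d≡ 0<d =
      let s                   = a + b + 1ℚ
          0<s                 = ≤-<-trans (≤-trans 0≤a (p≤p+q a 0≤b)) (p<p+1 (a + b))
          (i , 0<i , inv≡1)   = inverse (<-≤-trans 0<s (p≤p+q s (<⇒≤ 0<d)))
          (ε<1 , εs<d)        = fraction 0<s 0<d 0<i inv≡1
      in with-step (d * i) (*-pos 0<d 0<i) ε<1 (subst (d * i * s <_) (sym d≡) εs<d)

  ^-shrink : ∀ {u y} n → 0ℚ ≤ u → 0ℚ < y → u < y ^ n →
    ∃[ y′ ] 0ℚ < y′ × y′ < y × u < y′ ^ n
  ^-shrink zero 0≤u 0<y u<1 =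
    let (y′ , 0<y′ , y′<y) = <-dense 0<y in y′ , 0<y′ , y′<y , u<1
  ^-shrink {u} {y} (suc n) 0≤u 0<y u<yⁿ⁺¹ =
    let (a , b , 0<a , a<y , b<yⁿ , u<ab) = shrink-factors 0≤u 0<y (^-pos n 0<y) u<yⁿ⁺¹
        0<b = *-cancel-<ʳ (<⇒≤ 0<a)
                (subst₂ _<_ (sym (*-zeroˡ a)) (*-comm a b) (≤-<-trans 0≤u u<ab))
        (c , 0<c , c<y , b<cⁿ) = ^-shrink n (<⇒≤ 0<b) 0<y b<yⁿ
        step : ∀ {m} → 0ℚ < m → m < y → a ≤ m → c ≤ m →
               ∃[ y′ ] 0ℚ < y′ × y′ < y × u < y′ ^ suc n
        step {m} 0<m m<y a≤m c≤m = m , 0<m , m<y , <-≤-trans u<ab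
          (*-mono-≤² (<⇒≤ 0<a) a≤m (<⇒≤ 0<b)
            (≤-trans (<⇒≤ b<cⁿ) (^-mono-≤ n (<⇒≤ 0<c) c≤m)))
    in case-total step (≤-total a c) 0<a a<y 0<c c<y
    where
    case-total : ∀ {a c} {P : Set} → (∀ {m} → 0ℚ < m → m < y → a ≤ m → c ≤ m → P) →
                 a ≤ c ⊎ c ≤ a → 0ℚ < a → a < y → 0ℚ < c → c < y → P
    case-total step (inj₁ a≤c) 0<a a<y 0<c c<y = step 0<c c<y a≤c ≤-refl
    case-total step (inj₂ c≤a) 0<a a<y 0<c c<y = step 0<a a<y ≤-refl c≤a

  ^-grow : ∀ {y v} n → 0ℚ ≤ y → y ^ n < v → ∃[ y′ ] y < y′ × y′ ^ n < v
  ^-grow {y} zero 0≤y 1<v = y + 1ℚ , p<p+1 y , 1<v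
  ^-grow {y} {v} (suc n) 0≤y yⁿ⁺¹<v =
    let (a , b , y<a , yⁿ<b , ab<v) = grow-factors 0≤y (^-nonNeg n 0≤y) yⁿ⁺¹<v
        (c , y<c , cⁿ<b)            = ^-grow n 0≤y yⁿ<b
        step : ∀ {m} → y < m → m ≤ a → m ≤ c → ∃[ y′ ] y < y′ × y′ ^ suc n < v
        step {m} y<m m≤a m≤c = let 0≤m = ≤-trans 0≤y (<⇒≤ y<m) in
          m , y<m , ≤-<-trans
            (*-mono-≤² 0≤m m≤a (^-nonNeg n 0≤m)
              (≤-trans (^-mono-≤ n 0≤m m≤c) (<⇒≤ cⁿ<b))) ab<v
    in case-total step (≤-total a c) y<a y<c
    where
    case-total : ∀ {a c} {P : Set} → (∀ {m} → y < m → m ≤ a → m ≤ c → P) →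
                 a ≤ c ⊎ c ≤ a → y < a → y < c → P
    case-total step (inj₁ a≤c) y<a y<c = step y<a ≤-refl a≤c
    case-total step (inj₂ c≤a) y<a y<c = step y<c c≤a ≤-refl

  -- geometric progressions with ratio above 1 exceed every bound
  geometric : ∀ {ρ y} → 1ℚ < ρ → 0ℚ < y → ∀ m → ∃[ k ] m < ρ ^ k * y
  geometric {ρ} {y} 1<ρ 0<y m = bound (p<q⇒0<q-p 1<ρ) refl
    where
    bound : ∀ {δ} → 0ℚ < δ → ρ - 1ℚ ≡ δ → ∃[ k ] m < ρ ^ k * y
    bound {δ} 0<δ δ≡ =
      let (j , _ , inv≡1) = inverse (*-pos 0<δ 0<y)
          (k , mj<k)      = archimedean (m * j)
      in suc k , (begin-strict
        m                        <⟨ undivide-< {a = fromℕ (suc k)} (*-pos 0<δ 0<y) inv≡1 mj<k ⟩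
        fromℕ (suc k) * (δ * y)  ≡⟨ sym (*-assoc (fromℕ (suc k)) δ y) ⟩
        fromℕ (suc k) * δ * y    ≤⟨ *-monoʳ-≤-nonNeg y {{nonNegative (<⇒≤ 0<y)}} (power (suc k)) ⟩
        ρ ^ suc k * y            ∎)
      where
      open ≤-Reasoning
      open +-*-Solver using (solve; con; _:=_; _:+_; _:-_)
      1+δ≡ρ : 1ℚ + δ ≡ ρ
      1+δ≡ρ = trans (cong (λ z → 1ℚ + z) (sym δ≡))
                    (solve 1 (λ r → con 1ℚ :+ (r :- con 1ℚ) := r) refl ρ)
      power : ∀ k → fromℕ k * δ ≤ ρ ^ k
      power k = begin
        fromℕ k * δ       ≡⟨ sym (+-identityˡ (fromℕ k * δ)) ⟩
        0ℚ + fromℕ k * δ  ≤⟨ +-monoˡ-≤ (fromℕ k * δ) (<⇒≤ 0<1) ⟩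
        1ℚ + fromℕ k * δ  ≤⟨ bernoulli k (subst (0ℚ ≤_) (sym 1+δ≡ρ) (<⇒≤ (<-trans 0<1 1<ρ))) ⟩
        (1ℚ + δ) ^ k      ≡⟨ cong (_^ k) 1+δ≡ρ ⟩
        ρ ^ k             ∎

  -- n-th powers are dense among the nonnegative rationals
  ^-dense : ∀ {u v} n → 0ℚ ≤ u → u < v → ∃[ y ] 0ℚ < y × u < y ^ suc n × y ^ suc n < v
  ^-dense {u} {v} n 0≤u u<v = start (^-grow N ≤-refl
      (subst (_< v) (sym (*-zeroˡ (0ℚ ^ n))) (≤-<-trans 0≤u u<v)))
    where
    N = suc n
    Between = ∃[ y ] 0ℚ < y × u < y ^ N × y ^ N < v
    large : ∀ {y} → 1ℚ + u < y → u < y ^ suc n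
    large {y} 1+u<y = <-≤-trans
      (<-trans (subst (u <_) (+-comm u 1ℚ) (p<p+1 u)) 1+u<y)
      (x≤x^n n (≤-trans (p≤p+q 1ℚ 0≤u) (<⇒≤ 1+u<y)))
    search : ∀ {ρ} → 0ℚ < ρ → ρ ^ suc n * u < v →
      ∀ k {y} → 0ℚ < y → y ^ suc n < v → 1ℚ + u < ρ ^ k * y →
      Between
    search 0<ρ ρⁿu<v zero {y} 0<y yⁿ<v bound =
      y , 0<y , large (subst (1ℚ + u <_) (*-identityˡ y) bound) , yⁿ<v
    search {ρ} 0<ρ ρⁿu<v (suc k) {y} 0<y yⁿ<v bound with u <? y ^ suc n
    ... | yes u<yⁿ = y , 0<y , u<yⁿ , yⁿ<v
    ... | no  u≮yⁿ = search 0<ρ ρⁿu<v k (*-pos 0<ρ 0<y)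
        (subst (_< v) (sym (CExp.^-distrib-* ρ y (suc n)))
          (≤-<-trans (*-monoˡ-≤-nonNeg (ρ ^ suc n)
                       {{nonNegative (^-nonNeg (suc n) (<⇒≤ 0<ρ))}} (≮⇒≥ u≮yⁿ)) ρⁿu<v))
        (subst (1ℚ + u <_)
          (trans (cong (_* y) (*-comm ρ (ρ ^ k))) (*-assoc (ρ ^ k) ρ y)) bound)
    above : ∀ {y} → 0ℚ < y → y ^ N < v → 0ℚ < u → Between
    above {y} 0<y yⁿ<v 0<u =
      let (i , 0<i , ui≡1)    = inverse 0<u
          1<vi                = subst (_< v * i) ui≡1 (*-mono-<ʳ 0<i u<v)
          (ρ , 1<ρ , ρⁿ<vi)   = ^-grow N (<⇒≤ 0<1) (subst (_< v * i) (sym (1^n≡1 N)) 1<vi)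
          ρⁿu<v               = subst (ρ ^ N * u <_)
            (trans (*-assoc v i u) (trans (cong (v *_) (trans (*-comm i u) ui≡1)) (*-identityʳ v)))
            (*-mono-<ʳ 0<u ρⁿ<vi)
          (k , 1+u<ρᵏy)       = geometric 1<ρ 0<y (1ℚ + u)
      in search (<-trans 0<1 1<ρ) ρⁿu<v k 0<y yⁿ<v 1+u<ρᵏy
    start : ∃[ y ] 0ℚ < y × y ^ N < v → Between
    start (y , 0<y , yⁿ<v) with u <? y ^ N
    ... | yes u<yⁿ = y , 0<y , u<yⁿ , yⁿ<v
    ... | no  u≮yⁿ = above 0<y yⁿ<v (<-≤-trans (^-pos N 0<y) (≮⇒≥ u≮yⁿ))


  ^-between : ∀ {p q} m n .{{_ : ℕ.NonZero m}} .{{_ : ℕ.NonZero n}} → 0ℚ ≤ p → p < q →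
    ∃[ s ] ∃[ t ] 0ℚ < s × s < t × p ^ n < s ^ m × t ^ m < q ^ n
  ^-between (suc m) (suc n) 0≤p p<q =
    let (s , 0<s , pⁿ<sᵐ , sᵐ<qⁿ) = ^-dense m (^-nonNeg (suc n) 0≤p) (^-mono-< n 0≤p p<q)
        (t , s<t , tᵐ<qⁿ)         = ^-grow (suc m) (<⇒≤ 0<s) sᵐ<qⁿ
    in s , t , 0<s , s<t , pⁿ<sᵐ , tᵐ<qⁿ

  y<⟨y+1⟩ⁿ : ∀ {y} n .{{_ : ℕ.NonZero n}} → 0ℚ ≤ y → 0ℚ < y + 1ℚ × y < (y + 1ℚ) ^ n
  y<⟨y+1⟩ⁿ {y} (suc n) 0≤y = <-≤-trans 0<1 1≤x , <-≤-trans (p<p+1 y) (x≤x^n n 1≤x)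
    where
    1≤x : 1ℚ ≤ y + 1ℚ
    1≤x = subst (1ℚ ≤_) (+-comm 1ℚ y) (p≤p+q 1ℚ 0≤y)

open Auxiliary

-- Two-sided, located Dedekind cuts of rationals.

record ℝ : Set₁ where
  field
    L U         : Pred ℚ 0ℓ
    L-inhabited : ∃ L
    U-inhabited : ∃ U
    L-open      : ∀ {p} → L p → ∃[ q ] p < q × L q
    U-open      : ∀ {q} → U q → ∃[ p ] p < q × U p
    disjoint    : ∀ {q} → L q → U q → ⊥
    located     : ∀ {p q} → p < q → L p ⊎ U q

  L-down : ∀ {p q} → p < q → L q → L p
  L-down p<q Lq with located p<q
  ... | inj₁ Lp = Lp
  ... | inj₂ Uq = ⊥-elim (disjoint Lq Uq)

  U-up : ∀ {p q} → p < q → U p → U q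
  U-up p<q Up with located p<q
  ... | inj₁ Lp = ⊥-elim (disjoint Lp Up)
  ... | inj₂ Uq = Uq

  L<U : ∀ {p q} → L p → U q → p < q
  L<U {p} {q} Lp Uq with p <? q
  ... | yes p<q = p<q
  ... | no  p≮q with p ≟ q
  ...   | yes p≡q = ⊥-elim (disjoint Lp (subst U (sym p≡q) Uq))
  ...   | no  p≢q = ⊥-elim (disjoint (L-down (≤∧≢⇒< (≮⇒≥ p≮q) (p≢q ∘ sym)) Lp) Uq)
    where
    ≤∧≢⇒< : ∀ {p q} → p ≤ q → p ≢ q → p < q
    ≤∧≢⇒< {p} {q} p≤q p≢q with p <? q
    ... | yes p<q = p<q
    ... | no  p≮q = ⊥-elim (p≢q (≤-antisym p≤q (≮⇒≥ p≮q)))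

open ℝ

infix 4 _≤ℝ_

_≤ℝ_ : ℝ → ℝ → Set
x ≤ℝ y = ∀ {q} → L x q → L y q

Positiveℝ : ℝ → Set
Positiveℝ x = L x 0ℚ

fromℚ : ℚ → ℝ
fromℚ r = record
  { L           = _< r
  ; U           = r <_
  ; L-inhabited = r - 1ℚ , 0<q-p⇒p<q (subst (0ℚ <_) (sym (r-[r-1]≡1 r)) 0<1)
  ; U-inhabited = r + 1ℚ , p<p+1 r
  ; L-open      = <-dense
  ; U-open      = λ r<q → let (p , r<p , p<q) = <-dense r<q in p , p<q , r<p
  ; disjoint    = <-asym
  ; located     = located′
  }
  where
  r-[r-1]≡1 : ∀ r → r - (r - 1ℚ) ≡ 1ℚ
  r-[r-1]≡1 = solve 1 (λ r → r :- (r :- con 1ℚ) := con 1ℚ) refl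
    where open +-*-Solver using (solve; con; _:=_; _:-_)
  located′ : ∀ {p q} → p < q → p < r ⊎ r < q
  located′ {p} p<q with p <? r
  ... | yes p<r = inj₁ p<r
  ... | no  p≮r = inj₂ (≤-<-trans (≮⇒≥ p≮r) p<q)

infixr 7 _•_

_•_ : (c : ℚ) .{{_ : Positive c}} → ℝ → ℝ
c • x = record
  { L           = λ q → L x (c⁻¹ * q)
  ; U           = λ q → U x (c⁻¹ * q)
  ; L-inhabited = let (p , Lp) = L-inhabited x in c * p , subst (L x) (sym (c⁻¹c p)) Lp
  ; U-inhabited = let (p , Up) = U-inhabited x in c * p , subst (U x) (sym (c⁻¹c p)) Up
  ; L-open      = λ {p} Lp → let (q , p<q , Lq) = L-open x Lp in
                  c * q , subst (_< c * q) (cc⁻¹ p) (scale p<q) , subst (L x) (sym (c⁻¹c q)) Lq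
  ; U-open      = λ {q} Uq → let (p , p<q , Up) = U-open x Uq in
                  c * p , subst (c * p <_) (cc⁻¹ q) (scale p<q) , subst (U x) (sym (c⁻¹c p)) Up
  ; disjoint    = disjoint x
  ; located     = λ p<q → located x (*-monoʳ-<-pos c⁻¹ {{1/pos⇒pos c}} p<q)
  }
  where
  instance
    c≢0 : NonZero c
    c≢0 = pos⇒nonZero c
  c⁻¹ = 1/ c
  c⁻¹c : ∀ q → c⁻¹ * (c * q) ≡ q
  c⁻¹c q = trans (sym (*-assoc c⁻¹ c q)) (trans (cong (_* q) (*-inverseˡ c)) (*-identityˡ q))
  cc⁻¹ : ∀ q → c * (c⁻¹ * q) ≡ q
  cc⁻¹ q = trans (sym (*-assoc c c⁻¹ q)) (trans (cong (_* q) (*-inverseʳ c)) (*-identityˡ q))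
  scale : ∀ {p q} → p < q → c * p < c * q
  scale = *-monoʳ-<-pos c

-- With n = suc k, (1 + q/n)ⁿ increases to exp q from the first n with
-- 1 + q/n > 0 on, and (1 - q/n)⁻ⁿ decreases to exp q from the first n with
-- 1 - q/n > 0 on.  Hence these relations say b < exp q and exp q < b, and
-- log B below is the cut at which exp q passes B.

infix 4 _<exp_ exp_<_

_<exp_ : ℚ → ℚ → Set
b <exp q = ∃[ k ] let y = 1ℚ + q * (+ 1 / suc k) in 0ℚ < y × b < y ^ suc k

exp_<_ : ℚ → ℚ → Set
exp q < b = ∃[ k ] let y = 1ℚ - q * (+ 1 / suc k) in 0ℚ < y × 1ℚ < b * y ^ suc k

module Logarithm where

  ratio-cancel : ∀ k x → x * fromℕ (suc k) * (+ 1 / suc k) ≡ x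
  ratio-cancel k x = trans (*-assoc x (fromℕ (suc k)) (+ 1 / suc k))
    (trans (cong (x *_) (fromℕ-inverse k)) (*-identityʳ x))

  <exp-open : ∀ {b q} → 0ℚ ≤ b → b <exp q → ∃[ p ] p < q × b <exp p
  <exp-open {b} {q} 0≤b (k , 0<y , b<yⁿ) = go (^-shrink (suc k) 0≤b 0<y b<yⁿ)
    where
    e = + 1 / suc k
    go : ∃[ y′ ] 0ℚ < y′ × y′ < 1ℚ + q * e × b < y′ ^ suc k → ∃[ p ] p < q × b <exp p
    go (y′ , 0<y′ , y′<y , b<y′ⁿ) =
        (y′ - 1ℚ) * fromℕ (suc k)
      , *-cancel-<ʳ (<⇒≤ (0<1/suc k)) (subst₂ _<_ (sym (ratio-cancel k (y′ - 1ℚ))) (drop (q * e))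
          (+-monoˡ-< (- 1ℚ) y′<y))
      , k , subst (0ℚ <_) (sym restore) 0<y′
          , subst (λ z → b < z ^ suc k) (sym restore) b<y′ⁿ
      where
      open +-*-Solver using (solve; con; _:=_; _:+_; _:-_)
      drop : ∀ z → 1ℚ + z - 1ℚ ≡ z
      drop = solve 1 (λ z → con 1ℚ :+ z :- con 1ℚ := z) refl
      restore : 1ℚ + (y′ - 1ℚ) * fromℕ (suc k) * e ≡ y′
      restore = trans (cong (λ z → 1ℚ + z) (ratio-cancel k (y′ - 1ℚ)))
        (solve 1 (λ y → con 1ℚ :+ (y :- con 1ℚ) := y) refl y′)

  exp<-pos : ∀ {q b} → exp q < b → 0ℚ < b
  exp<-pos {q} {b} (k , 0<y , 1<byⁿ) = *-cancel-<ʳ (<⇒≤ 0<yⁿ)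
    (subst (_< b * yⁿ) (sym (*-zeroˡ yⁿ)) (<-trans 0<1 1<byⁿ))
    where
    yⁿ   = (1ℚ - q * (+ 1 / suc k)) ^ suc k
    0<yⁿ = ^-pos (suc k) 0<y

  -- exp q < b  is  b⁻¹ < exp (- q)
  exp<⇒<exp : ∀ {q b i} → 0ℚ < i → b * i ≡ 1ℚ → exp q < b → i <exp (- q)
  exp<⇒<exp {q} {b} {i} 0<i bi≡1 (k , 0<y , 1<byⁿ) =
    k , subst (0ℚ <_) y≡ 0<y ,
    subst (λ z → i < z ^ suc k) y≡ (subst (_< y ^ suc k) (*-identityˡ i)
      (divide-< 0<i bi≡1 (subst (1ℚ <_) (*-comm b (y ^ suc k)) 1<byⁿ)))
    where
    y = 1ℚ - q * (+ 1 / suc k)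
    y≡ : y ≡ 1ℚ + (- q) * (+ 1 / suc k)
    y≡ = cong (λ z → 1ℚ + z) (neg-distribˡ-* q (+ 1 / suc k))

  <exp⇒exp< : ∀ {q b i} → 0ℚ < b → b * i ≡ 1ℚ → i <exp q → exp (- q) < b
  <exp⇒exp< {q} {b} {i} 0<b bi≡1 (k , 0<y , i<yⁿ) =
    k , subst (0ℚ <_) y≡ 0<y ,
    subst (λ z → 1ℚ < b * z ^ suc k) y≡ (subst (_< b * y ^ suc k) bi≡1 (*-mono-<ˡ 0<b i<yⁿ))
    where
    y = 1ℚ + q * (+ 1 / suc k)
    neg-neg : ∀ z → z ≡ - (- z)
    neg-neg = solve 1 (λ z → z := :- (:- z)) refl
      where open +-*-Solver using (solve; _:=_; :-_)
    y≡ : y ≡ 1ℚ - (- q) * (+ 1 / suc k)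
    y≡ = cong (λ z → 1ℚ + z) (trans (neg-neg _)
           (cong -_ (neg-distribˡ-* q (+ 1 / suc k))))

  exp<-open : ∀ {q b} → exp q < b → ∃[ p ] q < p × exp p < b
  exp<-open {q} {b} eq<b = go (inverse (exp<-pos {q} {b} eq<b))
    where
    go : ∃[ i ] 0ℚ < i × b * i ≡ 1ℚ → ∃[ p ] q < p × exp p < b
    go (i , 0<i , bi≡1) =
      let (p , p<-q , i<ep) = <exp-open {i} { - q} (<⇒≤ 0<i) (exp<⇒<exp {q} {b} 0<i bi≡1 eq<b) in
      - p , subst (_< - p) (neg-neg q) (neg-antimono-< p<-q) ,
      <exp⇒exp< {p} {b} {i} (exp<-pos {q} {b} eq<b) bi≡1 i<ep
      where
      neg-neg : ∀ z → - (- z) ≡ z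
      neg-neg = solve 1 (λ z → :- (:- z) := z) refl
        where open +-*-Solver using (solve; _:=_; :-_)

  -- (1 + q/m)ᵐ (1 - q/n)ⁿ ≤ 1, by passing to the exponent m n in both factors
  exp-bounds : ∀ {q a b} → a <exp q → exp q < b → 0ℚ < a → a < b
  exp-bounds {q} {a} {b} (j , 0<y , a<yᵐ) eq<b@(k , 0<z , 1<bzⁿ) 0<a =
    *-cancel-<ʳ (<⇒≤ 0<zⁿ) (begin-strict
      a * z ^ n             <⟨ *-mono-<ʳ 0<zⁿ a<yᵐ ⟩
      y ^ m * z ^ n         ≤⟨ *-mono-≤² (^-nonNeg m (<⇒≤ 0<y)) (lift j k q 0<y)
                                (^-nonNeg n (<⇒≤ 0<z)) zⁿ≤ ⟩
      (1ℚ + t) ^ N * (1ℚ - t) ^ N  ≡⟨ sym (CExp.^-distrib-* (1ℚ + t) (1ℚ - t) N) ⟩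
      ((1ℚ + t) * (1ℚ - t)) ^ N    ≤⟨ ^-mono-≤ N (*-nonNeg 0≤1+t 0≤1-t) square ⟩
      1ℚ ^ N                ≡⟨ 1^n≡1 N ⟩
      1ℚ                    <⟨ 1<bzⁿ ⟩
      b * z ^ n             ∎)
    where
    open ≤-Reasoning
    m = suc j
    n = suc k
    N = m ℕ.* n
    d = + 1 / m
    e = + 1 / n
    y = 1ℚ + q * d
    z = 1ℚ - q * e
    t = q * d * e
    0<zⁿ = ^-pos n 0<z
    convex : ∀ i {x} → 0ℚ < 1ℚ + x → 0ℚ < 1ℚ + x * (+ 1 / suc i)
    convex i {x} 0<1+x with ≤-total 0ℚ x
    ... | inj₁ 0≤x = <-≤-trans 0<1 (p≤p+q 1ℚ (*-nonNeg 0≤x (<⇒≤ (0<1/suc i))))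
    ... | inj₂ x≤0 = <-≤-trans 0<1+x (+-monoʳ-≤ 1ℚ
        (subst (_≤ x * f) (*-identityʳ x)
          (*-monoˡ-≤-nonPos x {{nonPositive x≤0}} f≤1)))
      where
      f = + 1 / suc i
      f≤1 : f ≤ 1ℚ
      f≤1 = subst₂ _≤_ (*-identityˡ f) (fromℕ-inverse i)
        (*-monoʳ-≤-nonNeg f {{nonNegative (<⇒≤ (0<1/suc i))}}
          (subst (1ℚ ≤_) (sym (fromℕ-suc i)) (p≤p+q 1ℚ (0≤fromℕ i))))
    -- Bernoulli's inequality, raised to the power suc j
    lift : ∀ j k q → 0ℚ < 1ℚ + q * (+ 1 / suc j) →
      (1ℚ + q * (+ 1 / suc j)) ^ suc j ≤
      (1ℚ + q * (+ 1 / suc j) * (+ 1 / suc k)) ^ (suc j ℕ.* suc k)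
    lift j k q 0<y = subst (v ^ suc j ≤_) (trans (Exp.^-assocʳ w (suc k) (suc j))
        (cong (w ^_) (ℕ.*-comm (suc k) (suc j))))
      (^-mono-≤ (suc j) (<⇒≤ 0<y)
        (subst (_≤ w ^ suc k) bern (bernoulli (suc k) (<⇒≤ (convex k {x} 0<y)))))
      where
      x = q * (+ 1 / suc j)
      v = 1ℚ + x
      w = 1ℚ + x * (+ 1 / suc k)
      bern : 1ℚ + fromℕ (suc k) * (x * (+ 1 / suc k)) ≡ v
      bern = cong (λ z → 1ℚ + z) (trans (sym (*-assoc (fromℕ (suc k)) x (+ 1 / suc k)))
        (trans (cong (_* (+ 1 / suc k)) (*-comm (fromℕ (suc k)) x)) (ratio-cancel k x)))
    z≡ : z ≡ 1ℚ + (- q) * e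
    z≡ = cong (λ s → 1ℚ + s) (neg-distribˡ-* q e)
    t≡ : 1ℚ + (- q) * e * d ≡ 1ℚ - t
    t≡ = cong (λ s → 1ℚ + s)
      (solve 3 (λ q d e → (:- q) :* e :* d := :- (q :* d :* e)) refl q d e)
      where open +-*-Solver using (solve; _:=_; _:*_; :-_)
    0<z′ : 0ℚ < 1ℚ + (- q) * e
    0<z′ = subst (0ℚ <_) z≡ 0<z
    zⁿ≤ : z ^ n ≤ (1ℚ - t) ^ N
    zⁿ≤ = subst₂ _≤_ (cong (_^ n) (sym z≡)) (cong₂ _^_ t≡ (ℕ.*-comm n m)) (lift k j (- q) 0<z′)
    0≤1+t : 0ℚ ≤ 1ℚ + t
    0≤1+t = <⇒≤ (convex k {q * d} 0<y)
    0≤1-t : 0ℚ ≤ 1ℚ - t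
    0≤1-t = subst (0ℚ ≤_) t≡ (<⇒≤ (convex j {(- q) * e} 0<z′))
    square : (1ℚ + t) * (1ℚ - t) ≤ 1ℚ
    square = subst ((1ℚ + t) * (1ℚ - t) ≤_) (difference t) (p≤p+q _ (0≤x² t))
      where
      difference : ∀ t → (1ℚ + t) * (1ℚ - t) + t * t ≡ 1ℚ
      difference = solve 1 (λ t → (con 1ℚ :+ t) :* (con 1ℚ :- t) :+ t :* t := con 1ℚ) refl
        where open +-*-Solver using (solve; con; _:=_; _:+_; _:*_; _:-_)

  Gap : ℚ → ℚ → ℚ → Set
  Gap p q e = 0ℚ < 1ℚ + q * e × 0ℚ < 1ℚ - p * e × 1ℚ < (1ℚ + q * e) * (1ℚ - p * e)

  gap-at : ∀ {p q e i} → 0ℚ < e → p < q → 0ℚ < i → (q - p) * i ≡ 1ℚ →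
    (∣ q ∣ + ∣ p ∣ + ∣ p * q ∣ * i) * e < 1ℚ → Gap p q e
  gap-at {p} {q} {e} {i} 0<e p<q 0<i di≡1 Me<1 = 0<y , 0<z , 1<yz
    where
    open +-*-Solver using (solve; con; _:=_; _:+_; _:*_; _:-_; :-_)
    A = ∣ q ∣
    B = ∣ p ∣
    C = ∣ p * q ∣ * i
    0≤C : 0ℚ ≤ C
    0≤C = *-nonNeg (0≤∣p∣ (p * q)) (<⇒≤ 0<i)
    A≤ : A ≤ A + B + C
    A≤ = ≤-trans (p≤p+q A (0≤∣p∣ p)) (p≤p+q (A + B) 0≤C)
    B≤ : B ≤ A + B + C
    B≤ = ≤-trans (subst (B ≤_) (+-comm B A) (p≤p+q B (0≤∣p∣ q))) (p≤p+q (A + B) 0≤C)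
    C≤ : C ≤ A + B + C
    C≤ = subst (C ≤_) (+-comm C (A + B)) (p≤p+q C (≤-trans (0≤∣p∣ q) (p≤p+q A (0≤∣p∣ p))))
    small : ∀ {x} → x ≤ A + B + C → x * e < 1ℚ
    small x≤M = ≤-<-trans (*-monoʳ-≤-nonNeg e {{nonNegative (<⇒≤ 0<e)}} x≤M) Me<1
    neg-neg : ∀ q e → - (- q * e) ≡ q * e
    neg-neg = solve 2 (λ q e → :- (:- q :* e) := q :* e) refl
    0<y : 0ℚ < 1ℚ + q * e
    0<y = subst (λ s → 0ℚ < 1ℚ + s) (neg-neg q e)
            (p<q⇒0<q-p (small (≤-trans (-p≤∣p∣ q) A≤)))
    0<z : 0ℚ < 1ℚ - p * e
    0<z = p<q⇒0<q-p (small (≤-trans (p≤∣p∣ p) B≤))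
    swap : ∀ s i e → s * i * e ≡ s * e * i
    swap = solve 3 (λ s i e → s :* i :* e := s :* e :* i) refl
    pqe<d : p * q * e < q - p
    pqe<d = subst (p * q * e <_) (*-identityˡ (q - p))
      (undivide-< {a = 1ℚ} (p<q⇒0<q-p p<q) di≡1
        (subst (_< 1ℚ) (swap (p * q) i e)
          (small (≤-trans (*-monoʳ-≤-nonNeg i {{nonNegative (<⇒≤ 0<i)}} (p≤∣p∣ (p * q))) C≤))))
    expand : ∀ p q e → 1ℚ + e * (q - p - p * q * e) ≡ (1ℚ + q * e) * (1ℚ - p * e)
    expand = solve 3 (λ p q e → con 1ℚ :+ e :* (q :- p :- p :* q :* e)
               := (con 1ℚ :+ q :* e) :* (con 1ℚ :- p :* e)) refl
    1<yz : 1ℚ < (1ℚ + q * e) * (1ℚ - p * e)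
    1<yz = subst₂ _<_ (+-identityʳ 1ℚ) (expand p q e)
      (+-monoʳ-< 1ℚ (*-pos 0<e (p<q⇒0<q-p pqe<d)))

  -- some n has (1 + q/n) (1 - p/n) > 1 with both factors positive
  gap : ∀ {p q} → p < q → ∃[ k ] Gap p q (+ 1 / suc k)
  gap {p} {q} p<q =
    let (i , 0<i , di≡1) = inverse (p<q⇒0<q-p p<q)
        (k , M<n)        = archimedean (∣ q ∣ + ∣ p ∣ + ∣ p * q ∣ * i)
    in k , gap-at (0<1/suc k) p<q 0<i di≡1
             (subst ((∣ q ∣ + ∣ p ∣ + ∣ p * q ∣ * i) * (+ 1 / suc k) <_) (fromℕ-inverse k) (*-mono-<ʳ (0<1/suc k) M<n))

  separate : ∀ {p q} → p < q → ∃[ s ] ∃[ t ] s < t × exp p < s × t <exp q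
  separate {p} {q} p<q = let (k , 0<y , 0<z , 1<yz) = gap p<q in powers k 0<y 0<z 1<yz
    where
    powers : ∀ k → let e = + 1 / suc k in 0ℚ < 1ℚ + q * e → 0ℚ < 1ℚ - p * e →
      1ℚ < (1ℚ + q * e) * (1ℚ - p * e) → ∃[ s ] ∃[ t ] s < t × exp p < s × t <exp q
    powers k 0<y 0<z 1<yz = main (inverse (^-pos n 0<z))
      where
      n = suc k
      y = 1ℚ + q * (+ 1 / n)
      z = 1ℚ - p * (+ 1 / n)
      1<yⁿzⁿ : 1ℚ < y ^ n * z ^ n
      1<yⁿzⁿ = subst₂ _<_ (1^n≡1 n) (CExp.^-distrib-* y z n) (^-mono-< k (<⇒≤ 0<1) 1<yz)
      main : ∃[ i ] 0ℚ < i × z ^ n * i ≡ 1ℚ → ∃[ s ] ∃[ t ] s < t × exp p < s × t <exp q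
      main (i , 0<i , zi≡1) =
        let (s , i<s , s<yⁿ) = <-dense (divide-< {a = y ^ n} 0<i zi≡1 1<yⁿzⁿ)
            (t , s<t , t<yⁿ) = <-dense s<yⁿ
        in s , t , s<t , (k , 0<z , undivide-< {a = s} (^-pos n 0<z) zi≡1 i<s) , (k , 0<y , t<yⁿ)

log : (B : ℝ) → Positiveℝ B → ℝ
log B 0<B = record
  { L           = λ q → ∃[ b ] L B b × exp q < b
  ; U           = λ q → ∃[ b ] U B b × b <exp q
  ; L-inhabited = let (b , 0<b , Lb) = L-open B 0<B
                      (i , 0<i , bi≡1) = inverse 0<b
                  in - i , b , Lb , <exp⇒exp< {i} {b} {i} 0<b bi≡1 (linear i 0<i)
  ; U-inhabited = let (b , Ub) = U-inhabited B in b , b , Ub , linear b (L<U B 0<B Ub)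
  ; L-open      = λ {q} (b , Lb , eq<b) → let (p , q<p , ep<b) = exp<-open {q} {b} eq<b in
                  p , q<p , b , Lb , ep<b
  ; U-open      = λ {q} (b , Ub , b<eq) →
                  let (p , p<q , b<ep) = <exp-open {b} {q} (<⇒≤ (L<U B 0<B Ub)) b<eq in
                  p , p<q , b , Ub , b<ep
  ; disjoint    = λ {q} (a , La , eq<a) (b , Ub , b<eq) →
                  <-asym (L<U B La Ub) (exp-bounds {q} {b} {a} b<eq eq<a (L<U B 0<B Ub))
  ; located     = located′
  }
  where
  open Logarithm
  linear : ∀ b → 0ℚ < b → b <exp b
  linear b 0<b = 0 , subst (0ℚ <_) (sym y≡) (<-trans 0<b (p<p+1 b))
                   , subst (b <_) (sym (trans (*-identityʳ _) y≡)) (p<p+1 b)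
    where
    y≡ : 1ℚ + b * (+ 1 / 1) ≡ b + 1ℚ
    y≡ = trans (cong (λ z → 1ℚ + z) (*-identityʳ b)) (+-comm 1ℚ b)
  located′ : ∀ {p q} → p < q → (∃[ b ] L B b × exp p < b) ⊎ (∃[ b ] U B b × b <exp q)
  located′ p<q = let (s , t , s<t , ep<s , t<eq) = separate p<q in
    Sum.map (λ Ls → s , Ls , ep<s) (λ Ut → t , Ut , t<eq) (located B s<t)

-- For x ≥ 0, x < z^(m/n) means xⁿ < zᵐ.  (A negative z is treated as 0.)

infix 8 _^[_/_]

_^[_/_] : ℝ → (m n : ℕ) .{{_ : ℕ.NonZero m}} .{{_ : ℕ.NonZero n}} → ℝ
z ^[ m / n ] = record
  { L           = Lᶻ
  ; U           = Uᶻ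
  ; L-inhabited = - 1ℚ , inj₁ (negative⁻¹ (- 1ℚ))
  ; U-inhabited = U-inh
  ; L-open      = L-op
  ; U-open      = U-op
  ; disjoint    = disj
  ; located     = loc
  }
  where
  Lᶻ Uᶻ : ℚ → Set
  Lᶻ x = x < 0ℚ ⊎ (0ℚ ≤ x × ∃[ y ] 0ℚ ≤ y × L z y × x ^ n < y ^ m)
  Uᶻ x = 0ℚ < x × ∃[ y ] 0ℚ ≤ y × U z y × y ^ m < x ^ n

  U-inh : ∃ Uᶻ
  U-inh =
    let (u , Uu)    = U-inhabited z
        0≤y         = ≤-trans (0≤∣p∣ u) (<⇒≤ (p<p+1 ∣ u ∣))
        (0<x , y<x) = y<⟨y+1⟩ⁿ n (^-nonNeg m 0≤y)
    in _ , 0<x , ∣ u ∣ + 1ℚ , 0≤y , U-up z (≤-<-trans (p≤∣p∣ u) (p<p+1 ∣ u ∣)) Uu , y<x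

  L-op : ∀ {p} → Lᶻ p → ∃[ q ] p < q × Lᶻ q
  L-op (inj₁ x<0) = let (q , x<q , q<0) = <-dense x<0 in q , x<q , inj₁ q<0
  L-op (inj₂ (0≤x , y , 0≤y , Ly , xⁿ<yᵐ)) =
    let (q , x<q , qⁿ<yᵐ) = ^-grow n 0≤x xⁿ<yᵐ in
    q , x<q , inj₂ (≤-trans 0≤x (<⇒≤ x<q) , y , 0≤y , Ly , qⁿ<yᵐ)

  U-op : ∀ {q} → Uᶻ q → ∃[ p ] p < q × Uᶻ p
  U-op (0<x , y , 0≤y , Uy , yᵐ<xⁿ) =
    let (p , 0<p , p<x , yᵐ<pⁿ) = ^-shrink n (^-nonNeg m 0≤y) 0<x yᵐ<xⁿ in
    p , p<x , 0<p , y , 0≤y , Uy , yᵐ<pⁿ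

  disj : ∀ {q} → Lᶻ q → Uᶻ q → ⊥
  disj (inj₁ x<0) (0<x , _) = <-asym x<0 0<x
  disj (inj₂ (_ , a , 0≤a , La , xⁿ<aᵐ)) (_ , b , _ , Ub , bᵐ<xⁿ) =
    <-irrefl refl (<-trans xⁿ<aᵐ (≤-<-trans (^-mono-≤ m 0≤a (<⇒≤ (L<U z La Ub))) bᵐ<xⁿ))

  loc : ∀ {p q} → p < q → Lᶻ p ⊎ Uᶻ q
  loc {p} {q} p<q with p <? 0ℚ
  ... | yes p<0 = inj₁ (inj₁ p<0)
  ... | no  p≮0 =
    let 0≤p                             = ≮⇒≥ p≮0
        (s , t , 0<s , s<t , pⁿ<sᵐ , tᵐ<qⁿ) = ^-between m n 0≤p p<q
    in Sum.map (λ Ls → inj₂ (0≤p , s , <⇒≤ 0<s , Ls , pⁿ<sᵐ))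
               (λ Ut → ≤-<-trans 0≤p p<q , t , <⇒≤ (<-trans 0<s s<t) , Ut , tᵐ<qⁿ)
               (located z s<t)

-- P holds for at least n distinct rationals.  For a set P, a real x satisfies
-- x ≤ #P when x ≤ n for some n with AtLeast P n, and #P ≤ x (in particular P
-- is finite) when n ≤ x for every n with AtLeast P n.  This avoids deciding
-- membership in P, which is impossible for sets bounded by an arbitrary real.

AtLeast : Pred ℚ 0ℓ → ℕ → Set
AtLeast P n = ∃[ ts ] length ts ≡ n × Unique ts × All P ts

-- F(B) ≪ #S(B) and #S(B) ≪ G(B), for functions of a real B > 0.  The constant
-- c may be taken rational because increasing it preserves the inequalities;
-- requiring B > 0 loses nothing, as B₀ is arbitrary.

infix 3 _≪#_ _#≪_

_≪#_ : ((B : ℝ) → Positiveℝ B → ℝ) → (ℝ → Pred ℚ 0ℓ) → Set₁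
F ≪# S = Σ[ c ∈ ℚ ] Σ[ c>0 ∈ Positive c ] Σ[ B₀ ∈ ℝ ]
  ∀ B (B>0 : Positiveℝ B) → B₀ ≤ℝ B →
  ∃[ n ] AtLeast (S B) n × F B B>0 ≤ℝ _•_ c {{c>0}} (fromℚ (fromℕ n))

_#≪_ : (ℝ → Pred ℚ 0ℓ) → ((B : ℝ) → Positiveℝ B → ℝ) → Set₁
S #≪ G = Σ[ c ∈ ℚ ] Σ[ c>0 ∈ Positive c ] Σ[ B₀ ∈ ℝ ]
  ∀ B (B>0 : Positiveℝ B) → B₀ ≤ℝ B →
  ∀ n → AtLeast (S B) n → fromℚ (fromℕ n) ≤ℝ _•_ c {{c>0}} (G B B>0)

-- Elements of ℚ are in lowest terms.
H : ℚ → ℕ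
H q = ℤ.∣ ↥ q ∣ ℕ.⊔ ↧ₙ q

MersennePrime : Pred ℕ 0ℓ
MersennePrime p = Prime p × ∃[ n ] p ≡ 2 ℕ.^ n ℕ.∸ 1

θ : ℕ → ℚ → ℚ
θ q z = z ^ q + 1ℚ

-- (θ_{q_s} ∘ ⋯ ∘ θ_{q_1})(r) for the list q_1, …, q_s
composeθ : ℚ → List ℕ → ℚ
composeθ = foldl (λ z q → θ q z)

MersenneValue : ℚ → Pred ℚ 0ℓ
MersenneValue r t = Σ[ qs ∈ List⁺ ℕ ] All MersennePrime (toList qs) × t ≡ composeθ r (toList qs)

MersenneValuesUpTo : ℚ → ℝ → Pred ℚ 0ℓ
MersenneValuesUpTo r B t = MersenneValue r t × fromℚ (fromℕ (H t)) ≤ℝ B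

-- A word q₁ … q_s of Mersenne primes has a value t at r, and log H(t) is q₁ ⋯ q_s up to constant
-- factors that depend on r only.  So both bounds are about words whose product Q is at most X.
--
-- Upper bound: let w(q) ≥ q^(-14/23) be rational weights of the Mersenne primes with Σ w(q) < 1.
-- The weights of all words, being products of the weights of the letters, have a finite sum, so n
-- distinct words include one of weight O(1/n), whose product Q satisfies n ≪ Q^(14/23).  Only
-- 2ⁿ - 1 with n < 23 are tested for primality; the remaining weights form a geometric progression.
--
-- Lower bound: two words with the same product have different values, which avoids the question
-- whether distinct words have distinct values in general.  Indeed, after removing a common prefix
-- their first letters are q < q′, and if y ≥ 2 then every word with product Q starting with q′ has
-- a value below (y^q′ + 2)^(Q/q′) ≤ (y^q + 1)^(Q/q), which is a lower bound for those starting
-- with q; for y ≤ -2 this is mirrored, the letters being odd.  If y ∈ ℚ is arbitrary, a suitable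
-- prefix leads to one of these two cases.  The words of length k over the seven smallest Mersenne
-- primes have only polynomially many products, but exponential total weight for weights just below
-- q^(-87/143).  Hence M ≥ Q^(87/143) words have the same product Q for some k, and concatenating j
-- of them gives M^j words with product Q^j.
module Submission where

open import Defs
open import Algebra.Bundles using (CommutativeMonoid; CommutativeRing)
import Algebra.Properties.CommutativeSemigroup as CommutativeSemigroupProperties
open import Data.Bool.Base using (Bool; true; false; not; _∧_; T; if_then_else_)
open import Data.Bool.Properties using (T-∧)
open import Data.Empty using (⊥-elim)
open import Data.Integer.Base as ℤ using (+_)
import Data.Integer.Divisibility.Signed as ℤ
import Data.Integer.Properties as ℤ
open import Data.List.Base
  using (List; []; _∷_; _++_; length; map; concat; filter; upTo; cartesianProductWith; foldl)
open import Data.List.Membership.Propositional using (_∈_)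
open import Data.List.Membership.Propositional.Properties
  using ( ∈-∃++; ∈-++⁺ˡ; ∈-++⁺ʳ; ∈-++⁻; ∈-cartesianProductWith⁺; ∈-cartesianProductWith⁻
        ; ∈-map⁺; ∈-map⁻; ∈-upTo⁺; ∈-upTo⁻; ∈-filter⁻)
open import Data.List.NonEmpty.Base using () renaming (_∷_ to _∷⁺_)
open import Data.List.Properties
  using (filter-accept; filter-reject; foldl-++; length-map; length-++; length-upTo; map-upTo; ∷-injective)
open import Data.List.Relation.Unary.All as All using (All; []; _∷_)
import Data.List.Relation.Unary.All.Properties as All
open import Data.List.Relation.Unary.AllPairs using ([]; _∷_)
open import Data.List.Relation.Unary.Any using (here; there)
open import Data.List.Relation.Unary.Unique.Propositional using (Unique)
import Data.List.Relation.Unary.Unique.Propositional.Properties as Unique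
open import Data.Nat.Base as ℕ using (ℕ; zero; suc)
open import Data.Nat.Coprimality as Coprimality using (Coprime; coprime-divisor; 1-coprimeTo)
open import Data.Nat.Divisibility using (divides; ∣-trans; n∣m⇒m%n≡0)
open import Data.Nat.DivMod using (_%_)
open import Data.Nat.ListAction using (sum; product)
open import Data.Nat.ListAction.Properties using (product-++)
open import Data.Nat.Primality
  using ( Prime; prime⇒nonTrivial; ¬prime[0]; ¬prime[1]; composite-≢
        ; _Rough_; 0-rough; 1-rough; 2-rough; ∤⇒rough-suc; rough∧square>⇒prime)
import Data.Nat.Properties as ℕ
open import Data.Product.Base using (∃-syntax; _×_; _,_; proj₁; proj₂)
open import Data.Rational.Base
open import Data.Rational.Properties
open import Data.Rational.Solver using (module +-*-Solver)
import Data.Rational.Unnormalised.Base as ℚᵘ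
import Data.Rational.Unnormalised.Properties as ℚᵘ
open import Data.Sum.Base using (_⊎_; inj₁; inj₂)
open import Function.Base using (_∘_)
open import Function.Bundles using (module Equivalence)
open import Relation.Binary.Definitions using (tri<; tri≈; tri>)
open import Relation.Binary.PropositionalEquality
open import Relation.Nullary using (¬_; yes; no; contradiction)
open import Relation.Nullary.Decidable using (toWitness)
open import Algebra.Definitions.RawSemiring +-*-rawSemiring using (_^_)
open import Algebra.Properties.CommutativeSemiring.Exp
  (CommutativeRing.commutativeSemiring +-*-commutativeRing)
  using (^-homo-*; ^-assocʳ; ^-distrib-*)
open import Data.List.Relation.Unary.Unique.DecPropositional ℕ._≟_ using (unique?)

open Auxiliary
open ℝ

private
  module +-CS   = CommutativeSemigroupProperties (CommutativeMonoid.commutativeSemigroup +-0-commutativeMonoid)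
  module *-CS   = CommutativeSemigroupProperties (CommutativeMonoid.commutativeSemigroup *-1-commutativeMonoid)
  module ℕ-*-CS = CommutativeSemigroupProperties ℕ.*-commutativeSemigroup

private variable
  A B : Set

-- Natural numbers and powers in ℚ

fromℕ-+ : ∀ m n → fromℕ (m ℕ.+ n) ≡ fromℕ m + fromℕ n
fromℕ-+ zero    n = sym (+-identityˡ (fromℕ n))
fromℕ-+ (suc m) n = begin
  fromℕ (suc (m ℕ.+ n))       ≡⟨ fromℕ-suc (m ℕ.+ n) ⟩
  1ℚ + fromℕ (m ℕ.+ n)        ≡⟨ cong (λ z → 1ℚ + z) (fromℕ-+ m n) ⟩
  1ℚ + (fromℕ m + fromℕ n)    ≡⟨ +-assoc 1ℚ (fromℕ m) (fromℕ n) ⟨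
  1ℚ + fromℕ m + fromℕ n      ≡⟨ cong (_+ fromℕ n) (fromℕ-suc m) ⟨
  fromℕ (suc m) + fromℕ n     ∎
  where open ≡-Reasoning

fromℕ-* : ∀ m n → fromℕ (m ℕ.* n) ≡ fromℕ m * fromℕ n
fromℕ-* zero    n = sym (*-zeroˡ (fromℕ n))
fromℕ-* (suc m) n = begin
  fromℕ (n ℕ.+ m ℕ.* n)               ≡⟨ fromℕ-+ n (m ℕ.* n) ⟩
  fromℕ n + fromℕ (m ℕ.* n)           ≡⟨ cong (λ z → fromℕ n + z) (fromℕ-* m n) ⟩
  fromℕ n + fromℕ m * fromℕ n         ≡⟨ cong (_+ fromℕ m * fromℕ n) (*-identityˡ (fromℕ n)) ⟨
  1ℚ * fromℕ n + fromℕ m * fromℕ n    ≡⟨ *-distribʳ-+ (fromℕ n) 1ℚ (fromℕ m) ⟨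
  (1ℚ + fromℕ m) * fromℕ n            ≡⟨ cong (_* fromℕ n) (fromℕ-suc m) ⟨
  fromℕ (suc m) * fromℕ n             ∎
  where open ≡-Reasoning

fromℕ-^ : ∀ m n → fromℕ (m ℕ.^ n) ≡ fromℕ m ^ n
fromℕ-^ m zero    = refl
fromℕ-^ m (suc n) = trans (fromℕ-* m (m ℕ.^ n)) (cong (fromℕ m *_) (fromℕ-^ m n))

fromℕ-mono-≤ : ∀ {m n} → m ℕ.≤ n → fromℕ m ≤ fromℕ n
fromℕ-mono-≤ {m} {n} m≤n = subst (fromℕ m ≤_)
  (trans (sym (fromℕ-+ m (n ℕ.∸ m))) (cong fromℕ (ℕ.m+[n∸m]≡n m≤n)))
  (p≤p+q (fromℕ m) (0≤fromℕ (n ℕ.∸ m)))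

fromℕ-mono-< : ∀ {m n} → m ℕ.< n → fromℕ m < fromℕ n
fromℕ-mono-< {m} m<n = <-≤-trans
  (subst (fromℕ m <_) (trans (+-comm (fromℕ m) 1ℚ) (sym (fromℕ-suc m))) (p<p+1 (fromℕ m)))
  (fromℕ-mono-≤ m<n)

<⇒≱ : ∀ {p q} → p < q → ¬ q ≤ p
<⇒≱ p<q q≤p = <-irrefl refl (<-≤-trans p<q q≤p)

*-monoˡ-≤ : ∀ {a b c} → 0ℚ ≤ c → a ≤ b → c * a ≤ c * b
*-monoˡ-≤ {c = c} 0≤c = *-monoˡ-≤-nonNeg c {{nonNegative 0≤c}}

*-monoʳ-≤ : ∀ {a b c} → 0ℚ ≤ c → a ≤ b → a * c ≤ b * c
*-monoʳ-≤ {c = c} 0≤c = *-monoʳ-≤-nonNeg c {{nonNegative 0≤c}}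

^-cancel-≤ : ∀ {x y} n .{{_ : ℕ.NonZero n}} → 0ℚ ≤ y → x ^ n ≤ y ^ n → x ≤ y
^-cancel-≤ (suc n) 0≤y xⁿ≤yⁿ = ≮⇒≥ λ y<x → <⇒≱ (^-mono-< n 0≤y y<x) xⁿ≤yⁿ

1≤x^n : ∀ {x} n → 1ℚ ≤ x → 1ℚ ≤ x ^ n
1≤x^n {x} n 1≤x = subst (_≤ x ^ n) (1^n≡1 n) (^-mono-≤ n (<⇒≤ 0<1) 1≤x)

x^n≤1 : ∀ {x} n → 0ℚ ≤ x → x ≤ 1ℚ → x ^ n ≤ 1ℚ
x^n≤1 {x} n 0≤x x≤1 = subst (x ^ n ≤_) (1^n≡1 n) (^-mono-≤ n 0≤x x≤1)

^-monoʳ-≤ : ∀ {x m n} → 1ℚ ≤ x → m ℕ.≤ n → x ^ m ≤ x ^ n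
^-monoʳ-≤ {x} {m} {n} 1≤x m≤n = begin
  x ^ m                        ≡⟨ *-identityʳ (x ^ m) ⟨
  x ^ m * 1ℚ                   ≤⟨ *-monoˡ-≤ (^-nonNeg m 0≤x) (1≤x^n (n ℕ.∸ m) 1≤x) ⟩
  x ^ m * x ^ (n ℕ.∸ m)        ≡⟨ ^-homo-* x m (n ℕ.∸ m) ⟨
  x ^ (m ℕ.+ (n ℕ.∸ m))        ≡⟨ cong (x ^_) (ℕ.m+[n∸m]≡n m≤n) ⟩
  x ^ n                        ∎
  where
  open ≤-Reasoning
  0≤x = ≤-trans (<⇒≤ 0<1) 1≤x

^-comm : ∀ x m n → (x ^ m) ^ n ≡ (x ^ n) ^ m
^-comm x m n = trans (^-assocʳ x m n)
  (trans (cong (x ^_) (ℕ.*-comm m n)) (sym (^-assocʳ x n m)))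

-- Since x ≥ 1, the bound x^(e/d) ≤ y survives lowering e/d to m/n; comparing d-th powers avoids
-- fractional exponents. The lower bound passes in this way from 87/143 to 0.60839.
^-exponents-≤ : ∀ {x y} d e m n .{{_ : ℕ.NonZero d}} → 1ℚ ≤ x → 0ℚ ≤ y → m ℕ.* d ℕ.≤ e ℕ.* n →
  x ^ e ≤ y ^ d → x ^ m ≤ y ^ n
^-exponents-≤ {x} {y} d e m n 1≤x 0≤y md≤en xᵉ≤yᵈ = ^-cancel-≤ d (^-nonNeg n 0≤y) (begin
  (x ^ m) ^ d     ≡⟨ ^-assocʳ x m d ⟩
  x ^ (m ℕ.* d)   ≤⟨ ^-monoʳ-≤ 1≤x md≤en ⟩
  x ^ (e ℕ.* n)   ≡⟨ ^-assocʳ x e n ⟨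
  (x ^ e) ^ n     ≤⟨ ^-mono-≤ n (^-nonNeg e (≤-trans (<⇒≤ 0<1) 1≤x)) xᵉ≤yᵈ ⟩
  (y ^ d) ^ n     ≡⟨ ^-comm y d n ⟩
  (y ^ n) ^ d     ∎)
  where open ≤-Reasoning

^-antimonoʳ-≤ : ∀ {x m n} → 0ℚ ≤ x → x ≤ 1ℚ → m ℕ.≤ n → x ^ n ≤ x ^ m
^-antimonoʳ-≤ {x} {m} {n} 0≤x x≤1 m≤n = begin
  x ^ n                        ≡⟨ cong (x ^_) (ℕ.m+[n∸m]≡n m≤n) ⟨
  x ^ (m ℕ.+ (n ℕ.∸ m))        ≡⟨ ^-homo-* x m (n ℕ.∸ m) ⟩
  x ^ m * x ^ (n ℕ.∸ m)        ≤⟨ *-monoˡ-≤ (^-nonNeg m 0≤x) (x^n≤1 (n ℕ.∸ m) 0≤x x≤1) ⟩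
  x ^ m * 1ℚ                   ≡⟨ *-identityʳ (x ^ m) ⟩
  x ^ m                        ∎
  where open ≤-Reasoning

-- The mirrored step, in which e/d is raised to m/n. The upper bound passes in this way from 14/23
-- to 0.60872.
^-exponents-≥ : ∀ {x y} d e m n .{{_ : ℕ.NonZero d}} → 1ℚ ≤ x → 0ℚ ≤ y → e ℕ.* n ℕ.≤ m ℕ.* d →
  y ^ d ≤ x ^ e → y ^ n ≤ x ^ m
^-exponents-≥ {x} {y} d e m n 1≤x 0≤y en≤md yᵈ≤xᵉ = ^-cancel-≤ d (^-nonNeg m (≤-trans (<⇒≤ 0<1) 1≤x)) (begin
  (y ^ n) ^ d     ≡⟨ ^-comm y n d ⟩
  (y ^ d) ^ n     ≤⟨ ^-mono-≤ n (^-nonNeg d 0≤y) yᵈ≤xᵉ ⟩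
  (x ^ e) ^ n     ≡⟨ ^-assocʳ x e n ⟩
  x ^ (e ℕ.* n)   ≤⟨ ^-monoʳ-≤ 1≤x en≤md ⟩
  x ^ (m ℕ.* d)   ≡⟨ ^-assocʳ x m d ⟨
  (x ^ m) ^ d     ∎)
  where open ≤-Reasoning

-- Sums over lists and weighted words

Σ[_] : (A → ℚ) → List A → ℚ
Σ[ f ] []       = 0ℚ
Σ[ f ] (x ∷ xs) = f x + Σ[ f ] xs

Σ-++ : ∀ (f : A → ℚ) xs ys → Σ[ f ] (xs ++ ys) ≡ Σ[ f ] xs + Σ[ f ] ys
Σ-++ f []       ys = sym (+-identityˡ _)
Σ-++ f (x ∷ xs) ys = trans (cong (λ z → f x + z) (Σ-++ f xs ys)) (sym (+-assoc (f x) _ _))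

Σ-map : ∀ (f : B → ℚ) (g : A → B) xs → Σ[ f ] (map g xs) ≡ Σ[ f ∘ g ] xs
Σ-map f g []       = refl
Σ-map f g (x ∷ xs) = cong (λ z → f (g x) + z) (Σ-map f g xs)

Σ-* : ∀ c (f : A → ℚ) xs → Σ[ (λ x → c * f x) ] xs ≡ c * Σ[ f ] xs
Σ-* c f []       = sym (*-zeroʳ c)
Σ-* c f (x ∷ xs) = trans (cong (λ z → c * f x + z) (Σ-* c f xs)) (sym (*-distribˡ-+ c (f x) _))

Σ-mono-≤ : ∀ {f g : A → ℚ} xs → (∀ x → f x ≤ g x) → Σ[ f ] xs ≤ Σ[ g ] xs
Σ-mono-≤ []       f≤g = ≤-refl
Σ-mono-≤ (x ∷ xs) f≤g = +-mono-≤ (f≤g x) (Σ-mono-≤ xs f≤g)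

Σ-nonNeg : ∀ {f : A → ℚ} xs → (∀ x → 0ℚ ≤ f x) → 0ℚ ≤ Σ[ f ] xs
Σ-nonNeg []       0≤f = ≤-refl
Σ-nonNeg (x ∷ xs) 0≤f = +-mono-≤ (0≤f x) (Σ-nonNeg xs 0≤f)

p≤q+p : ∀ p {q} → 0ℚ ≤ q → p ≤ q + p
p≤q+p p {q} 0≤q = subst (p ≤_) (+-comm p q) (p≤p+q p 0≤q)

-- Each step deletes from `ys` the occurrence that accounts for `x`. As `x` does not recur in `xs`,
-- the remaining entries are still found in `as ++ bs`.
Σ-⊆ : ∀ {f : A → ℚ} → (∀ x → 0ℚ ≤ f x) → ∀ {xs} ys → Unique xs → (∀ {x} → x ∈ xs → x ∈ ys) →
  Σ[ f ] xs ≤ Σ[ f ] ys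
Σ-⊆         0≤f {[]}     ys _             _     = Σ-nonNeg ys 0≤f
Σ-⊆ {f = f} 0≤f {x ∷ xs} ys (x∉xs ∷ uniq) xs⊆ys with ∈-∃++ (xs⊆ys (here refl))
... | as , bs , refl = begin
  f x + Σ[ f ] xs                    ≤⟨ +-monoʳ-≤ (f x) (Σ-⊆ 0≤f (as ++ bs) uniq rest) ⟩
  f x + Σ[ f ] (as ++ bs)            ≡⟨ cong (λ z → f x + z) (Σ-++ f as bs) ⟩
  f x + (Σ[ f ] as + Σ[ f ] bs)      ≡⟨ +-CS.x∙yz≈y∙xz (f x) (Σ[ f ] as) (Σ[ f ] bs) ⟩
  Σ[ f ] as + (f x + Σ[ f ] bs)      ≡⟨ Σ-++ f as (x ∷ bs) ⟨
  Σ[ f ] (as ++ x ∷ bs)              ∎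
  where
  open ≤-Reasoning
  rest : ∀ {y} → y ∈ xs → y ∈ as ++ bs
  rest y∈xs with ∈-++⁻ as (xs⊆ys (there y∈xs))
  ... | inj₁ y∈as         = ∈-++⁺ˡ y∈as
  ... | inj₂ (here refl)  = contradiction refl (All.lookup x∉xs y∈xs)
  ... | inj₂ (there y∈bs) = ∈-++⁺ʳ as y∈bs

-- If the head is below θ, the mean over the tail is still at least θ, so a search from the left
-- succeeds.
average : ∀ (f : A → ℚ) θ x xs → θ * fromℕ (length (x ∷ xs)) ≤ Σ[ f ] (x ∷ xs) →
  ∃[ y ] y ∈ x ∷ xs × θ ≤ f y
average f θ x xs total with θ ≤? f x
... | yes θ≤fx = x , here refl , θ≤fx
... | no  θ≰fx with xs
...   | []     = contradiction
  (subst₂ _≤_ (*-identityʳ θ) (+-identityʳ (f x)) total) θ≰fx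
...   | z ∷ zs =
  let (y , y∈ , θ≤fy) = average f θ z zs
        (≮⇒≥ λ Σ<θn → <⇒≱ (subst (f x + Σ[ f ] (z ∷ zs) <_) (sym split)
          (+-mono-< (≰⇒> θ≰fx) Σ<θn)) total)
  in y , there y∈ , θ≤fy
  where
  n = length (z ∷ zs)
  split : θ * fromℕ (suc n) ≡ θ + θ * fromℕ n
  split = trans (cong (θ *_) (fromℕ-suc n)) (trans (*-distribˡ-+ θ 1ℚ (fromℕ n))
    (cong (_+ θ * fromℕ n) (*-identityʳ θ)))

average⁻ : ∀ (f : A → ℚ) θ x xs → Σ[ f ] (x ∷ xs) ≤ θ * fromℕ (length (x ∷ xs)) →
  ∃[ y ] y ∈ x ∷ xs × f y ≤ θ
average⁻ f θ x xs total =
  let (y , y∈ , -θ≤-fy) = average (λ y → - 1ℚ * f y) (- 1ℚ * θ) x xs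
        (subst₂ _≤_ (sym (*-assoc (- 1ℚ) θ _)) (sym (Σ-* (- 1ℚ) f (x ∷ xs)))
          (*-monoˡ-≤-nonPos (- 1ℚ) total))
  in y , y∈ , *-cancelˡ-≤-neg (- 1ℚ) -θ≤-fy

-- Adding `x` enlarges the part of its own class by f(x) and shrinks no other. Only an inequality
-- holds, because `cs` may list a class repeatedly.
pigeonhole : ∀ (f : A → ℚ) → (∀ x → 0ℚ ≤ f x) → ∀ (class : A → ℕ) cs xs → (∀ {x} → x ∈ xs → class x ∈ cs) →
  Σ[ f ] xs ≤ Σ[ (λ c → Σ[ f ] (filter (λ x → class x ℕ.≟ c) xs)) ] cs
pigeonhole f 0≤f class cs []       _    = ≤-reflexive (sym (zeros cs))
  where
  zeros : ∀ (cs : List ℕ) → Σ[ (λ _ → 0ℚ) ] cs ≡ 0ℚ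
  zeros []       = refl
  zeros (c ∷ cs) = trans (+-identityˡ _) (zeros cs)
pigeonhole {A} f 0≤f class cs (x ∷ xs) covered =
  ≤-trans (+-monoʳ-≤ (f x) (pigeonhole f 0≤f class cs xs (covered ∘ there)))
          (insert cs (covered (here refl)))
  where
  part : List A → ℕ → ℚ
  part ys c = Σ[ f ] (filter (λ y → class y ℕ.≟ c) ys)
  part-mono : ∀ c → part xs c ≤ part (x ∷ xs) c
  part-mono c with class x ℕ.≟ c
  ... | yes x∈c = ≤-trans (p≤q+p (part xs c) (0≤f x))
                          (≤-reflexive (cong Σ[ f ] (sym (filter-accept (λ y → class y ℕ.≟ c) x∈c))))
  ... | no  x∉c = ≤-reflexive (cong Σ[ f ] (sym (filter-reject (λ y → class y ℕ.≟ c) x∉c)))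
  part-own : f x + part xs (class x) ≤ part (x ∷ xs) (class x)
  part-own = ≤-reflexive (cong Σ[ f ] (sym (filter-accept (λ y → class y ℕ.≟ class x) {xs = xs} refl)))
  insert : ∀ cs → class x ∈ cs → f x + Σ[ part xs ] cs ≤ Σ[ part (x ∷ xs) ] cs
  insert (c ∷ cs) (here refl) = begin
    f x + (part xs c + Σ[ part xs ] cs)    ≡⟨ +-assoc (f x) _ _ ⟨
    f x + part xs c + Σ[ part xs ] cs      ≤⟨ +-mono-≤ part-own (Σ-mono-≤ cs part-mono) ⟩
    part (x ∷ xs) c + Σ[ part (x ∷ xs) ] cs  ∎
    where open ≤-Reasoning
  insert (c ∷ cs) (there c∈cs) = begin
    f x + (part xs c + Σ[ part xs ] cs)    ≡⟨ +-CS.x∙yz≈y∙xz (f x) (part xs c) (Σ[ part xs ] cs) ⟩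
    part xs c + (f x + Σ[ part xs ] cs)    ≤⟨ +-mono-≤ (part-mono c) (insert cs c∈cs) ⟩
    part (x ∷ xs) c + Σ[ part (x ∷ xs) ] cs  ∎
    where open ≤-Reasoning

-- Multiplicative weights of words and an inequality of Kraft type

weight : (A → ℚ) → List A → ℚ
weight w []      = 1ℚ
weight w (x ∷ u) = w x * weight w u

weight-nonNeg : ∀ {w : A → ℚ} → (∀ x → 0ℚ ≤ w x) → ∀ u → 0ℚ ≤ weight w u
weight-nonNeg 0≤w []      = <⇒≤ 0<1
weight-nonNeg 0≤w (x ∷ u) = *-nonNeg (0≤w x) (weight-nonNeg 0≤w u)

Σ-prepend : ∀ (w : A → ℚ) xs us →
  Σ[ weight w ] (cartesianProductWith _∷_ xs us) ≡ Σ[ w ] xs * Σ[ weight w ] us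
Σ-prepend w []       us = sym (*-zeroˡ (Σ[ weight w ] us))
Σ-prepend w (x ∷ xs) us = begin
  Σ[ weight w ] (map (x ∷_) us ++ cartesianProductWith _∷_ xs us)
    ≡⟨ Σ-++ (weight w) (map (x ∷_) us) _ ⟩
  Σ[ weight w ] (map (x ∷_) us) + Σ[ weight w ] (cartesianProductWith _∷_ xs us)
    ≡⟨ cong₂ _+_ (trans (Σ-map (weight w) (x ∷_) us) (Σ-* (w x) (weight w) us)) (Σ-prepend w xs us) ⟩
  w x * Σ[ weight w ] us + Σ[ w ] xs * Σ[ weight w ] us
    ≡⟨ *-distribʳ-+ (Σ[ weight w ] us) (w x) (Σ[ w ] xs) ⟨
  (w x + Σ[ w ] xs) * Σ[ weight w ] us ∎
  where open ≡-Reasoning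

words : List A → ℕ → List (List A)
words xs zero    = [] ∷ []
words xs (suc k) = cartesianProductWith _∷_ xs (words xs k)

-- Listing the empty word apart gives the total weights S(k) the recursion S(k+1) = 1 + σ S(k),
-- where σ is the total weight of the letters.
words≤ : List A → ℕ → List (List A)
words≤ xs zero    = [] ∷ []
words≤ xs (suc k) = [] ∷ cartesianProductWith _∷_ xs (words≤ xs k)

Σ-words : ∀ (w : A → ℚ) xs k → Σ[ weight w ] (words xs k) ≡ Σ[ w ] xs ^ k
Σ-words w xs zero    = +-identityʳ 1ℚ
Σ-words w xs (suc k) = trans (Σ-prepend w xs (words xs k)) (cong (Σ[ w ] xs *_) (Σ-words w xs k))

-- The hypothesis on K says that K is at least the sum 1 / (1 - σ) of the geometric series
-- with ratio σ = Σ[ w ] xs.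
Σ-words≤ : ∀ {w : A → ℚ} → (∀ x → 0ℚ ≤ w x) → ∀ xs {K} → 0ℚ ≤ K → 1ℚ + Σ[ w ] xs * K ≤ K →
  ∀ k → Σ[ weight w ] (words≤ xs k) ≤ K
Σ-words≤ {w = w} 0≤w xs {K} 0≤K geometric zero = begin
  1ℚ + 0ℚ               ≤⟨ +-monoʳ-≤ 1ℚ (*-nonNeg (Σ-nonNeg xs 0≤w) 0≤K) ⟩
  1ℚ + Σ[ w ] xs * K    ≤⟨ geometric ⟩
  K                     ∎
  where open ≤-Reasoning
Σ-words≤ {w = w} 0≤w xs {K} 0≤K geometric (suc k) = begin
  1ℚ + Σ[ weight w ] (cartesianProductWith _∷_ xs (words≤ xs k))
    ≡⟨ cong (λ z → 1ℚ + z) (Σ-prepend w xs (words≤ xs k)) ⟩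
  1ℚ + Σ[ w ] xs * Σ[ weight w ] (words≤ xs k)
    ≤⟨ +-monoʳ-≤ 1ℚ (*-monoˡ-≤ (Σ-nonNeg xs 0≤w) (Σ-words≤ 0≤w xs 0≤K geometric k)) ⟩
  1ℚ + Σ[ w ] xs * K    ≤⟨ geometric ⟩
  K                     ∎
  where open ≤-Reasoning

∈-words≤ : ∀ {xs : List A} {k u} → All (_∈ xs) u → length u ℕ.≤ k → u ∈ words≤ xs k
∈-words≤ {k = zero}  []           _               = here refl
∈-words≤ {k = suc k} []           _               = here refl
∈-words≤ {k = suc k} (x∈xs ∷ u⊆xs) (ℕ.s≤s length≤k) =
  there (∈-cartesianProductWith⁺ _∷_ x∈xs (∈-words≤ u⊆xs length≤k))

-- The alphabet ℕ is infinite, but finitely many words live over a finite part of it and have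
-- bounded length.
letters-bounded : ∀ (us : List (List ℕ)) → ∃[ N ] ∃[ k ] (∀ {u} → u ∈ us → All (_∈ upTo N) u × length u ℕ.≤ k)
letters-bounded []       = 0 , 0 , λ ()
letters-bounded (u ∷ us) with letters-bounded us
... | N , k , bounded = N ℕ.⊔ bound u , k ℕ.⊔ length u , λ where
    (here refl) → All.map (λ {i} i<b → ∈-upTo⁺ (ℕ.<-≤-trans i<b (ℕ.m≤n⊔m N _))) (below u) , ℕ.m≤n⊔m k _
    (there v∈us) → let (letters , len) = bounded v∈us in
      All.map (λ i∈ → ∈-upTo⁺ (ℕ.<-≤-trans (∈-upTo⁻ i∈) (ℕ.m≤m⊔n N _))) letters , ℕ.≤-trans len (ℕ.m≤m⊔n k _)
  where
  bound : List ℕ → ℕ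
  bound []      = 0
  bound (i ∷ u) = suc i ℕ.⊔ bound u
  below : ∀ u → All (ℕ._< bound u) u
  below []      = []
  below (i ∷ u) = ℕ.m≤m⊔n (suc i) (bound u) ∷ All.map (λ j<b → ℕ.<-≤-trans j<b (ℕ.m≤n⊔m (suc i) (bound u))) (below u)

-- Distinct words occur among all words of bounded length over a finite alphabet, whose total weight
-- is a partial sum of a geometric series. The bound K is uniform in the alphabet and the length.
kraft : ∀ {w : ℕ → ℚ} → (∀ x → 0ℚ ≤ w x) → ∀ {K} → 0ℚ ≤ K → (∀ N → 1ℚ + Σ[ w ] (upTo N) * K ≤ K) →
  ∀ {us} → Unique us → Σ[ weight w ] us ≤ K
kraft 0≤w 0≤K geometric {us} uniq =
  let (N , k , bounded) = letters-bounded us in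
  ≤-trans (Σ-⊆ (weight-nonNeg 0≤w) (words≤ (upTo N) k) uniq
            (λ u∈us → let (letters , len) = bounded u∈us in ∈-words≤ letters len))
          (Σ-words≤ 0≤w (upTo N) 0≤K (geometric N) k)

-- Many words with the same product

length-cartesianProductWith : ∀ {C : Set} (f : A → B → C) xs ys →
  length (cartesianProductWith f xs ys) ≡ length xs ℕ.* length ys
length-cartesianProductWith f []       ys = refl
length-cartesianProductWith f (x ∷ xs) ys = trans (length-++ (map (f x) ys))
  (cong₂ ℕ._+_ (length-map (f x) ys) (length-cartesianProductWith f xs ys))

-- The exponents range independently over 0, ..., k instead of summing to k. This covers the
-- products of all words of length k, and the size (k+1)^(number of letters) is still polynomial in
-- k.
monomials : ℕ → List ℕ → List ℕ
monomials k []       = 1 ∷ []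
monomials k (q ∷ qs) = cartesianProductWith ℕ._*_ (map (q ℕ.^_) (upTo (suc k))) (monomials k qs)

length-monomials : ∀ k qs → length (monomials k qs) ≡ suc k ℕ.^ length qs
length-monomials k []       = refl
length-monomials k (q ∷ qs) = trans (length-cartesianProductWith ℕ._*_ (map (q ℕ.^_) (upTo (suc k))) (monomials k qs))
  (cong₂ ℕ._*_ (trans (length-map (q ℕ.^_) (upTo (suc k))) (length-upTo (suc k))) (length-monomials k qs))

∈-monomials⁺ : ∀ {k i m} q qs → i ℕ.≤ k → m ∈ monomials k qs → q ℕ.^ i ℕ.* m ∈ monomials k (q ∷ qs)
∈-monomials⁺ q qs i≤k m∈ = ∈-cartesianProductWith⁺ ℕ._*_ (∈-map⁺ (q ℕ.^_) (∈-upTo⁺ (ℕ.s≤s i≤k))) m∈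

∈-monomials⁻ : ∀ {k m} q qs → m ∈ monomials k (q ∷ qs) →
  ∃[ i ] ∃[ m′ ] i ℕ.≤ k × m′ ∈ monomials k qs × m ≡ q ℕ.^ i ℕ.* m′
∈-monomials⁻ {k} q qs m∈
  with ∈-cartesianProductWith⁻ ℕ._*_ (map (q ℕ.^_) (upTo (suc k))) (monomials k qs) m∈
... | _ , m′ , power∈ , m′∈ , refl with ∈-map⁻ (q ℕ.^_) power∈
...   | i , i∈ , refl = i , m′ , ℕ.<⇒≤pred (∈-upTo⁻ i∈) , m′∈ , refl

monomials-suc : ∀ {k m} qs → m ∈ monomials k qs → m ∈ monomials (suc k) qs
monomials-suc []       m∈ = m∈
monomials-suc (q ∷ qs) m∈ with ∈-monomials⁻ q qs m∈
... | i , m′ , i≤k , m′∈ , refl = ∈-monomials⁺ q qs (ℕ.m≤n⇒m≤1+n i≤k) (monomials-suc qs m′∈)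

monomials-* : ∀ {k m q} qs → q ∈ qs → m ∈ monomials k qs → q ℕ.* m ∈ monomials (suc k) qs
monomials-* {k} (q ∷ qs) (here refl) m∈ with ∈-monomials⁻ q qs m∈
... | i , m′ , i≤k , m′∈ , refl = subst (_∈ monomials (suc k) (q ∷ qs)) (ℕ.*-assoc q (q ℕ.^ i) m′)
  (∈-monomials⁺ q qs (ℕ.s≤s i≤k) (monomials-suc qs m′∈))
monomials-* {k} {q = q} (p ∷ qs) (there q∈qs) m∈ with ∈-monomials⁻ p qs m∈
... | i , m′ , i≤k , m′∈ , refl = subst (_∈ monomials (suc k) (p ∷ qs)) (ℕ-*-CS.x∙yz≈y∙xz (p ℕ.^ i) q m′)
  (∈-monomials⁺ p qs (ℕ.m≤n⇒m≤1+n i≤k) (monomials-* qs q∈qs m′∈))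

1∈monomials : ∀ qs → 1 ∈ monomials 0 qs
1∈monomials []       = here refl
1∈monomials (q ∷ qs) = ∈-monomials⁺ {i = 0} q qs ℕ.z≤n (1∈monomials qs)

product∈monomials : ∀ {qs u} → All (_∈ qs) u → product u ∈ monomials (length u) qs
product∈monomials {qs} []         = 1∈monomials qs
product∈monomials {qs} (q∈ ∷ u⊆) = monomials-* qs q∈ (product∈monomials u⊆)

words-unique : ∀ {xs : List A} → Unique xs → ∀ k → Unique (words xs k)
words-unique uniq zero    = [] ∷ []
words-unique uniq (suc k) = Unique.cartesianProductWith⁺ _∷_ ∷-injective uniq (words-unique uniq k)

∈-words⁻ : ∀ {xs : List A} k {u} → u ∈ words xs k → length u ≡ k × All (_∈ xs) u
∈-words⁻ zero    (here refl) = refl , []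
∈-words⁻ {xs = xs} (suc k) u∈ with ∈-cartesianProductWith⁻ _∷_ xs (words xs k) u∈
... | x , v , x∈ , v∈ , refl = let (len , v⊆) = ∈-words⁻ k v∈ in cong suc len , x∈ ∷ v⊆

-- The hypothesis is w(q) ≤ q^(-e/d) without fractional exponents. Both sides are multiplicative, so
-- it passes from letters to words.
weight-product : ∀ {w : ℕ → ℚ} {qs : List ℕ} d e → (∀ q → 0ℚ ≤ w q) →
  (∀ {q} → q ∈ qs → w q ^ d * fromℕ q ^ e ≤ 1ℚ) →
  ∀ {u} → All (_∈ qs) u → weight w u ^ d * fromℕ (product u) ^ e ≤ 1ℚ
weight-product d e 0≤w small [] = ≤-reflexive (cong₂ _*_ (1^n≡1 d) (1^n≡1 e))
weight-product {w} d e 0≤w small {q ∷ u} (q∈ ∷ u⊆) = begin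
  (w q * W) ^ d * fromℕ (q ℕ.* product u) ^ e
    ≡⟨ cong₂ _*_ (^-distrib-* (w q) W d) (trans (cong (_^ e) (fromℕ-* q (product u))) (^-distrib-* (fromℕ q) P e)) ⟩
  w q ^ d * W ^ d * (fromℕ q ^ e * P ^ e)
    ≡⟨ *-CS.interchange (w q ^ d) (W ^ d) (fromℕ q ^ e) (P ^ e) ⟩
  w q ^ d * fromℕ q ^ e * (W ^ d * P ^ e)
    ≤⟨ *-mono-≤² (*-nonNeg (^-nonNeg d (0≤w q)) (^-nonNeg e (0≤fromℕ q))) (small q∈)
         (*-nonNeg (^-nonNeg d (weight-nonNeg 0≤w u)) (^-nonNeg e (0≤fromℕ (product u))))
         (weight-product d e 0≤w small u⊆) ⟩
  1ℚ * 1ℚ  ≡⟨ *-identityˡ 1ℚ ⟩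
  1ℚ       ∎
  where
  open ≤-Reasoning
  W = weight w u
  P = fromℕ (product u)

-- Put σ = 1 + δ and n = (p+1) m. Bernoulli's inequality gives σ^n ≥ (m δ)^(p+1), while (n+1)^p ≤
-- ((p+2) m)^p for m ≥ 1, so any such m with (p+2)^p ≤ m δ^(p+1) will do.
exponential-beats-power : ∀ {σ} p → 1ℚ < σ → ∃[ k ] fromℕ (suc (suc k)) ^ p ≤ σ ^ suc k
exponential-beats-power {σ} p 1<σ =
  let δ = σ - 1ℚ
      0<δ = p<q⇒0<q-p 1<σ
      (i , 0<i , inv) = inverse (^-pos (suc p) 0<δ)
      c = fromℕ (suc (suc p)) ^ p
      (k , c*i<m) = archimedean (c * i)
  -- Here m is `suc k`, and the witness is the predecessor of n = (p+1) m.
  in k ℕ.+ p ℕ.* suc k , bound (suc k) (fromℕ-mono-≤ {1} {suc k} (ℕ.s≤s ℕ.z≤n)) (ℕ.s≤s ℕ.z≤n) 0<δ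
       (<⇒≤ (undivide-< {c} {fromℕ (suc k)} {δ ^ suc p} {i} (^-pos (suc p) 0<δ) inv c*i<m))
  where
  open ≤-Reasoning
  open +-*-Solver using (solve; _:=_; _:+_; _:-_; con)
  bound : ∀ m → 1ℚ ≤ fromℕ m → 1 ℕ.≤ m → 0ℚ < σ - 1ℚ →
    fromℕ (suc (suc p)) ^ p ≤ fromℕ m * (σ - 1ℚ) ^ suc p →
    fromℕ (suc (suc p ℕ.* m)) ^ p ≤ σ ^ (suc p ℕ.* m)
  bound m 1≤M 1≤m 0<δ large = begin
    fromℕ (suc (suc p ℕ.* m)) ^ p
      ≤⟨ ^-mono-≤ p (0≤fromℕ (suc (suc p ℕ.* m))) (fromℕ-mono-≤ (ℕ.+-monoˡ-≤ (suc p ℕ.* m) 1≤m)) ⟩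
    fromℕ (suc (suc p) ℕ.* m) ^ p
      ≡⟨ trans (cong (_^ p) (fromℕ-* (suc (suc p)) m)) (^-distrib-* _ M p) ⟩
    fromℕ (suc (suc p)) ^ p * M ^ p
      ≤⟨ *-monoʳ-≤ (^-nonNeg p (0≤fromℕ m)) large ⟩
    M * δ ^ suc p * M ^ p
      ≡⟨ trans (*-assoc M _ _) (trans (cong (M *_) (*-comm _ (M ^ p))) (sym (*-assoc M _ _))) ⟩
    M ^ suc p * δ ^ suc p
      ≡⟨ ^-distrib-* M δ (suc p) ⟨
    (M * δ) ^ suc p
      ≤⟨ ^-mono-≤ (suc p) (*-nonNeg (0≤fromℕ m) (<⇒≤ 0<δ)) (p≤q+p (M * δ) (<⇒≤ 0<1)) ⟩
    (1ℚ + M * δ) ^ suc p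
      ≤⟨ ^-mono-≤ (suc p) (≤-trans (<⇒≤ 0<1) (p≤p+q 1ℚ (*-nonNeg (0≤fromℕ m) (<⇒≤ 0<δ)))) (bernoulli m
           (≤-trans (<⇒≤ 0<1) (p≤p+q 1ℚ (<⇒≤ 0<δ)))) ⟩
    ((1ℚ + δ) ^ m) ^ suc p
      ≡⟨ trans (cong (λ x → (x ^ m) ^ suc p) (solve 1 (λ s → con 1ℚ :+ (s :- con 1ℚ) := s) refl σ))
               (trans (^-assocʳ σ m (suc p)) (cong (σ ^_) (ℕ.*-comm m (suc p)))) ⟩
    σ ^ (suc p ℕ.* m) ∎
    where
    M = fromℕ m
    δ = σ - 1ℚ

-- `numerous` says that at least Q^(e/d) words share the product Q. Their common length makes
-- concatenations of such words uniquely decodable.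
record Block (qs : List ℕ) (d e : ℕ) : Set where
  field
    blocks   : List (List ℕ)
    k Q      : ℕ
    unique   : Unique blocks
    nonEmpty : ∃[ u ] u ∈ blocks
    shape    : ∀ {u} → u ∈ blocks → length u ≡ suc k × All (_∈ qs) u × product u ≡ Q
    numerous : fromℕ Q ^ e ≤ fromℕ (length blocks) ^ d

-- The words of length n fall into at most (n + 1)^(number of letters) classes according to
-- their product.  Their total weight grows exponentially, hence some class has weight at least 1.
block : ∀ {qs : List ℕ} {w : ℕ → ℚ} d e → Unique qs → (∀ q → 0ℚ ≤ w q) →
  (∀ {q} → q ∈ qs → w q ^ d * fromℕ q ^ e ≤ 1ℚ) → 1ℚ < Σ[ w ] qs → Block qs d e
block {qs} {w} d e uniq 0≤w small 1<σ =
  let (k , many) = exponential-beats-power (length qs) 1<σ in build k many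
  where
  open ≤-Reasoning
  build : ∀ k → fromℕ (suc (suc k)) ^ length qs ≤ Σ[ w ] qs ^ suc k → Block qs d e
  build k many = heavy (monomials n qs) refl
    where
    n = suc k
    us = words qs n
    classOf : ℕ → List (List ℕ)
    classOf c = filter (λ u → product u ℕ.≟ c) us
    -- The classes have mean weight at least 1.
    total : 1ℚ * fromℕ (length (monomials n qs)) ≤ Σ[ (λ c → Σ[ weight w ] (classOf c)) ] (monomials n qs)
    total = begin
      1ℚ * fromℕ (length (monomials n qs))  ≡⟨ *-identityˡ _ ⟩
      fromℕ (length (monomials n qs))       ≡⟨ cong fromℕ (length-monomials n qs) ⟩
      fromℕ (suc n ℕ.^ length qs)           ≡⟨ fromℕ-^ (suc n) (length qs) ⟩
      fromℕ (suc n) ^ length qs             ≤⟨ many ⟩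
      Σ[ w ] qs ^ n                         ≡⟨ Σ-words w qs n ⟨
      Σ[ weight w ] us
        ≤⟨ pigeonhole (weight w) (weight-nonNeg 0≤w) product (monomials n qs) us (λ {u} u∈us →
             let (len , u⊆) = ∈-words⁻ {xs = qs} n u∈us in
             subst (λ l → product u ∈ monomials l qs) len (product∈monomials {qs} u⊆)) ⟩
      Σ[ (λ c → Σ[ weight w ] (classOf c)) ] (monomials n qs) ∎
    atLeast : ∀ c v vs → classOf c ≡ v ∷ vs → 1ℚ ≤ Σ[ weight w ] (v ∷ vs) → Block qs d e
    atLeast c v vs eq heavy = record
      { blocks   = classOf c
      ; unique   = Unique.filter⁺ (λ u → product u ℕ.≟ c) (words-unique uniq n)
      ; nonEmpty = v , subst (v ∈_) (sym eq) (here refl)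
      ; shape    = shape
      -- A class of N words with total weight at least 1 contains a word u with N w(u) ≥ 1. As w(u)
      -- ≤ c^(-e/d), it follows that N ≥ c^(e/d).
      ; numerous = subst (λ zs → fromℕ c ^ e ≤ fromℕ (length zs) ^ d) (sym eq)
          (numerous (average (λ u → N * weight w u) 1ℚ v vs (begin
            1ℚ * N                          ≡⟨ *-comm 1ℚ N ⟩
            N * 1ℚ                          ≤⟨ *-monoˡ-≤ (0≤fromℕ (length (v ∷ vs))) heavy ⟩
            N * Σ[ weight w ] (v ∷ vs)      ≡⟨ Σ-* N (weight w) (v ∷ vs) ⟨
            Σ[ (λ u → N * weight w u) ] (v ∷ vs) ∎)))
      }
      where
      N = fromℕ (length (v ∷ vs))
      shape : ∀ {u} → u ∈ classOf c → length u ≡ n × All (_∈ qs) u × product u ≡ c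
      shape u∈ = let (u∈us , u∈c) = ∈-filter⁻ (λ u → product u ℕ.≟ c) u∈
                     (len , u⊆)   = ∈-words⁻ {xs = qs} n u∈us
                 in len , u⊆ , u∈c
      numerous : ∃[ u ] u ∈ v ∷ vs × 1ℚ ≤ N * weight w u → fromℕ c ^ e ≤ N ^ d
      numerous (u , u∈ , 1≤NW) = let (_ , u⊆ , u∈c) = shape (subst (u ∈_) (sym eq) u∈) in begin
        fromℕ c ^ e                   ≡⟨ *-identityˡ _ ⟨
        1ℚ * fromℕ c ^ e              ≤⟨ *-monoʳ-≤ (^-nonNeg e (0≤fromℕ c)) (1≤x^n d 1≤NW) ⟩
        (N * weight w u) ^ d * fromℕ c ^ e
          ≡⟨ trans (cong (_* fromℕ c ^ e) (^-distrib-* N (weight w u) d)) (*-assoc (N ^ d) _ _) ⟩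
        N ^ d * (weight w u ^ d * fromℕ c ^ e)
          ≤⟨ *-monoˡ-≤ (^-nonNeg d (0≤fromℕ (length (v ∷ vs)))) (subst (λ c → weight w u ^ d * fromℕ c ^ e ≤ 1ℚ) u∈c
               (weight-product d e 0≤w small u⊆)) ⟩
        N ^ d * 1ℚ                    ≡⟨ *-identityʳ _ ⟩
        N ^ d                         ∎
    nonEmpty : ∀ c vs → classOf c ≡ vs → 1ℚ ≤ Σ[ weight w ] vs → Block qs d e
    nonEmpty c []       eq 1≤0   = contradiction 1≤0 (<⇒≱ 0<1)
    nonEmpty c (v ∷ vs) eq heavy = atLeast c v vs eq heavy
    heavy : ∀ cs → monomials n qs ≡ cs → Block qs d e
    heavy []       eq = contradiction (trans (sym (length-monomials n qs)) (cong length eq)) (ℕ.≢-nonZero⁻¹ _ {{ℕ.m^n≢0 (suc n) (length qs)}})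
    heavy (c ∷ cs) eq =
      let (c′ , _ , 1≤) = average (λ c → Σ[ weight w ] (classOf c)) 1ℚ c cs
            (subst (λ cs → 1ℚ * fromℕ (length cs) ≤ Σ[ (λ c → Σ[ weight w ] (classOf c)) ] cs) eq total)
      in nonEmpty c′ (classOf c′) refl 1≤

-- Words with the same product have different values

record OddLetter (q : ℕ) : Set where
  constructor odd-letter
  field
    half : ℕ
    form : q ≡ 3 ℕ.+ (half ℕ.+ half)

odd⇒≥2 : ∀ {q} → OddLetter q → 2 ℕ.≤ q
odd⇒≥2 (odd-letter h refl) = ℕ.s≤s (ℕ.s≤s ℕ.z≤n)

0≤2 : 0ℚ ≤ 1ℚ + 1ℚ
0≤2 = <⇒≤ (positive⁻¹ (1ℚ + 1ℚ))

1≤2 : 1ℚ ≤ 1ℚ + 1ℚ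
1≤2 = p≤p+q 1ℚ (<⇒≤ 0<1)

y^n+1≤[y+1]^n : ∀ {y} n → 0ℚ ≤ y → y ^ suc n + 1ℚ ≤ (y + 1ℚ) ^ suc n
y^n+1≤[y+1]^n {y} zero    0≤y = ≤-reflexive (solve 1 (λ y → y :* con 1ℚ :+ con 1ℚ := (y :+ con 1ℚ) :* con 1ℚ) refl y)
  where open +-*-Solver using (solve; _:=_; _:+_; _:*_; con)
y^n+1≤[y+1]^n {y} (suc n) 0≤y = begin
  y * p + 1ℚ                  ≤⟨ p≤p+q _ (+-mono-≤ 0≤y (^-nonNeg (suc n) 0≤y)) ⟩
  y * p + 1ℚ + (y + p)        ≡⟨ solve 2 (λ y p → y :* p :+ con 1ℚ :+ (y :+ p) := (y :+ con 1ℚ) :* (p :+ con 1ℚ)) refl y p ⟩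
  (y + 1ℚ) * (p + 1ℚ)         ≤⟨ *-monoˡ-≤ (≤-trans 0≤y (<⇒≤ (p<p+1 y))) (y^n+1≤[y+1]^n n 0≤y) ⟩
  (y + 1ℚ) ^ suc (suc n)      ∎
  where
  open ≤-Reasoning
  open +-*-Solver using (solve; _:=_; _:+_; _:*_; con)
  p = y ^ suc n

y^n+2≤[y+1]^n : ∀ {y n} → 2 ℕ.≤ n → 1ℚ ≤ y → y ^ n + (1ℚ + 1ℚ) ≤ (y + 1ℚ) ^ n
y^n+2≤[y+1]^n {y} {suc (suc n)} (ℕ.s≤s (ℕ.s≤s _)) 1≤y = begin
  y * p + (1ℚ + 1ℚ)           ≤⟨ +-monoʳ-≤ (y * p) (+-monoʳ-≤ 1ℚ (≤-trans 1≤y (p≤p+q y (^-nonNeg (suc n) 0≤y)))) ⟩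
  y * p + (1ℚ + (y + p))      ≡⟨ solve 2 (λ y p → y :* p :+ (con 1ℚ :+ (y :+ p)) := (y :+ con 1ℚ) :* (p :+ con 1ℚ)) refl y p ⟩
  (y + 1ℚ) * (p + 1ℚ)         ≤⟨ *-monoˡ-≤ (≤-trans 0≤y (<⇒≤ (p<p+1 y))) (y^n+1≤[y+1]^n n 0≤y) ⟩
  (y + 1ℚ) ^ suc (suc n)      ∎
  where
  open ≤-Reasoning
  open +-*-Solver using (solve; _:=_; _:+_; _:*_; con)
  p = y ^ suc n
  0≤y = ≤-trans (<⇒≤ 0<1) 1≤y

-- Since q m = q′ m′, the conclusion compares equal powers of a^(1/q′) and b^(1/q).
exchange : ∀ {a b} q m q′ m′ .{{_ : ℕ.NonZero q}} → 0ℚ ≤ a → 0ℚ ≤ b → q ℕ.* m ≡ q′ ℕ.* m′ →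
  a ^ q ≤ b ^ q′ → a ^ m′ ≤ b ^ m
exchange {a} {b} q m q′ m′ 0≤a 0≤b qm≡q′m′ aᵠ≤bᵠ′ = ^-cancel-≤ q (^-nonNeg m 0≤b) (begin
  (a ^ m′) ^ q     ≡⟨ ^-comm a m′ q ⟩
  (a ^ q) ^ m′     ≤⟨ ^-mono-≤ m′ (^-nonNeg q 0≤a) aᵠ≤bᵠ′ ⟩
  (b ^ q′) ^ m′    ≡⟨ ^-assocʳ b q′ m′ ⟩
  b ^ (q′ ℕ.* m′)  ≡⟨ cong (b ^_) qm≡q′m′ ⟨
  b ^ (q ℕ.* m)    ≡⟨ ^-assocʳ b q m ⟨
  (b ^ q) ^ m      ≡⟨ ^-comm b q m ⟩
  (b ^ m) ^ q      ∎)
  where open ≤-Reasoning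

exchange⁻ : ∀ {a b} q m q′ m′ .{{_ : ℕ.NonZero q}} → 0ℚ ≤ a → 0ℚ ≤ b → q ℕ.* m ≡ q′ ℕ.* m′ →
  b ^ q′ ≤ a ^ q → b ^ m ≤ a ^ m′
exchange⁻ {a} {b} q m q′ m′ 0≤a 0≤b qm≡q′m′ bᵠ′≤aᵠ = ^-cancel-≤ q (^-nonNeg m′ 0≤a) (begin
  (b ^ m) ^ q      ≡⟨ ^-comm b m q ⟩
  (b ^ q) ^ m      ≡⟨ ^-assocʳ b q m ⟩
  b ^ (q ℕ.* m)    ≡⟨ cong (b ^_) qm≡q′m′ ⟩
  b ^ (q′ ℕ.* m′)  ≡⟨ ^-assocʳ b q′ m′ ⟨
  (b ^ q′) ^ m′    ≤⟨ ^-mono-≤ m′ (^-nonNeg q′ 0≤b) bᵠ′≤aᵠ ⟩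
  (a ^ q) ^ m′     ≡⟨ ^-comm a q m′ ⟩
  (a ^ m′) ^ q     ∎)
  where open ≤-Reasoning

composeθ-≥ : ∀ {y} u → 0ℚ ≤ y → y ^ product u ≤ composeθ y u
composeθ-≥ {y} []      0≤y = ≤-reflexive (*-identityʳ y)
composeθ-≥ {y} (q ∷ u) 0≤y = begin
  y ^ (q ℕ.* product u)   ≡⟨ ^-assocʳ y q (product u) ⟨
  (y ^ q) ^ product u     ≤⟨ ^-mono-≤ (product u) (^-nonNeg q 0≤y) (<⇒≤ (p<p+1 (y ^ q))) ⟩
  (y ^ q + 1ℚ) ^ product u ≤⟨ composeθ-≥ u (≤-trans (^-nonNeg q 0≤y) (<⇒≤ (p<p+1 (y ^ q)))) ⟩
  composeθ (θ q y) u      ∎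
  where open ≤-Reasoning

-- Adding 1 to the value lets the induction close: a step replaces y + 1 by y^q + 2, which is at
-- most (y + 1)^q because y ≥ 1 and q ≥ 2.
composeθ-≤ : ∀ {y u} → All OddLetter u → 1ℚ ≤ y → composeθ y u + 1ℚ ≤ (y + 1ℚ) ^ product u
composeθ-≤ {y} []                    1≤y = ≤-reflexive (sym (*-identityʳ (y + 1ℚ)))
composeθ-≤ {y} {q ∷ u} (odd ∷ odds) 1≤y = begin
  composeθ (θ q y) u + 1ℚ         ≤⟨ composeθ-≤ odds 1≤θ ⟩
  (y ^ q + 1ℚ + 1ℚ) ^ product u   ≡⟨ cong (_^ product u) (+-assoc (y ^ q) 1ℚ 1ℚ) ⟩
  (y ^ q + (1ℚ + 1ℚ)) ^ product u
    ≤⟨ ^-mono-≤ (product u) (+-mono-≤ (^-nonNeg q 0≤y) 0≤2) (y^n+2≤[y+1]^n (odd⇒≥2 odd) 1≤y) ⟩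
  ((y + 1ℚ) ^ q) ^ product u      ≡⟨ ^-assocʳ (y + 1ℚ) q (product u) ⟩
  (y + 1ℚ) ^ (q ℕ.* product u)    ∎
  where
  open ≤-Reasoning
  0≤y = ≤-trans (<⇒≤ 0<1) 1≤y
  1≤θ : 1ℚ ≤ θ q y
  1≤θ = p≤q+p 1ℚ (^-nonNeg q 0≤y)

-- The 1 that is added after the smaller power is amplified by the larger remaining product, so the
-- smaller first letter gives the larger value.
first-letter-< : ∀ {y q q′ u v} → 1ℚ + 1ℚ ≤ y → All OddLetter v → 2 ℕ.≤ q → q ℕ.< q′ →
  q ℕ.* product u ≡ q′ ℕ.* product v → composeθ (θ q′ y) v < composeθ (θ q y) u
first-letter-< {y} {q@(suc _)} {q′} {u} {v} 2≤y odds 2≤q q<q′ same = begin-strict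
  composeθ (θ q′ y) v                <⟨ p<p+1 _ ⟩
  composeθ (θ q′ y) v + 1ℚ           ≤⟨ composeθ-≤ odds (p≤q+p 1ℚ (^-nonNeg q′ 0≤y)) ⟩
  (y ^ q′ + 1ℚ + 1ℚ) ^ product v     ≡⟨ cong (_^ product v) (+-assoc (y ^ q′) 1ℚ 1ℚ) ⟩
  (y ^ q′ + (1ℚ + 1ℚ)) ^ product v   ≤⟨ exchange q (product u) q′ (product v)
                                          (+-mono-≤ (^-nonNeg q′ 0≤y) 0≤2) 0≤θ same roots ⟩
  (y ^ q + 1ℚ) ^ product u           ≤⟨ composeθ-≥ u 0≤θ ⟩
  composeθ (θ q y) u                 ∎
  where
  open ≤-Reasoning
  open +-*-Solver using (solve; _:=_; _:+_; _:*_; con)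
  0≤y = ≤-trans 0≤2 2≤y
  1≤y = ≤-trans 1≤2 2≤y
  0≤θ : 0ℚ ≤ θ q y
  0≤θ = ≤-trans (^-nonNeg q 0≤y) (<⇒≤ (p<p+1 (y ^ q)))
  k = q′ ℕ.∸ suc q
  q+k≡q′ : q ℕ.+ suc k ≡ q′
  q+k≡q′ = trans (ℕ.+-suc q k) (ℕ.m+[n∸m]≡n q<q′)
  -- As y ≥ 2, the summand 2 is at most y^(q′-q), which then factors out and leaves y^q + 1. Its
  -- q-th power is absorbed by (y^q + 1)^(q′-q).
  roots : (y ^ q′ + (1ℚ + 1ℚ)) ^ q ≤ (y ^ q + 1ℚ) ^ q′
  roots = begin
    (y ^ q′ + (1ℚ + 1ℚ)) ^ q
      ≤⟨ ^-mono-≤ q (+-mono-≤ (^-nonNeg q′ 0≤y) 0≤2) (+-monoʳ-≤ (y ^ q′) (≤-trans 2≤y (x≤x^n k 1≤y))) ⟩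
    (y ^ q′ + y ^ suc k) ^ q
      ≡⟨ cong (λ z → (z + y ^ suc k) ^ q) (trans (cong (y ^_) (sym q+k≡q′)) (^-homo-* y q (suc k))) ⟩
    (y ^ q * y ^ suc k + y ^ suc k) ^ q
      ≡⟨ cong (_^ q) (solve 2 (λ a b → a :* b :+ b := b :* (a :+ con 1ℚ)) refl (y ^ q) (y ^ suc k)) ⟩
    (y ^ suc k * θ q y) ^ q          ≡⟨ ^-distrib-* (y ^ suc k) (θ q y) q ⟩
    (y ^ suc k) ^ q * θ q y ^ q      ≡⟨ cong (_* θ q y ^ q) (^-comm y (suc k) q) ⟩
    (y ^ q) ^ suc k * θ q y ^ q
      ≤⟨ *-monoʳ-≤ (^-nonNeg q 0≤θ) (^-mono-≤ (suc k) (^-nonNeg q 0≤y) (<⇒≤ (p<p+1 (y ^ q)))) ⟩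
    θ q y ^ suc k * θ q y ^ q        ≡⟨ *-comm (θ q y ^ suc k) (θ q y ^ q) ⟩
    θ q y ^ q * θ q y ^ suc k        ≡⟨ ^-homo-* (θ q y) q (suc k) ⟨
    θ q y ^ (q ℕ.+ suc k)            ≡⟨ cong (θ q y ^_) q+k≡q′ ⟩
    (y ^ q + 1ℚ) ^ q′                ∎

-- The conjugate of θ under z ↦ - z, for odd q.
θ⁻ : ℕ → ℚ → ℚ
θ⁻ q z = z ^ q - 1ℚ

composeθ⁻ : ℚ → List ℕ → ℚ
composeθ⁻ = foldl (λ z q → θ⁻ q z)

neg-^-odd : ∀ y h → (- y) ^ (3 ℕ.+ (h ℕ.+ h)) ≡ - (y ^ (3 ℕ.+ (h ℕ.+ h)))
neg-^-odd y h = begin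
  - y * (- y * (- y * (- y) ^ (h ℕ.+ h)))  ≡⟨ cong (λ z → - y * (- y * (- y * z))) even ⟩
  - y * (- y * (- y * y ^ (h ℕ.+ h)))      ≡⟨ solve 2 (λ y p → :- y :* (:- y :* (:- y :* p)) := :- (y :* (y :* (y :* p)))) refl y (y ^ (h ℕ.+ h)) ⟩
  - (y * (y * (y * y ^ (h ℕ.+ h))))        ∎
  where
  open ≡-Reasoning
  open +-*-Solver using (solve; _:=_; _:*_; :-_)
  even : (- y) ^ (h ℕ.+ h) ≡ y ^ (h ℕ.+ h)
  even = begin
    (- y) ^ (h ℕ.+ h)      ≡⟨ ^-homo-* (- y) h h ⟩
    (- y) ^ h * (- y) ^ h  ≡⟨ ^-distrib-* (- y) (- y) h ⟨
    (- y * - y) ^ h        ≡⟨ cong (_^ h) (solve 1 (λ y → :- y :* :- y := y :* y) refl y) ⟩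
    (y * y) ^ h            ≡⟨ ^-distrib-* y y h ⟩
    y ^ h * y ^ h          ≡⟨ ^-homo-* y h h ⟨
    y ^ (h ℕ.+ h)          ∎

θ-neg : ∀ {q} y → OddLetter q → θ q (- y) ≡ - θ⁻ q y
θ-neg y (odd-letter h refl) = trans (cong (_+ 1ℚ) (neg-^-odd y h))
  (solve 1 (λ p → :- p :+ con 1ℚ := :- (p :- con 1ℚ)) refl (y ^ (3 ℕ.+ (h ℕ.+ h))))
  where open +-*-Solver using (solve; _:=_; _:+_; _:-_; :-_; con)

composeθ-neg : ∀ {u} y → All OddLetter u → composeθ (- y) u ≡ - composeθ⁻ y u
composeθ-neg         y []           = refl
composeθ-neg {q ∷ u} y (odd ∷ odds) =
  trans (cong (λ z → composeθ z u) (θ-neg y odd)) (composeθ-neg (θ⁻ q y) odds)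

[y-1]^n≤y^n-2 : ∀ {y n} → 2 ℕ.≤ n → 1ℚ + 1ℚ ≤ y → (y - 1ℚ) ^ n ≤ θ⁻ n y - 1ℚ
[y-1]^n≤y^n-2 {y} {n} 2≤n 2≤y = begin
  (y - 1ℚ) ^ n
    ≡⟨ solve 1 (λ p → p := p :+ (con 1ℚ :+ con 1ℚ) :- con 1ℚ :- con 1ℚ) refl ((y - 1ℚ) ^ n) ⟩
  (y - 1ℚ) ^ n + (1ℚ + 1ℚ) - 1ℚ - 1ℚ
    ≤⟨ +-monoˡ-≤ (- 1ℚ) (+-monoˡ-≤ (- 1ℚ) (y^n+2≤[y+1]^n 2≤n (+-monoˡ-≤ (- 1ℚ) 2≤y))) ⟩
  (y - 1ℚ + 1ℚ) ^ n - 1ℚ - 1ℚ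
    ≡⟨ cong (λ z → z ^ n - 1ℚ - 1ℚ) (solve 1 (λ y → y :- con 1ℚ :+ con 1ℚ := y) refl y) ⟩
  y ^ n - 1ℚ - 1ℚ ∎
  where
  open ≤-Reasoning
  open +-*-Solver using (solve; _:=_; _:+_; _:-_; con)

1≤y-1 : ∀ {y} → 1ℚ + 1ℚ ≤ y → 1ℚ ≤ y - 1ℚ
1≤y-1 2≤y = +-monoˡ-≤ (- 1ℚ) 2≤y

2≤θ⁻ : ∀ {y q} → 2 ℕ.≤ q → 1ℚ + 1ℚ ≤ y → 1ℚ + 1ℚ ≤ θ⁻ q y
2≤θ⁻ {y} {q} 2≤q 2≤y = begin
  1ℚ + 1ℚ              ≤⟨ +-monoˡ-≤ 1ℚ (≤-trans (1≤x^n q (1≤y-1 2≤y)) ([y-1]^n≤y^n-2 2≤q 2≤y)) ⟩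
  θ⁻ q y - 1ℚ + 1ℚ     ≡⟨ solve 1 (λ y → y :- con 1ℚ :+ con 1ℚ := y) refl (θ⁻ q y) ⟩
  θ⁻ q y               ∎
  where
  open ≤-Reasoning
  open +-*-Solver using (solve; _:=_; _:+_; _:-_; con)

y-1≤y : ∀ y → y - 1ℚ ≤ y
y-1≤y y = subst (y - 1ℚ ≤_) (+-identityʳ y) (+-monoʳ-≤ y (<⇒≤ (negative⁻¹ (- 1ℚ))))

composeθ⁻-≤ : ∀ {y u} → All OddLetter u → 1ℚ + 1ℚ ≤ y → composeθ⁻ y u ≤ y ^ product u
composeθ⁻-≤ {y} []                    2≤y = ≤-reflexive (sym (*-identityʳ y))
composeθ⁻-≤ {y} {q ∷ u} (odd ∷ odds) 2≤y = begin
  composeθ⁻ (θ⁻ q y) u    ≤⟨ composeθ⁻-≤ odds 2≤θ ⟩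
  θ⁻ q y ^ product u      ≤⟨ ^-mono-≤ (product u) (≤-trans 0≤2 2≤θ) (y-1≤y (y ^ q)) ⟩
  (y ^ q) ^ product u     ≡⟨ ^-assocʳ y q (product u) ⟩
  y ^ (q ℕ.* product u)   ∎
  where
  open ≤-Reasoning
  2≤θ = 2≤θ⁻ {y} {q} (odd⇒≥2 odd) 2≤y

composeθ⁻-≥ : ∀ {y u} → All OddLetter u → 1ℚ + 1ℚ ≤ y → (y - 1ℚ) ^ product u ≤ composeθ⁻ y u - 1ℚ
composeθ⁻-≥ {y} []                    2≤y = ≤-reflexive (*-identityʳ (y - 1ℚ))
composeθ⁻-≥ {y} {q ∷ u} (odd ∷ odds) 2≤y = begin
  (y - 1ℚ) ^ (q ℕ.* product u)    ≡⟨ ^-assocʳ (y - 1ℚ) q (product u) ⟨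
  ((y - 1ℚ) ^ q) ^ product u      ≤⟨ ^-mono-≤ (product u) (^-nonNeg q (≤-trans (<⇒≤ 0<1) (1≤y-1 2≤y)))
                                       ([y-1]^n≤y^n-2 (odd⇒≥2 odd) 2≤y) ⟩
  (θ⁻ q y - 1ℚ) ^ product u       ≤⟨ composeθ⁻-≥ odds (2≤θ⁻ {y} {q} (odd⇒≥2 odd) 2≤y) ⟩
  composeθ⁻ (θ⁻ q y) u - 1ℚ       ∎
  where open ≤-Reasoning

-- Now a 1 is subtracted, and the loss is amplified more after the smaller power, so the order of
-- `first-letter-<` is reversed.
first-letter-<⁻ : ∀ {y q q′ u v} → 1ℚ + 1ℚ ≤ y → All OddLetter u → All OddLetter v → 2 ℕ.≤ q → q ℕ.< q′ →
  q ℕ.* product u ≡ q′ ℕ.* product v → composeθ⁻ (θ⁻ q y) u < composeθ⁻ (θ⁻ q′ y) v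
first-letter-<⁻ {y} {q@(suc _)} {q′} {u} {v} 2≤y odds odds′ 2≤q q<q′ same = begin-strict
  composeθ⁻ (θ⁻ q y) u            ≤⟨ composeθ⁻-≤ odds 2≤θ ⟩
  θ⁻ q y ^ product u              ≤⟨ exchange⁻ q (product u) q′ (product v) 0≤θ′-1 0≤θ same roots ⟩
  (θ⁻ q′ y - 1ℚ) ^ product v      ≤⟨ composeθ⁻-≥ odds′ 2≤θ′ ⟩
  composeθ⁻ (θ⁻ q′ y) v - 1ℚ      <⟨ p<p+1 _ ⟩
  composeθ⁻ (θ⁻ q′ y) v - 1ℚ + 1ℚ ≡⟨ solve 1 (λ y → y :- con 1ℚ :+ con 1ℚ := y) refl (composeθ⁻ (θ⁻ q′ y) v) ⟩
  composeθ⁻ (θ⁻ q′ y) v           ∎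
  where
  open ≤-Reasoning
  open +-*-Solver using (solve; _:=_; _:+_; _:*_; _:-_; :-_; con)
  0≤y = ≤-trans 0≤2 2≤y
  1≤y = ≤-trans 1≤2 2≤y
  2≤θ = 2≤θ⁻ {y} {q} 2≤q 2≤y
  2≤θ′ = 2≤θ⁻ {y} {q′} (ℕ.≤-trans 2≤q (ℕ.<⇒≤ q<q′)) 2≤y
  0≤θ = ≤-trans 0≤2 2≤θ
  0≤θ′-1 = ≤-trans (<⇒≤ 0<1) (1≤y-1 2≤θ′)
  k = q′ ℕ.∸ suc q
  q+k≡q′ : q ℕ.+ suc k ≡ q′
  q+k≡q′ = trans (ℕ.+-suc q k) (ℕ.m+[n∸m]≡n q<q′)
  roots : θ⁻ q y ^ q′ ≤ (θ⁻ q′ y - 1ℚ) ^ q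
  roots = begin
    θ⁻ q y ^ q′                      ≡⟨ cong (θ⁻ q y ^_) q+k≡q′ ⟨
    θ⁻ q y ^ (q ℕ.+ suc k)           ≡⟨ ^-homo-* (θ⁻ q y) q (suc k) ⟩
    θ⁻ q y ^ q * θ⁻ q y ^ suc k      ≡⟨ *-comm (θ⁻ q y ^ q) (θ⁻ q y ^ suc k) ⟩
    θ⁻ q y ^ suc k * θ⁻ q y ^ q
      ≤⟨ *-monoʳ-≤ (^-nonNeg q 0≤θ) (^-mono-≤ (suc k) 0≤θ (y-1≤y (y ^ q))) ⟩
    (y ^ q) ^ suc k * θ⁻ q y ^ q     ≡⟨ cong (_* θ⁻ q y ^ q) (^-comm y q (suc k)) ⟩
    (y ^ suc k) ^ q * θ⁻ q y ^ q     ≡⟨ ^-distrib-* (y ^ suc k) (θ⁻ q y) q ⟨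
    (y ^ suc k * θ⁻ q y) ^ q
      ≡⟨ cong (_^ q) (solve 2 (λ a b → b :* (a :- con 1ℚ) := a :* b :- b) refl (y ^ q) (y ^ suc k)) ⟩
    (y ^ q * y ^ suc k - y ^ suc k) ^ q
      ≡⟨ cong (λ z → (z - y ^ suc k) ^ q) (trans (sym (^-homo-* y q (suc k))) (cong (y ^_) q+k≡q′)) ⟩
    (y ^ q′ - y ^ suc k) ^ q
      -- Monotonicity of powers needs a nonnegative base, which the factored form provides.
      ≤⟨ ^-mono-≤ q (subst (0ℚ ≤_) factor (*-nonNeg (^-nonNeg (suc k) 0≤y) 0≤θ))
           (+-monoʳ-≤ (y ^ q′) (neg-antimono-≤ (≤-trans 2≤y (x≤x^n k 1≤y)))) ⟩
    (y ^ q′ - (1ℚ + 1ℚ)) ^ q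
      ≡⟨ cong (_^ q) (solve 1 (λ p → p :- (con 1ℚ :+ con 1ℚ) := p :- con 1ℚ :- con 1ℚ) refl (y ^ q′)) ⟩
    (θ⁻ q′ y - 1ℚ) ^ q ∎
    where
    factor : y ^ suc k * θ⁻ q y ≡ y ^ q′ - y ^ suc k
    factor = trans (solve 2 (λ a b → b :* (a :- con 1ℚ) := a :* b :- b) refl (y ^ q) (y ^ suc k))
      (cong (_- y ^ suc k) (trans (sym (^-homo-* y q (suc k))) (cong (y ^_) q+k≡q′)))

odd-product≢1 : ∀ {q m} → OddLetter q → 1 ≢ q ℕ.* m
odd-product≢1 {m = m} (odd-letter h refl) 1≡ with ℕ.m*n≡1⇒m≡1 (3 ℕ.+ (h ℕ.+ h)) m (sym 1≡)
... | ()

cancel-letter : ∀ {q m m′} → OddLetter q → q ℕ.* m ≡ q ℕ.* m′ → m ≡ m′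
cancel-letter {m = m} {m′} (odd-letter h refl) = ℕ.*-cancelˡ-≡ m m′ (3 ℕ.+ (h ℕ.+ h))

-- Equal values force equal first letters by `first-letter-<`. These cancel from the products, and
-- the argument repeats at `θ q y`, which is again at least 2.
composeθ-injective⁺ : ∀ {y u v} → 1ℚ + 1ℚ ≤ y → All OddLetter u → All OddLetter v →
  product u ≡ product v → composeθ y u ≡ composeθ y v → u ≡ v
composeθ-injective⁺ 2≤y []      []      same eq = refl
composeθ-injective⁺ 2≤y []      (o ∷ _) same eq = contradiction same (odd-product≢1 o)
composeθ-injective⁺ 2≤y (o ∷ _) []      same eq = contradiction (sym same) (odd-product≢1 o)
composeθ-injective⁺ {y} {q ∷ u} {q′ ∷ v} 2≤y (o ∷ os) (o′ ∷ os′) same eq with ℕ.<-cmp q q′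
... | tri< q<q′ _ _ = contradiction (sym eq) (<⇒≢ (first-letter-< {u = u} 2≤y os′ (odd⇒≥2 o) q<q′ same))
... | tri> _ _ q′<q = contradiction eq (<⇒≢ (first-letter-< {u = v} 2≤y os (odd⇒≥2 o′) q′<q (sym same)))
... | tri≈ _ refl _ = cong (q ∷_) (composeθ-injective⁺ 2≤θ os os′ (cancel-letter o same) eq)
  where
  2≤θ : 1ℚ + 1ℚ ≤ θ q y
  2≤θ = +-monoˡ-≤ 1ℚ (1≤x^n q (≤-trans 1≤2 2≤y))

composeθ⁻-injective : ∀ {y u v} → 1ℚ + 1ℚ ≤ y → All OddLetter u → All OddLetter v →
  product u ≡ product v → composeθ⁻ y u ≡ composeθ⁻ y v → u ≡ v
composeθ⁻-injective 2≤y []      []      same eq = refl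
composeθ⁻-injective 2≤y []      (o ∷ _) same eq = contradiction same (odd-product≢1 o)
composeθ⁻-injective 2≤y (o ∷ _) []      same eq = contradiction (sym same) (odd-product≢1 o)
composeθ⁻-injective {y} {q ∷ u} {q′ ∷ v} 2≤y (o ∷ os) (o′ ∷ os′) same eq with ℕ.<-cmp q q′
... | tri< q<q′ _ _ = contradiction eq (<⇒≢ (first-letter-<⁻ 2≤y os os′ (odd⇒≥2 o) q<q′ same))
... | tri> _ _ q′<q = contradiction (sym eq) (<⇒≢ (first-letter-<⁻ 2≤y os′ os (odd⇒≥2 o′) q′<q (sym same)))
... | tri≈ _ refl _ = cong (q ∷_) (composeθ⁻-injective (2≤θ⁻ {y} {q} (odd⇒≥2 o) 2≤y) os os′ (cancel-letter o same) eq)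

composeθ-injective : ∀ {y u v} → 1ℚ + 1ℚ ≤ y ⊎ y ≤ - (1ℚ + 1ℚ) → All OddLetter u → All OddLetter v →
  product u ≡ product v → composeθ y u ≡ composeθ y v → u ≡ v
composeθ-injective (inj₁ 2≤y) os os′ same eq = composeθ-injective⁺ 2≤y os os′ same eq
composeθ-injective {y} {u} {v} (inj₂ y≤-2) os os′ same eq =
  composeθ⁻-injective {y = - y} (subst (_≤ - y) (neg-neg (1ℚ + 1ℚ)) (neg-antimono-≤ y≤-2)) os os′ same
    (neg-injective (trans (sym (composeθ-neg (- y) os)) (trans
      (subst (λ z → composeθ z u ≡ composeθ z v) (sym (neg-neg y)) eq) (composeθ-neg (- y) os′))))
  where
  open +-*-Solver using (solve; _:=_; :-_)
  neg-neg : ∀ z → - (- z) ≡ z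
  neg-neg = solve 1 (λ z → :- (:- z) := z) refl

-- Heights

coprime-*ʳ : ∀ {m n k} → Coprime m n → Coprime m k → Coprime m (n ℕ.* k)
coprime-*ʳ {n = n} m⊥n m⊥k {c} (c∣m , c∣nk) =
  m⊥k (c∣m , coprime-divisor {c} {n} (λ (d∣c , d∣n) → m⊥n (∣-trans d∣c c∣m , d∣n)) c∣nk)

coprime-^ʳ : ∀ {m n} q → Coprime m n → Coprime m (n ℕ.^ q)
coprime-^ʳ         zero    m⊥n = Coprimality.sym (1-coprimeTo _)
coprime-^ʳ {n = n} (suc q) m⊥n = coprime-*ʳ {n = n} m⊥n (coprime-^ʳ q m⊥n)

coprime-^ : ∀ {m n} q → Coprime m n → Coprime (m ℕ.^ q) (n ℕ.^ q)
coprime-^ q m⊥n = Coprimality.sym (coprime-^ʳ q (Coprimality.sym (coprime-^ʳ q m⊥n)))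

∣i^n∣≡∣i∣^n : ∀ i n → ℤ.∣ i ℤ.^ n ∣ ≡ ℤ.∣ i ∣ ℕ.^ n
∣i^n∣≡∣i∣^n i zero    = refl
∣i^n∣≡∣i∣^n i (suc n) = trans (ℤ.abs-* i (i ℤ.^ n)) (cong (ℤ.∣ i ∣ ℕ.*_) (∣i^n∣≡∣i∣^n i n))

coprime-+ʳ : ∀ i d → Coprime ℤ.∣ i ∣ d → Coprime ℤ.∣ i ℤ.+ ℤ.+ d ∣ d
coprime-+ʳ i d i⊥d {c} (c∣i+d , c∣d) =
  i⊥d (ℤ.∣⇒∣ᵤ (ℤ.∣m+n∣n⇒∣m {ℤ.+ c} {i} {ℤ.+ d} (ℤ.∣ᵤ⇒∣ c∣i+d) (ℤ.∣ᵤ⇒∣ c∣d)) , c∣d)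

-- `mkℚᵘ` stores the predecessor of the denominator, hence the witness `e` for the predecessor of
-- the power.
toℚᵘ-^ : ∀ n d-1 .(c : Coprime ℤ.∣ n ∣ (suc d-1)) q →
  ∃[ e ] suc e ≡ suc d-1 ℕ.^ q × toℚᵘ (mkℚ n d-1 c ^ q) ℚᵘ.≃ ℚᵘ.mkℚᵘ (n ℤ.^ q) e
toℚᵘ-^ n d-1 c zero    = 0 , refl , ℚᵘ.≃-refl
toℚᵘ-^ n d-1 c (suc q) = let (e , e≡ , rep) = toℚᵘ-^ n d-1 c q in
  e ℕ.+ d-1 ℕ.* suc e , cong (suc d-1 ℕ.*_) e≡ ,
  ℚᵘ.≃-trans (toℚᵘ-homo-* (mkℚ n d-1 c) (mkℚ n d-1 c ^ q)) (ℚᵘ.*-congˡ {ℚᵘ.mkℚᵘ n d-1} rep)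

lowest-terms : ∀ {t N e} → Coprime ℤ.∣ N ∣ (suc e) → toℚᵘ t ℚᵘ.≃ ℚᵘ.mkℚᵘ N e →
  ↥ t ≡ N × ↧ₙ t ≡ suc e
lowest-terms {t} {N} {e} coprime rep with toℚᵘ-injective {t} {mkℚ N e coprime} rep
... | refl = refl , refl

-- For coprime a and b, (a/b)^q + 1 = (a^q + b^q)/b^q is already in lowest terms, since a^q + b^q is
-- coprime to b^q.
H-θ : ∀ q z → H (θ q z) ≡ ℤ.∣ (↥ z) ℤ.^ q ℤ.+ ℤ.+ (↧ₙ z ℕ.^ q) ∣ ℕ.⊔ (↧ₙ z ℕ.^ q)
H-θ q (mkℚ n d-1 c) =
  let (e , e≡ , rep) = toℚᵘ-^ n d-1 c q
      D = suc d-1 ℕ.^ q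
      n⊥d = Coprimality.recompute c
      N⊥D : Coprime ℤ.∣ n ℤ.^ q ℤ.+ ℤ.+ D ∣ D
      N⊥D = coprime-+ʳ (n ℤ.^ q) D (subst (λ m → Coprime m D) (sym (∣i^n∣≡∣i∣^n n q)) (coprime-^ q n⊥d))
      (num , den) = lowest-terms {θ q (mkℚ n d-1 c)} (subst (λ D → Coprime ℤ.∣ n ℤ.^ q ℤ.+ ℤ.+ D ∣ D) (sym e≡) N⊥D)
        (ℚᵘ.≃-trans (toℚᵘ-homo-+ (mkℚ n d-1 c ^ q) 1ℚ) (ℚᵘ.≃-trans (ℚᵘ.+-congˡ ℚᵘ.1ℚᵘ rep) (plus-one (n ℤ.^ q) e)))
  in trans (cong₂ (λ a b → ℤ.∣ a ∣ ℕ.⊔ b) num den) (cong (λ D → ℤ.∣ n ℤ.^ q ℤ.+ ℤ.+ D ∣ ℕ.⊔ D) e≡)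
  where
  plus-one : ∀ N e → ℚᵘ.mkℚᵘ N e ℚᵘ.+ ℚᵘ.1ℚᵘ ℚᵘ.≃ ℚᵘ.mkℚᵘ (N ℤ.+ ℤ.+ suc e) e
  plus-one N e = ℚᵘ.*≡* (cong₂ ℤ._*_
    (cong₂ ℤ._+_ (ℤ.*-identityʳ N) (ℤ.*-identityˡ (ℤ.+ suc e)))
    (cong ℤ.+_ (sym (ℕ.*-identityʳ (suc e)))))

^-distrib-⊔ : ∀ m n q → (m ℕ.⊔ n) ℕ.^ q ≡ m ℕ.^ q ℕ.⊔ n ℕ.^ q
^-distrib-⊔ m n q = ℕ.mono-≤-distrib-⊔ {ℕ._^ q} (ℕ.^-monoˡ-≤ q) m n

-- The numerator is recovered as a^q = (a^q + b^q) - b^q, a difference of two terms each bounded by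
-- the new height.
H^q≤2Hθ : ∀ q z → H z ℕ.^ q ℕ.≤ 2 ℕ.* H (θ q z)
H^q≤2Hθ q z = begin
  H z ℕ.^ q            ≡⟨ ^-distrib-⊔ ℤ.∣ ↥ z ∣ (↧ₙ z) q ⟩
  ℤ.∣ ↥ z ∣ ℕ.^ q ℕ.⊔ D ≤⟨ ℕ.⊔-lub N≤ (ℕ.≤-trans (ℕ.m≤n⊔m S D) (ℕ.m≤m+n h _)) ⟩
  2 ℕ.* h              ≡⟨ cong (2 ℕ.*_) (H-θ q z) ⟨
  2 ℕ.* H (θ q z)      ∎
  where
  open ℕ.≤-Reasoning
  D = ↧ₙ z ℕ.^ q
  N = (↥ z) ℤ.^ q
  S = ℤ.∣ N ℤ.+ ℤ.+ D ∣
  h = S ℕ.⊔ D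
  cancel : N ℤ.+ ℤ.+ D ℤ.- ℤ.+ D ≡ N
  cancel = trans (ℤ.+-assoc N (ℤ.+ D) (ℤ.- ℤ.+ D))
    (trans (cong (λ i → N ℤ.+ i) (ℤ.+-inverseʳ (ℤ.+ D))) (ℤ.+-identityʳ N))
  N≤ : ℤ.∣ ↥ z ∣ ℕ.^ q ℕ.≤ 2 ℕ.* h
  N≤ = begin
    ℤ.∣ ↥ z ∣ ℕ.^ q                   ≡⟨ ∣i^n∣≡∣i∣^n (↥ z) q ⟨
    ℤ.∣ N ∣                           ≡⟨ cong ℤ.∣_∣ cancel ⟨
    ℤ.∣ N ℤ.+ ℤ.+ D ℤ.- ℤ.+ D ∣       ≤⟨ ℤ.∣i-j∣≤∣i∣+∣j∣ (N ℤ.+ ℤ.+ D) (ℤ.+ D) ⟩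
    S ℕ.+ D                           ≤⟨ ℕ.+-mono-≤ (ℕ.m≤m⊔n S D) (ℕ.m≤n⊔m S D) ⟩
    h ℕ.+ h                           ≡⟨ cong (h ℕ.+_) (ℕ.+-identityʳ h) ⟨
    2 ℕ.* h                           ∎

Hθ≤2H^q : ∀ q z → H (θ q z) ℕ.≤ 2 ℕ.* H z ℕ.^ q
Hθ≤2H^q q z = begin
  H (θ q z)                       ≡⟨ H-θ q z ⟩
  S ℕ.⊔ D                         ≤⟨ ℕ.⊔-lub (ℤ.∣i+j∣≤∣i∣+∣j∣ N (ℤ.+ D)) (ℕ.m≤n+m D ℤ.∣ N ∣) ⟩
  ℤ.∣ N ∣ ℕ.+ D                   ≡⟨ cong (ℕ._+ D) (∣i^n∣≡∣i∣^n (↥ z) q) ⟩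
  ℤ.∣ ↥ z ∣ ℕ.^ q ℕ.+ D           ≤⟨ ℕ.+-mono-≤ (ℕ.^-monoˡ-≤ q (ℕ.m≤m⊔n _ _)) (ℕ.^-monoˡ-≤ q (ℕ.m≤n⊔m _ _)) ⟩
  H z ℕ.^ q ℕ.+ H z ℕ.^ q         ≡⟨ cong (H z ℕ.^ q ℕ.+_) (ℕ.+-identityʳ _) ⟨
  2 ℕ.* H z ℕ.^ q                 ∎
  where
  open ℕ.≤-Reasoning
  D = ↧ₙ z ℕ.^ q
  N = (↥ z) ℤ.^ q
  S = ℤ.∣ N ℤ.+ ℤ.+ D ∣

*-^-distrib : ∀ a b q → (a ℕ.* b) ℕ.^ q ≡ a ℕ.^ q ℕ.* b ℕ.^ q
*-^-distrib a b zero    = refl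
*-^-distrib a b (suc q) = trans (cong (a ℕ.* b ℕ.*_) (*-^-distrib a b q))
  (ℕ.[m*n]*[o*p]≡[m*o]*[n*p] a b (a ℕ.^ q) (b ℕ.^ q))

-- The factor 2 lost in `H^q≤2Hθ` is regained from q ≥ 2: a height of at least 2·2^p becomes at
-- least 2^q·2^(pq)/2 ≥ 2·2^(pq).
H-composeθ-≥ : ∀ {u p z} → All (2 ℕ.≤_) u → 2 ℕ.* 2 ℕ.^ p ℕ.≤ H z →
  2 ℕ.* 2 ℕ.^ (p ℕ.* product u) ℕ.≤ H (composeθ z u)
H-composeθ-≥ {[]}    {p} []           large = subst (λ p → 2 ℕ.* 2 ℕ.^ p ℕ.≤ _) (sym (ℕ.*-identityʳ p)) large
H-composeθ-≥ {q ∷ u} {p} {z} (2≤q ∷ 2≤u) large =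
  subst (λ p → 2 ℕ.* 2 ℕ.^ p ℕ.≤ H (composeθ (θ q z) u)) (ℕ.*-assoc p q (product u))
    (H-composeθ-≥ {u} {p ℕ.* q} 2≤u (ℕ.*-cancelˡ-≤ 2 (begin
      2 ℕ.* (2 ℕ.* 2 ℕ.^ (p ℕ.* q))     ≡⟨ ℕ.*-assoc 2 2 (2 ℕ.^ (p ℕ.* q)) ⟨
      2 ℕ.^ 2 ℕ.* 2 ℕ.^ (p ℕ.* q)       ≤⟨ ℕ.*-monoˡ-≤ (2 ℕ.^ (p ℕ.* q)) (ℕ.^-monoʳ-≤ 2 2≤q) ⟩
      2 ℕ.^ q ℕ.* 2 ℕ.^ (p ℕ.* q)       ≡⟨ cong (2 ℕ.^ q ℕ.*_) (ℕ.^-*-assoc 2 p q) ⟨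
      2 ℕ.^ q ℕ.* (2 ℕ.^ p) ℕ.^ q       ≡⟨ *-^-distrib 2 (2 ℕ.^ p) q ⟨
      (2 ℕ.* 2 ℕ.^ p) ℕ.^ q             ≤⟨ ℕ.^-monoˡ-≤ q large ⟩
      H z ℕ.^ q                         ≤⟨ H^q≤2Hθ q z ⟩
      2 ℕ.* H (θ q z)                   ∎)))
  where open ℕ.≤-Reasoning

-- Twice the height is submultiplicative: 2 H(θ z) ≤ 4 H(z)^q ≤ (2 H(z))^q, as q ≥ 2.
H-composeθ-≤ : ∀ {u z} → All (2 ℕ.≤_) u → 2 ℕ.* H (composeθ z u) ℕ.≤ (2 ℕ.* H z) ℕ.^ product u
H-composeθ-≤ {[]}    {z} []          = ℕ.≤-reflexive (sym (ℕ.*-identityʳ (2 ℕ.* H z)))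
H-composeθ-≤ {q ∷ u} {z} (2≤q ∷ 2≤u) = begin
  2 ℕ.* H (composeθ (θ q z) u)              ≤⟨ H-composeθ-≤ 2≤u ⟩
  (2 ℕ.* H (θ q z)) ℕ.^ product u           ≤⟨ ℕ.^-monoˡ-≤ (product u) (begin
    2 ℕ.* H (θ q z)               ≤⟨ ℕ.*-monoʳ-≤ 2 (Hθ≤2H^q q z) ⟩
    2 ℕ.* (2 ℕ.* H z ℕ.^ q)       ≡⟨ ℕ.*-assoc 2 2 (H z ℕ.^ q) ⟨
    2 ℕ.^ 2 ℕ.* H z ℕ.^ q         ≤⟨ ℕ.*-monoˡ-≤ (H z ℕ.^ q) (ℕ.^-monoʳ-≤ 2 2≤q) ⟩
    2 ℕ.^ q ℕ.* H z ℕ.^ q         ≡⟨ *-^-distrib 2 (H z) q ⟨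
    (2 ℕ.* H z) ℕ.^ q             ∎) ⟩
  ((2 ℕ.* H z) ℕ.^ q) ℕ.^ product u         ≡⟨ ℕ.^-*-assoc (2 ℕ.* H z) q (product u) ⟩
  (2 ℕ.* H z) ℕ.^ (q ℕ.* product u)         ∎
  where open ℕ.≤-Reasoning

-- The lower bound

n<2^n : ∀ n → n ℕ.< 2 ℕ.^ n
n<2^n zero    = ℕ.s≤s ℕ.z≤n
n<2^n (suc n) = begin
  suc (suc n)              ≤⟨ ℕ.+-mono-≤ (ℕ.m^n>0 2 n) (n<2^n n) ⟩
  2 ℕ.^ n ℕ.+ 2 ℕ.^ n      ≡⟨ cong (2 ℕ.^ n ℕ.+_) (ℕ.+-identityʳ (2 ℕ.^ n)) ⟨
  2 ℕ.^ suc n              ∎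
  where open ℕ.≤-Reasoning

-- Logarithms and powers of two

module _ {B : ℝ} {B>0 : Positiveℝ B} where

  -- With n = `suc m`, y > n would give (1 + y/n)^n > 2^n, hence exp y > 2^n, although exp y lies
  -- below B and B below 2^n.
  log-≤ : ∀ {m y} → U B (fromℕ (2 ℕ.^ suc m)) → L (log B B>0) y → y ≤ fromℕ (suc m)
  log-≤ {m} {y} B<2ᵐ (b , b<B , exp-y<b) = ≮⇒≥ λ m<y → <-asym (L<U B b<B B<2ᵐ)
    (Logarithm.exp-bounds {y} {fromℕ (2 ℕ.^ suc m)} {b} (m , 0<base m<y , 2ᵐ<base m<y) exp-y<b
      (subst (0ℚ <_) (sym (fromℕ-^ 2 (suc m))) (^-pos (suc m) (0<fromℕ 1))))
    where
    base = 1ℚ + y * (+ 1 / suc m)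
    2<base : fromℕ (suc m) < y → fromℕ 2 < base
    2<base m<y = subst (_< base) (sym (fromℕ-suc 1)) (+-monoʳ-< 1ℚ
      (subst (_< y * (+ 1 / suc m)) (fromℕ-inverse m) (*-mono-<ʳ (0<1/suc m) m<y)))
    0<base : fromℕ (suc m) < y → 0ℚ < base
    0<base m<y = <-trans (0<fromℕ 1) (2<base m<y)
    2ᵐ<base : fromℕ (suc m) < y → fromℕ (2 ℕ.^ suc m) < base ^ suc m
    2ᵐ<base m<y = subst (_< base ^ suc m) (sym (fromℕ-^ 2 (suc m)))
      (^-mono-< m (0≤fromℕ 2) (2<base m<y))

  -- exp (1/4) < 2 because (1 - 1/4)⁻¹ < 2.
  log-> : ∀ {m} → L B (fromℕ (2 ℕ.^ suc m)) → L (log B B>0) (fromℕ (suc m) * (+ 1 / 4))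
  log-> {m} 2ᵐ<B = fromℕ (2 ℕ.^ suc m) , 2ᵐ<B , m
    , subst (0ℚ <_) base≡ (positive⁻¹ (1ℚ - + 1 / 4))
    , subst (1ℚ <_) total (subst (_< (fromℕ 2 * (1ℚ - + 1 / 4)) ^ suc m) (1^n≡1 (suc m))
        (^-mono-< m (<⇒≤ 0<1) 1<3/2))
    where
    base≡ : 1ℚ - + 1 / 4 ≡ 1ℚ - fromℕ (suc m) * (+ 1 / 4) * (+ 1 / suc m)
    base≡ = cong (λ z → 1ℚ - z) (sym (trans (cong (_* (+ 1 / suc m)) (*-comm (fromℕ (suc m)) (+ 1 / 4)))
      (Logarithm.ratio-cancel m (+ 1 / 4))))
    1<3/2 : 1ℚ < fromℕ 2 * (1ℚ - + 1 / 4)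
    1<3/2 = 0<q-p⇒p<q (positive⁻¹ (fromℕ 2 * (1ℚ - + 1 / 4) - 1ℚ))
    total : (fromℕ 2 * (1ℚ - + 1 / 4)) ^ suc m ≡
      fromℕ (2 ℕ.^ suc m) * (1ℚ - fromℕ (suc m) * (+ 1 / 4) * (+ 1 / suc m)) ^ suc m
    total = trans (^-distrib-* (fromℕ 2) (1ℚ - + 1 / 4) (suc m))
      (cong₂ _*_ (sym (fromℕ-^ 2 (suc m))) (cong (_^ suc m) base≡))

U-upwards : ∀ x {p q} → p ≤ q → U x p → U x q
U-upwards x {p} {q} p≤q x<p with p <? q
... | yes p<q = U-up x p<q x<p
... | no  p≮q = subst (U x) (≤-antisym p≤q (≮⇒≥ p≮q)) x<p

x<ca⇒x/c<a : ∀ c (c>0 : Positive c) {x a} → x < c * a → (1/ c) {{pos⇒nonZero c {{c>0}}}} * x < a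
x<ca⇒x/c<a c c>0 {x} {a} x<ca = subst (1/ c * x <_)
  (trans (sym (*-assoc (1/ c) c a)) (trans (cong (_* a) (*-inverseˡ c)) (*-identityˡ a)))
  (*-mono-<ˡ (positive⁻¹ (1/ c) {{1/pos⇒pos c {{c>0}}}}) x<ca)
  where instance c≢0 = pos⇒nonZero c {{c>0}}

root-≤ : ∀ z {M a c} m n .{{_ : ℕ.NonZero m}} .{{_ : ℕ.NonZero n}} (c>0 : Positive c) → 0ℚ ≤ a →
  (∀ {y} → L z y → y ≤ M) → M ^ m ≤ (c * a) ^ n → z ^[ m / n ] ≤ℝ _•_ c {{c>0}} (fromℚ a)
root-≤ z {M} {a} {c} m n c>0 0≤a z≤M Mᵐ≤ {x} = λ where
    (inj₁ x<0)                           → x<ca⇒x/c<a c c>0 (<-≤-trans x<0 0≤ca)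
    (inj₂ (0≤x , y , 0≤y , y<z , xⁿ<yᵐ)) → x<ca⇒x/c<a c c>0 (≰⇒> λ ca≤x → <⇒≱ xⁿ<yᵐ
      (≤-trans (^-mono-≤ m 0≤y (z≤M y<z)) (≤-trans Mᵐ≤ (^-mono-≤ n 0≤ca ca≤x))))
  where
  0≤ca : 0ℚ ≤ c * a
  0≤ca = *-nonNeg (<⇒≤ (positive⁻¹ c {{c>0}})) 0≤a

-- A real cannot be compared exactly with a rational. Locatedness decides between f(1) and f(1) + 1
-- instead, whence the slack 1.
bracket : ∀ B (f : ℕ → ℚ) k → L B (f 0) → U B (f k) → ∃[ j ] L B (f j) × U B (f (suc j) + 1ℚ)
bracket B f zero    f₀<B B<fₖ = ⊥-elim (disjoint B f₀<B B<fₖ)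
bracket B f (suc k) f₀<B B<fₖ with located B (p<p+1 (f 1))
... | inj₂ B<f₁+1 = 0 , f₀<B , B<f₁+1
... | inj₁ f₁<B   = let (j , fⱼ<B , B<fⱼ₊₁) = bracket B (f ∘ suc) k f₁<B B<fₖ in suc j , fⱼ<B , B<fⱼ₊₁

unique-map : ∀ (f : A → B) {xs} → (∀ {x y} → x ∈ xs → y ∈ xs → f x ≡ f y → x ≡ y) →
  Unique xs → Unique (map f xs)
unique-map f inj []            = []
unique-map f {x ∷ xs} inj (x∉xs ∷ uniq) =
  All.map⁺ (All.tabulate λ y∈xs fx≡fy →
    All.lookup x∉xs y∈xs (inj (here refl) (there y∈xs) fx≡fy))
  ∷ unique-map f (λ x∈ y∈ → inj (there x∈) (there y∈)) uniq

++-injective : ∀ (xs : List A) {ys xs′ ys′} → length xs ≡ length xs′ → xs ++ ys ≡ xs′ ++ ys′ →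
  xs ≡ xs′ × ys ≡ ys′
++-injective []       {xs′ = []}      _   eq = refl , eq
++-injective (x ∷ xs) {xs′ = x′ ∷ xs′} len eq =
  let (x≡ , rest) = ∷-injective eq
      (xs≡ , ys≡) = ++-injective xs (ℕ.suc-injective len) rest
  in cong₂ _∷_ x≡ xs≡ , ys≡

-- Blocks of a common length can be cut off one after the other.
concat-injective : ∀ {k} {uss vss : List (List A)} → All (λ u → length u ≡ k) uss →
  All (λ v → length v ≡ k) vss → length uss ≡ length vss → concat uss ≡ concat vss → uss ≡ vss
concat-injective []       []       _   _  = refl
concat-injective {uss = u ∷ uss} {v ∷ vss} (u∈ ∷ us) (v∈ ∷ vs) len eq =
  let (u≡v , rest) = ++-injective u (trans u∈ (sym v∈)) eq in
  cong₂ _∷_ u≡v (concat-injective us vs (ℕ.suc-injective len) rest)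

length-words : ∀ (xs : List A) k → length (words xs k) ≡ length xs ℕ.^ k
length-words xs zero    = refl
length-words xs (suc k) = trans (length-cartesianProductWith _∷_ xs (words xs k))
  (cong (length xs ℕ.*_) (length-words xs k))

Large : ℚ → Set
Large y = 1ℚ + 1ℚ ≤ y ⊎ y ≤ - (1ℚ + 1ℚ)

mersenneValue : ∀ {r} qs → 0 ℕ.< length qs → All MersennePrime qs → MersenneValue r (composeθ r qs)
mersenneValue (q ∷ qs) _ primes = q ∷⁺ qs , primes , refl

0<H : ∀ z → 0 ℕ.< H z
0<H z = ℕ.≤-trans (ℕ.s≤s ℕ.z≤n) (ℕ.m≤n⊔m ℤ.∣ ↥ z ∣ (↧ₙ z))

-- Values of concatenated blocks

module Lower {qs d e} .{{_ : ℕ.NonZero d}} (block : Block qs d e)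
  (mersenne : ∀ {q} → q ∈ qs → MersennePrime q) (odd : ∀ {q} → q ∈ qs → OddLetter q)
  {r : ℚ} (prefix : List ℕ) (prefix-mersenne : All MersennePrime prefix)
  (large : Large (composeθ r prefix)) where

  open Block block

  private
    r′ = composeθ r prefix
    C  = 2 ℕ.* H r′
    N  = length blocks

    2≤C : 2 ℕ.≤ C
    2≤C = ℕ.*-monoʳ-≤ 2 (0<H r′)

    instance
      C-nonZero : ℕ.NonZero C
      C-nonZero = ℕ.>-nonZero (ℕ.≤-trans (ℕ.s≤s ℕ.z≤n) 2≤C)

  3≤Q : 3 ℕ.≤ Q
  3≤Q with nonEmpty
  ... | u , u∈ with shape u∈
  ...   | len , u⊆ , refl = bound len (All.map odd u⊆)
    where
    1≤product : ∀ {u} → All OddLetter u → 1 ℕ.≤ product u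
    1≤product []                          = ℕ.≤-refl
    1≤product {_ ∷ u} (odd-letter h refl ∷ odds) =
      ℕ.*-mono-≤ {1} {3 ℕ.+ (h ℕ.+ h)} {1} {product u} (ℕ.s≤s ℕ.z≤n) (1≤product odds)
    bound : ∀ {u k} → length u ≡ suc k → All OddLetter u → 3 ℕ.≤ product u
    bound {_ ∷ u} _ (odd-letter h refl ∷ odds) =
      ℕ.*-mono-≤ {3} {3 ℕ.+ (h ℕ.+ h)} {1} {product u} (ℕ.m≤m+n 3 (h ℕ.+ h)) (1≤product odds)

  concat-shape : ∀ {bs} → All (_∈ blocks) bs →
    All (_∈ qs) (concat bs) × product (concat bs) ≡ Q ℕ.^ length bs
  concat-shape []           = [] , refl
  concat-shape {b ∷ bs} (b∈ ∷ bs∈) =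
    let (_ , b⊆ , b≡)  = shape b∈
        (bs⊆ , bs≡)    = concat-shape bs∈
    in All.++⁺ b⊆ bs⊆ , trans (product-++ b (concat bs)) (cong₂ ℕ._*_ b≡ bs≡)

  value : List (List ℕ) → ℚ
  value bs = composeθ r′ (concat bs)

  values-unique : ∀ j → Unique (map value (words blocks j))
  values-unique j = unique-map value injective (words-unique unique j)
    where
    injective : ∀ {bs cs} → bs ∈ words blocks j → cs ∈ words blocks j → value bs ≡ value cs → bs ≡ cs
    injective bs∈ cs∈ eq =
      let (len-bs , bs⊆) = ∈-words⁻ {xs = blocks} j bs∈
          (len-cs , cs⊆) = ∈-words⁻ {xs = blocks} j cs∈
          (letters-bs , product-bs) = concat-shape bs⊆
          (letters-cs , product-cs) = concat-shape cs⊆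
          same = trans len-bs (sym len-cs)
      in concat-injective (All.map (proj₁ ∘ shape) bs⊆) (All.map (proj₁ ∘ shape) cs⊆) same
           (composeθ-injective large (All.map odd letters-bs) (All.map odd letters-cs)
             (trans product-bs (trans (cong (Q ℕ.^_) same) (sym product-cs))) eq)

  value-mersenne : ∀ {j bs} → bs ∈ words blocks (suc j) → MersenneValue r (value bs)
  value-mersenne {j} {bs} bs∈ with ∈-words⁻ {xs = blocks} (suc j) bs∈
  value-mersenne {j} {[]} bs∈ | () , _
  value-mersenne {j} {b ∷ bs} bs∈ | len , bs⊆@(b∈ ∷ _) =
    subst (MersenneValue r) (foldl-++ (λ z q → θ q z) r prefix (concat (b ∷ bs)))
      (mersenneValue (prefix ++ concat (b ∷ bs)) nonempty
        (All.++⁺ prefix-mersenne (All.map mersenne (proj₁ (concat-shape bs⊆)))))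
    where
    nonempty : 0 ℕ.< length (prefix ++ b ++ concat bs)
    nonempty = begin
      1                                        ≤⟨ ℕ.s≤s ℕ.z≤n ⟩
      suc k                                    ≡⟨ proj₁ (shape b∈) ⟨
      length b                                 ≤⟨ ℕ.m≤m+n (length b) _ ⟩
      length b ℕ.+ length (concat bs)          ≡⟨ length-++ b ⟨
      length (b ++ concat bs)                  ≤⟨ ℕ.m≤n+m _ (length prefix) ⟩
      length prefix ℕ.+ length (b ++ concat bs) ≡⟨ length-++ prefix ⟨
      length (prefix ++ b ++ concat bs)        ∎
      where open ℕ.≤-Reasoning

  H-value : ∀ {j bs} → bs ∈ words blocks j → H (value bs) ℕ.≤ C ℕ.^ (Q ℕ.^ j)
  H-value {j} {bs} bs∈ = let (len , bs⊆) = ∈-words⁻ {xs = blocks} j bs∈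
                             (letters , product≡) = concat-shape bs⊆ in begin
    H (value bs)                     ≤⟨ ℕ.m≤m+n (H (value bs)) _ ⟩
    2 ℕ.* H (value bs)               ≤⟨ H-composeθ-≤ (All.map (odd⇒≥2 ∘ odd) letters) ⟩
    C ℕ.^ product (concat bs)        ≡⟨ cong (C ℕ.^_) (trans product≡ (cong (Q ℕ.^_) len)) ⟩
    C ℕ.^ (Q ℕ.^ j)                  ∎
    where open ℕ.≤-Reasoning

  -- The bound of `H-value` for j + 1 concatenated blocks: once B exceeds it, all N^(j+1) values
  -- count.
  threshold : ℕ → ℚ
  threshold j = fromℕ (C ℕ.^ (Q ℕ.^ suc j))

  atLeast : ∀ {B} j → L B (threshold j) → AtLeast (MersenneValuesUpTo r B) (N ℕ.^ suc j)
  atLeast {B} j y<B = map value (words blocks (suc j))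
    , trans (length-map value (words blocks (suc j))) (length-words blocks (suc j))
    , values-unique (suc j)
    , All.map⁺ (All.tabulate λ bs∈ → value-mersenne {j} bs∈ , bounded bs∈)
    where
    bounded : ∀ {bs} → bs ∈ words blocks (suc j) → fromℚ (fromℕ (H (value bs))) ≤ℝ B
    bounded bs∈ q<H = L-down B (<-≤-trans q<H (fromℕ-mono-≤ (H-value {suc j} bs∈))) y<B

  threshold-unbounded : ∀ k → fromℕ (suc k) ≤ threshold k
  threshold-unbounded k = fromℕ-mono-≤ (begin
    suc k                  ≤⟨ ℕ.<⇒≤ (n<2^n (suc k)) ⟩
    2 ℕ.^ suc k            ≤⟨ ℕ.^-monoˡ-≤ (suc k) (ℕ.≤-trans (ℕ.n≤1+n 2) 3≤Q) ⟩
    Q ℕ.^ suc k            ≤⟨ ℕ.<⇒≤ (n<2^n (Q ℕ.^ suc k)) ⟩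
    2 ℕ.^ (Q ℕ.^ suc k)    ≤⟨ ℕ.^-monoˡ-≤ (Q ℕ.^ suc k) 2≤C ⟩
    C ℕ.^ (Q ℕ.^ suc k)    ∎)
    where open ℕ.≤-Reasoning

  -- Absorbs the slack 1 of `bracket` when B is compared with a power of 2.
  C^n+1≤2^Cn : ∀ n → 1 ℕ.≤ n → C ℕ.^ n ℕ.+ 1 ℕ.≤ 2 ℕ.^ (C ℕ.* n)
  C^n+1≤2^Cn n 1≤n = begin
    C ℕ.^ n ℕ.+ 1      ≡⟨ ℕ.+-comm (C ℕ.^ n) 1 ⟩
    suc (C ℕ.^ n)      ≤⟨ ℕ.^-monoˡ-< n {{ℕ.>-nonZero 1≤n}} (n<2^n C) ⟩
    (2 ℕ.^ C) ℕ.^ n    ≡⟨ ℕ.^-*-assoc 2 C n ⟩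
    2 ℕ.^ (C ℕ.* n)    ∎
    where open ℕ.≤-Reasoning

  Q^j≥1 : ∀ j → 1 ℕ.≤ Q ℕ.^ j
  Q^j≥1 j = ℕ.m^n>0 Q {{ℕ.>-nonZero (ℕ.≤-trans (ℕ.s≤s ℕ.z≤n) 3≤Q)}} j

  1≤CQ : 1 ℕ.≤ C ℕ.* Q
  1≤CQ = ℕ.*-mono-≤ {1} {C} {1} {Q} (ℕ.≤-trans (ℕ.s≤s ℕ.z≤n) 2≤C) (ℕ.≤-trans (ℕ.s≤s ℕ.z≤n) 3≤Q)

  log-≤-threshold : ∀ {B} {B>0 : Positiveℝ B} {y} j → U B (threshold j + 1ℚ) → L (log B B>0) y →
    y ≤ fromℕ (C ℕ.* Q ℕ.^ suc j)
  log-≤-threshold {B} {B>0} {y} j B<y y<log = go (C ℕ.* Q ℕ.^ suc j) 0<M B<2^M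
    where
    0<M : 0 ℕ.< C ℕ.* Q ℕ.^ suc j
    0<M = ℕ.*-mono-≤ {1} {C} {1} {Q ℕ.^ suc j} (ℕ.≤-trans (ℕ.s≤s ℕ.z≤n) 2≤C) (Q^j≥1 (suc j))
    y+1≤2^M : threshold j + 1ℚ ≤ fromℕ (2 ℕ.^ (C ℕ.* Q ℕ.^ suc j))
    y+1≤2^M = subst (_≤ fromℕ (2 ℕ.^ (C ℕ.* Q ℕ.^ suc j))) (fromℕ-+ (C ℕ.^ (Q ℕ.^ suc j)) 1)
      (fromℕ-mono-≤ (C^n+1≤2^Cn (Q ℕ.^ suc j) (Q^j≥1 (suc j))))
    B<2^M : U B (fromℕ (2 ℕ.^ (C ℕ.* Q ℕ.^ suc j)))
    B<2^M = U-upwards B y+1≤2^M B<y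
    go : ∀ M → 0 ℕ.< M → U B (fromℕ (2 ℕ.^ M)) → y ≤ fromℕ M
    go (suc i) _ B<2^M = log-≤ {B} {B>0} {i} {y} B<2^M y<log

  powers : ∀ m n j → m ℕ.* d ℕ.≤ e ℕ.* n → fromℕ (Q ℕ.^ j) ^ m ≤ fromℕ (N ℕ.^ j) ^ n
  powers m n j md≤en = ^-exponents-≤ d e m n (fromℕ-mono-≤ {1} (Q^j≥1 j)) (0≤fromℕ (N ℕ.^ j)) md≤en (begin
    fromℕ (Q ℕ.^ j) ^ e     ≡⟨ trans (cong (_^ e) (fromℕ-^ Q j)) (^-comm (fromℕ Q) j e) ⟩
    (fromℕ Q ^ e) ^ j       ≤⟨ ^-mono-≤ j (^-nonNeg e (0≤fromℕ Q)) numerous ⟩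
    (fromℕ N ^ d) ^ j       ≡⟨ trans (^-comm (fromℕ N) d j) (cong (_^ d) (sym (fromℕ-^ N j))) ⟩
    fromℕ (N ℕ.^ j) ^ d     ∎)
    where open ≤-Reasoning

  -- B is bounded in terms of the threshold following the one that it exceeds, so log B can exceed
  -- the matched power of Q by the factor C Q. This factor enters the implied constant, as m ≤ n.
  powers-scaled : ∀ m n j → m ℕ.* d ℕ.≤ e ℕ.* n → m ℕ.≤ n →
    fromℕ (C ℕ.* Q ℕ.^ suc j) ^ m ≤ (fromℕ (C ℕ.* Q) * fromℕ (N ℕ.^ j)) ^ n
  powers-scaled m n j md≤en m≤n = begin
    fromℕ (C ℕ.* Q ℕ.^ suc j) ^ m        ≡⟨ cong (λ z → fromℕ z ^ m) (ℕ.*-assoc C Q (Q ℕ.^ j)) ⟨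
    fromℕ (C ℕ.* Q ℕ.* Q ℕ.^ j) ^ m
      ≡⟨ trans (cong (_^ m) (fromℕ-* (C ℕ.* Q) (Q ℕ.^ j))) (^-distrib-* (fromℕ (C ℕ.* Q)) (fromℕ (Q ℕ.^ j)) m) ⟩
    fromℕ (C ℕ.* Q) ^ m * fromℕ (Q ℕ.^ j) ^ m
      ≤⟨ *-mono-≤² (^-nonNeg m (0≤fromℕ (C ℕ.* Q))) (^-monoʳ-≤ (fromℕ-mono-≤ {1} 1≤CQ) m≤n)
           (^-nonNeg m (0≤fromℕ (Q ℕ.^ j))) (powers m n j md≤en) ⟩
    fromℕ (C ℕ.* Q) ^ n * fromℕ (N ℕ.^ j) ^ n   ≡⟨ ^-distrib-* (fromℕ (C ℕ.* Q)) (fromℕ (N ℕ.^ j)) n ⟨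
    (fromℕ (C ℕ.* Q) * fromℕ (N ℕ.^ j)) ^ n     ∎
    where open ≤-Reasoning

  0<c : 0ℚ < fromℕ (C ℕ.* Q)
  0<c = <-≤-trans 0<1 (fromℕ-mono-≤ {1} 1≤CQ)

  lower : ∀ m n .{{_ : ℕ.NonZero m}} .{{_ : ℕ.NonZero n}} → m ℕ.* d ℕ.≤ e ℕ.* n → m ℕ.≤ n →
    (λ B B>0 → log B B>0 ^[ m / n ]) ≪# MersenneValuesUpTo r
  -- For B ≥ B₀ the first threshold lies below B, which is where `bracket` starts.
  lower m n md≤en m≤n = fromℕ (C ℕ.* Q) , positive 0<c , fromℚ (threshold 0 + 1ℚ) , count
    where
    count : ∀ B (B>0 : Positiveℝ B) → fromℚ (threshold 0 + 1ℚ) ≤ℝ B → ∃[ i ] AtLeast (MersenneValuesUpTo r B) i ×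
      log B B>0 ^[ m / n ] ≤ℝ _•_ (fromℕ (C ℕ.* Q)) {{positive 0<c}} (fromℚ (fromℕ i))
    count B B>0 B₀≤B =
      let (u , B<u)           = U-inhabited B
          (k , u<k)           = archimedean u
          (j , y<B , B<y′+1)  = bracket B threshold k (B₀≤B (p<p+1 (threshold 0)))
                                  (U-up B (<-≤-trans u<k (threshold-unbounded k)) B<u)
      in N ℕ.^ suc j , atLeast {B} j y<B ,
         root-≤ (log B B>0) {fromℕ (C ℕ.* Q ℕ.^ suc (suc j))} {fromℕ (N ℕ.^ suc j)} {fromℕ (C ℕ.* Q)} m n
           (positive 0<c) (0≤fromℕ (N ℕ.^ suc j))
           (λ {y} → log-≤-threshold {B} {B>0} {y} (suc j) B<y′+1) (powers-scaled m n (suc j) md≤en m≤n)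

-- Prefixes leading to a value of modulus at least 2

fromNonNeg : ∀ {y} → 0ℚ ≤ y → Large (composeθ y (3 ∷ 3 ∷ []))
fromNonNeg 0≤y = inj₁ (+-monoˡ-≤ 1ℚ (1≤x^n 3 (p≤q+p 1ℚ (^-nonNeg 3 0≤y))))

odd3 : OddLetter 3
odd3 = odd-letter 0 refl

odd7 : OddLetter 7
odd7 = odd-letter 2 refl

fromUnit : ∀ {s} → 0ℚ ≤ s → s ≤ 1ℚ → Large (composeθ (- s) (3 ∷ 3 ∷ 3 ∷ []))
fromUnit {s} 0≤s s≤1 = fromNonNeg (subst (0ℚ ≤_) (sym (θ-neg s odd3))
  (neg-antimono-≤ (+-monoˡ-≤ (- 1ℚ) (x^n≤1 3 0≤s s≤1))))

-- Near -1.32 lies a repelling fixed point of z³ + 1, so no bounded number of letters 3 suffices. If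
-- s³ ≤ 2, the letter 3 moves -s into [-1, 0]; otherwise s⁷ ≥ s⁶ ≥ 4, and the letter 7 leads to at
-- most -3.
fromAboveOne : ∀ {s} → 1ℚ ≤ s → ∃[ qs ] All (_∈ 3 ∷ 7 ∷ []) qs × Large (composeθ (- s) qs)
fromAboveOne {s} 1≤s with s ^ 3 ≤? 1ℚ + 1ℚ
... | yes s³≤2 = 3 ∷ 3 ∷ 3 ∷ 3 ∷ [] , here refl ∷ here refl ∷ here refl ∷ here refl ∷ [] ,
  subst (λ z → Large (composeθ z (3 ∷ 3 ∷ 3 ∷ []))) (sym (θ-neg s odd3))
    (fromUnit (+-monoˡ-≤ (- 1ℚ) (1≤x^n 3 1≤s)) (+-monoˡ-≤ (- 1ℚ) s³≤2))
... | no  s³≰2 = 7 ∷ [] , there (here refl) ∷ [] , inj₂ (subst (_≤ - (1ℚ + 1ℚ)) (sym (θ-neg s odd7))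
  (neg-antimono-≤ (≤-trans 2≤3 (+-monoˡ-≤ (- 1ℚ) 4≤s⁷))))
  where
  open ≤-Reasoning
  2≤s³ = <⇒≤ (≰⇒> s³≰2)
  four = (1ℚ + 1ℚ) * (1ℚ + 1ℚ)
  2≤3 : 1ℚ + 1ℚ ≤ four - 1ℚ
  2≤3 = <⇒≤ (0<q-p⇒p<q (positive⁻¹ (four - 1ℚ - (1ℚ + 1ℚ))))
  4≤s⁷ : four ≤ s ^ 7
  4≤s⁷ = begin
    four                ≤⟨ *-mono-≤² 0≤2 2≤s³ 0≤2 2≤s³ ⟩
    s ^ 3 * s ^ 3       ≡⟨ ^-homo-* s 3 3 ⟨
    s ^ 6               ≤⟨ ^-monoʳ-≤ {s} {6} {7} 1≤s (ℕ.n≤1+n 6) ⟩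
    s ^ 7               ∎

large-prefix : ∀ r → ∃[ qs ] All (_∈ 3 ∷ 7 ∷ []) qs × Large (composeθ r qs)
large-prefix r with ≤-total 0ℚ r
... | inj₁ 0≤r = 3 ∷ 3 ∷ [] , here refl ∷ here refl ∷ [] , fromNonNeg 0≤r
... | inj₂ r≤0 = subst (λ z → ∃[ qs ] All (_∈ 3 ∷ 7 ∷ []) qs × Large (composeθ z qs)) neg-neg
                   (fromNegative (≤-total (- r) 1ℚ))
  where
  neg-neg : - (- r) ≡ r
  neg-neg = solve 1 (λ z → :- (:- z) := z) refl r
    where open +-*-Solver using (solve; _:=_; :-_)
  fromNegative : - r ≤ 1ℚ ⊎ 1ℚ ≤ - r → ∃[ qs ] All (_∈ 3 ∷ 7 ∷ []) qs × Large (composeθ (- (- r)) qs)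
  fromNegative (inj₁ s≤1) = 3 ∷ 3 ∷ 3 ∷ [] , here refl ∷ here refl ∷ here refl ∷ [] ,
    fromUnit (neg-antimono-≤ r≤0) s≤1
  fromNegative (inj₂ 1≤s) = fromAboveOne 1≤s

root-≥ : ∀ z {a b y c} m n .{{_ : ℕ.NonZero m}} .{{_ : ℕ.NonZero n}} (c>0 : Positive c) → 0ℚ ≤ y → L z y →
  a ≤ c * b → b ^ n ≤ y ^ m → fromℚ a ≤ℝ _•_ c {{c>0}} (z ^[ m / n ])
root-≥ z {a} {b} {y} {c} m n@(suc n-1) c>0 0≤y y<z a≤cb bⁿ≤yᵐ {x} x<a with x <? 0ℚ
... | yes x<0 = inj₁ (x<ca⇒x/c<a c c>0 (subst (x <_) (sym (*-zeroʳ c)) x<0))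
... | no  x≮0 = inj₂ (0≤x/c , y , 0≤y , y<z ,
  <-≤-trans (^-mono-< n-1 0≤x/c (x<ca⇒x/c<a c c>0 (<-≤-trans x<a a≤cb))) bⁿ≤yᵐ)
  where
  0≤x/c = *-nonNeg (<⇒≤ (positive⁻¹ ((1/ c) {{pos⇒nonZero c {{c>0}}}}) {{1/pos⇒pos c {{c>0}}}})) (≮⇒≥ x≮0)

0≤root : ∀ z {c} m n .{{_ : ℕ.NonZero m}} .{{_ : ℕ.NonZero n}} (c>0 : Positive c) →
  fromℚ 0ℚ ≤ℝ _•_ c {{c>0}} (z ^[ m / n ])
0≤root z {c} m n c>0 {x} x<0 = inj₁ (x<ca⇒x/c<a c c>0 (subst (x <_) (sym (*-zeroʳ c)) x<0))

-- The upper bound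

mersenne : ℕ → ℕ
mersenne n = 2 ℕ.^ n ℕ.∸ 1

-- Words are recoded by the exponents n of their letters 2ⁿ - 1, because the weights of the upper
-- bound are functions of n.
exponents : ∀ {qs} → All MersennePrime qs → ∃[ ns ] map mersenne ns ≡ qs × All (Prime ∘ mersenne) ns
exponents []                          = [] , refl , []
exponents ((p-prime , n , refl) ∷ rest) =
  let (ns , eq , primes) = exponents rest in n ∷ ns , cong (mersenne n ∷_) eq , p-prime ∷ primes

prime⇒≥2 : ∀ {p} → Prime p → 2 ℕ.≤ p
prime⇒≥2 p = ℕ.nonTrivial⇒n>1 _ {{prime⇒nonTrivial p}}

-- `heavy` states w(n) ≥ (2ⁿ - 1)^(-e/d) with cleared exponents, and `geometric` keeps every finite
-- sum of weights at most 1 - 1/K.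
module Upper {w : ℕ → ℚ} (0≤w : ∀ n → 0ℚ ≤ w n) {K : ℚ} (0<K : 0ℚ < K)
  (geometric : ∀ N → 1ℚ + Σ[ w ] (upTo N) * K ≤ K) (d e : ℕ) .{{_ : ℕ.NonZero d}}
  (heavy : ∀ n → Prime (mersenne n) → 1ℚ ≤ w n ^ d * fromℕ (mersenne n) ^ e) where

  norm : List ℕ → ℕ
  norm u = product (map mersenne u)

  weight-norm : ∀ {u} → All (Prime ∘ mersenne) u → 1ℚ ≤ weight w u ^ d * fromℕ (norm u) ^ e
  weight-norm []                  = ≤-reflexive (sym (cong₂ _*_ (1^n≡1 d) (1^n≡1 e)))
  weight-norm {n ∷ u} (p ∷ primes) = begin
    1ℚ * 1ℚ
      ≤⟨ *-mono-≤² (<⇒≤ 0<1) (heavy n p) (<⇒≤ 0<1) (weight-norm primes) ⟩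
    w n ^ d * fromℕ (mersenne n) ^ e * (W ^ d * P ^ e)
      ≡⟨ *-CS.interchange (w n ^ d) (fromℕ (mersenne n) ^ e) (W ^ d) (P ^ e) ⟩
    w n ^ d * W ^ d * (fromℕ (mersenne n) ^ e * P ^ e)
      ≡⟨ cong₂ _*_ (^-distrib-* (w n) W d)
           (trans (cong (_^ e) (fromℕ-* (mersenne n) (norm u))) (^-distrib-* (fromℕ (mersenne n)) P e)) ⟨
    (w n * W) ^ d * fromℕ (norm (n ∷ u)) ^ e ∎
    where
    open ≤-Reasoning
    W = weight w u
    P = fromℕ (norm u)

  1/K = proj₁ (inverse 0<K)

  0<1/K : 0ℚ < 1/K
  0<1/K = proj₁ (proj₂ (inverse 0<K))

  K*1/K : K * 1/K ≡ 1ℚ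
  K*1/K = proj₂ (proj₂ (inverse 0<K))

  -- By `kraft` some word among the N has weight at most K/N. Its weight is also at least
  -- norm^(-e/d), so N/K ≤ norm^(e/d).
  few : ∀ v vs → Unique (v ∷ vs) → All (All (Prime ∘ mersenne)) (v ∷ vs) →
    ∃[ u ] u ∈ v ∷ vs × (fromℕ (length (v ∷ vs)) * 1/K) ^ d ≤ fromℕ (norm u) ^ e
  few v vs uniq primes =
    let (u , u∈ , NW≤K) = average⁻ (λ u → N * weight w u) K v vs (begin
          Σ[ (λ u → N * weight w u) ] (v ∷ vs)   ≡⟨ Σ-* N (weight w) (v ∷ vs) ⟩
          N * Σ[ weight w ] (v ∷ vs)             ≤⟨ *-monoˡ-≤ (0≤fromℕ n) (kraft 0≤w (<⇒≤ 0<K) geometric uniq) ⟩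
          N * K                                  ≡⟨ *-comm N K ⟩
          K * N                                  ∎)
    in u , u∈ , bound (All.lookup primes u∈) NW≤K
    where
    open ≤-Reasoning
    n = length (v ∷ vs)
    N = fromℕ n
    bound : ∀ {u} → All (Prime ∘ mersenne) u → N * weight w u ≤ K → (N * 1/K) ^ d ≤ fromℕ (norm u) ^ e
    bound {u} primes NW≤K = begin
      (N * 1/K) ^ d                  ≡⟨ *-identityʳ _ ⟨
      (N * 1/K) ^ d * 1ℚ             ≤⟨ *-monoˡ-≤ (^-nonNeg d 0≤N/K) (weight-norm primes) ⟩
      (N * 1/K) ^ d * (W ^ d * P ^ e)
        ≡⟨ trans (sym (*-assoc ((N * 1/K) ^ d) (W ^ d) (P ^ e))) (cong (_* P ^ e) (sym (^-distrib-* (N * 1/K) W d))) ⟩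
      (N * 1/K * W) ^ d * P ^ e
        ≤⟨ *-monoʳ-≤ (^-nonNeg e (0≤fromℕ (norm u))) (x^n≤1 d (*-nonNeg 0≤N/K (weight-nonNeg 0≤w u)) (begin
             N * 1/K * W         ≡⟨ trans (*-assoc N 1/K W) (trans (cong (N *_) (*-comm 1/K W)) (sym (*-assoc N W 1/K))) ⟩
             N * W * 1/K         ≤⟨ *-monoʳ-≤ (<⇒≤ 0<1/K) NW≤K ⟩
             K * 1/K             ≡⟨ K*1/K ⟩
             1ℚ                  ∎)) ⟩
      1ℚ * P ^ e                     ≡⟨ *-identityˡ _ ⟩
      P ^ e                          ∎
      where
      W = weight w u
      P = fromℕ (norm u)
      0≤N/K = *-nonNeg (0≤fromℕ n) (<⇒≤ 0<1/K)

  module _ (r : ℚ) (4<H : 4 ℕ.< H r) (B : ℝ) where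

    value : List ℕ → ℚ
    value u = composeθ r (map mersenne u)

    Good : List ℕ → Set
    Good u = All (Prime ∘ mersenne) u × fromℚ (fromℕ (H (value u))) ≤ℝ B

    -- One word is chosen for each value; as the values are the images of the words, distinct values
    -- come from distinct words.
    extract : ∀ {ts} → All (MersenneValuesUpTo r B) ts → ∃[ us ] map value us ≡ ts × All Good us
    extract []                                           = [] , refl , []
    extract (((qs , primes , refl) , bounded) ∷ members) =
      let (us , eq , good)      = extract members
          (ns , eq′ , primes′)  = exponents primes
          same                  = cong (composeθ r) eq′
      in ns ∷ us , cong₂ _∷_ same eq ,
         (primes′ , subst (λ t → fromℚ (fromℕ (H t)) ≤ℝ B) (sym same) bounded) ∷ good

    -- The hypothesis H(r) > 4 enters as the case p = 1 of `H-composeθ-≥`. The spare factor 2 gives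
    -- the strict inequality required by the lower cut.
    norm<B : ∀ {u} → Good u → L B (fromℕ (2 ℕ.^ norm u))
    norm<B {u} (primes , bounded) = bounded (fromℕ-mono-< (begin
      suc (2 ℕ.^ norm u)            ≤⟨ ℕ.+-monoˡ-≤ (2 ℕ.^ norm u) (ℕ.m^n>0 2 (norm u)) ⟩
      2 ℕ.^ norm u ℕ.+ 2 ℕ.^ norm u ≡⟨ cong (2 ℕ.^ norm u ℕ.+_) (ℕ.+-identityʳ _) ⟨
      2 ℕ.* 2 ℕ.^ norm u            ≡⟨ cong (λ i → 2 ℕ.* 2 ℕ.^ i) (ℕ.*-identityˡ (norm u)) ⟨
      2 ℕ.* 2 ℕ.^ (1 ℕ.* norm u)
        ≤⟨ H-composeθ-≥ {map mersenne u} {1} {r} (All.map⁺ (All.map prime⇒≥2 primes)) (ℕ.<⇒≤ 4<H) ⟩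
      H (value u)                   ∎))
      where open ℕ.≤-Reasoning

    1≤norm : ∀ {u} → All (Prime ∘ mersenne) u → 1 ℕ.≤ norm u
    1≤norm []                   = ℕ.≤-refl
    1≤norm {n ∷ u} (p ∷ primes) =
      ℕ.*-mono-≤ {1} {mersenne n} {1} {norm u} (ℕ.≤-trans (ℕ.s≤s ℕ.z≤n) (prime⇒≥2 p)) (1≤norm primes)

  ¼ : ℚ
  ¼ = + 1 / 4

  0≤¼ : 0ℚ ≤ ¼
  0≤¼ = <⇒≤ (0<1/suc 3)

  0<c : 0ℚ < K * fromℕ 4
  0<c = *-pos 0<K (0<fromℕ 3)

  -- Q/4 is the lower approximation of log B supplied by `log->`. As m ≤ n, the factor 1/4 may be
  -- moved inside both powers.
  N/K-root : ∀ {N Q} m n → 1 ℕ.≤ Q → e ℕ.* n ℕ.≤ m ℕ.* d → m ℕ.≤ n →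
    (fromℕ N * 1/K) ^ d ≤ fromℕ Q ^ e → (fromℕ N * 1/K * ¼) ^ n ≤ (fromℕ Q * ¼) ^ m
  N/K-root {N} {Q} m n 1≤Q en≤md m≤n N≤ = begin
    (fromℕ N * 1/K * ¼) ^ n          ≡⟨ ^-distrib-* (fromℕ N * 1/K) ¼ n ⟩
    (fromℕ N * 1/K) ^ n * ¼ ^ n
      ≤⟨ *-mono-≤² (^-nonNeg n 0≤N/K)
           (^-exponents-≥ d e m n (fromℕ-mono-≤ {1} 1≤Q) 0≤N/K en≤md N≤) (^-nonNeg n 0≤¼)
           (^-antimonoʳ-≤ 0≤¼ ¼≤1 m≤n) ⟩
    fromℕ Q ^ m * ¼ ^ m              ≡⟨ ^-distrib-* (fromℕ Q) ¼ m ⟨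
    (fromℕ Q * ¼) ^ m                ∎
    where
    open ≤-Reasoning
    0≤N/K = *-nonNeg (0≤fromℕ N) (<⇒≤ 0<1/K)
    ¼≤1 : ¼ ≤ 1ℚ
    ¼≤1 = <⇒≤ (0<q-p⇒p<q (positive⁻¹ (1ℚ - ¼)))

  c*N/c : ∀ x → K * fromℕ 4 * (x * 1/K * ¼) ≡ x
  c*N/c x = begin
    K * fromℕ 4 * (x * 1/K * ¼)
      ≡⟨ solve 5 (λ k f n i q → k :* f :* (n :* i :* q) := k :* i :* (f :* q) :* n) refl K (fromℕ 4) x 1/K ¼ ⟩
    K * 1/K * (fromℕ 4 * ¼) * x    ≡⟨ cong₂ (λ a b → a * b * x) K*1/K (fromℕ-inverse 3) ⟩
    1ℚ * 1ℚ * x                    ≡⟨ trans (cong (_* x) (*-identityˡ 1ℚ)) (*-identityˡ x) ⟩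
    x                              ∎
    where
    open ≡-Reasoning
    open +-*-Solver using (solve; _:=_; _:*_)

  module _ m n .{{_ : ℕ.NonZero m}} .{{_ : ℕ.NonZero n}} (en≤md : e ℕ.* n ℕ.≤ m ℕ.* d) (m≤n : m ℕ.≤ n)
    {B : ℝ} {B>0 : Positiveℝ B} where

    Bounded : ℕ → Set
    Bounded N = fromℚ (fromℕ N) ≤ℝ _•_ (K * fromℕ 4) {{positive 0<c}} (log B B>0 ^[ m / n ])

    bounded : ∀ N Q → 1 ℕ.≤ Q → L B (fromℕ (2 ℕ.^ Q)) → (fromℕ N * 1/K) ^ d ≤ fromℕ Q ^ e → Bounded N
    bounded N (suc i) 1≤Q 2^Q<B N≤ =
      root-≥ (log B B>0) {fromℕ N} {fromℕ N * 1/K * ¼} {fromℕ (suc i) * ¼} {K * fromℕ 4} m n (positive 0<c)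
        (*-nonNeg (0≤fromℕ (suc i)) 0≤¼) (log-> {B} {B>0} {i} 2^Q<B) (≤-reflexive (sym (c*N/c (fromℕ N))))
        (N/K-root {N} {suc i} m n 1≤Q en≤md m≤n N≤)

    bounded-length : ∀ r (4<H : 4 ℕ.< H r) us → Unique us → All (Good r 4<H B) us → Bounded (length us)
    bounded-length r 4<H []       _    _    = 0≤root (log B B>0) {K * fromℕ 4} m n (positive 0<c)
    bounded-length r 4<H (v ∷ vs) uniq good =
      let (u , u∈ , N≤) = few v vs uniq (All.map proj₁ good)
          u-good        = All.lookup good u∈
      in bounded (length (v ∷ vs)) (norm u) (1≤norm r 4<H B (proj₁ u-good)) (norm<B r 4<H B u-good) N≤

  upper : ∀ {r} → 4 ℕ.< H r → ∀ m n .{{_ : ℕ.NonZero m}} .{{_ : ℕ.NonZero n}} →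
    e ℕ.* n ℕ.≤ m ℕ.* d → m ℕ.≤ n → MersenneValuesUpTo r #≪ (λ B B>0 → log B B>0 ^[ m / n ])
  upper {r} 4<H m n en≤md m≤n = K * fromℕ 4 , positive 0<c , fromℚ 0ℚ , λ B B>0 _ → count B B>0
    where
    count : ∀ B (B>0 : Positiveℝ B) N → AtLeast (MersenneValuesUpTo r B) N → Bounded m n en≤md m≤n {B} {B>0} N
    count B B>0 N (ts , len , uniq , members) =
      let (us , eq , good) = extract r 4<H B members
          length-us        = trans (sym (length-map (value r 4<H B) us)) (trans (cong length eq) len)
      in subst (Bounded m n en≤md m≤n {B} {B>0}) length-us
           (bounded-length m n en≤md m≤n {B} {B>0} r 4<H us (Unique.map⁻ (subst Unique (sym eq) uniq)) good)

-- Numerical data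

-- Kept as a product, so that denominators clear by ring identities and each numerical inequality
-- becomes one between natural numbers.
frac : ℕ → ℕ → ℚ
frac a k = fromℕ a * (+ 1 / suc k)

0≤frac : ∀ a k → 0ℚ ≤ frac a k
0≤frac a k = *-nonNeg (0≤fromℕ a) (<⇒≤ (0<1/suc k))

frac-1 : ∀ k → frac (suc k) k ≡ 1ℚ
frac-1 = fromℕ-inverse

frac-mono-≤ : ∀ {a b} k → a ℕ.≤ b → frac a k ≤ frac b k
frac-mono-≤ k a≤b = *-monoʳ-≤ (<⇒≤ (0<1/suc k)) (fromℕ-mono-≤ a≤b)

frac-+ : ∀ a b k → frac a k + frac b k ≡ frac (a ℕ.+ b) k
frac-+ a b k = trans (sym (*-distribʳ-+ (+ 1 / suc k) (fromℕ a) (fromℕ b)))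
  (cong (_* (+ 1 / suc k)) (sym (fromℕ-+ a b)))

frac-*-^ : ∀ a k q d e → frac a k ^ d * fromℕ q ^ e ≡ fromℕ (a ℕ.^ d ℕ.* q ℕ.^ e) * (+ 1 / suc k) ^ d
frac-*-^ a k q d e = begin
  frac a k ^ d * fromℕ q ^ e             ≡⟨ cong (_* fromℕ q ^ e) (^-distrib-* (fromℕ a) δ d) ⟩
  fromℕ a ^ d * δ ^ d * fromℕ q ^ e      ≡⟨ *-CS.xy∙z≈xz∙y (fromℕ a ^ d) (δ ^ d) (fromℕ q ^ e) ⟩
  fromℕ a ^ d * fromℕ q ^ e * δ ^ d
    ≡⟨ cong (_* δ ^ d) (trans (fromℕ-* (a ℕ.^ d) (q ℕ.^ e)) (cong₂ _*_ (fromℕ-^ a d) (fromℕ-^ q e))) ⟨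
  fromℕ (a ℕ.^ d ℕ.* q ℕ.^ e) * δ ^ d    ∎
  where
  open ≡-Reasoning
  δ = + 1 / suc k

unit-^ : ∀ k d → fromℕ (suc k ℕ.^ d) * (+ 1 / suc k) ^ d ≡ 1ℚ
unit-^ k d = trans (cong (_* (+ 1 / suc k) ^ d) (fromℕ-^ (suc k) d))
  (trans (sym (^-distrib-* (fromℕ (suc k)) (+ 1 / suc k) d))
    (trans (cong (_^ d) (fromℕ-inverse k)) (1^n≡1 d)))

frac-heavy : ∀ a k q d e → suc k ℕ.^ d ℕ.≤ a ℕ.^ d ℕ.* q ℕ.^ e → 1ℚ ≤ frac a k ^ d * fromℕ q ^ e
frac-heavy a k q d e large = subst₂ _≤_ (unit-^ k d) (sym (frac-*-^ a k q d e))
  (*-monoʳ-≤ (^-nonNeg d (<⇒≤ (0<1/suc k))) (fromℕ-mono-≤ large))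

frac-light : ∀ a k q d e → a ℕ.^ d ℕ.* q ℕ.^ e ℕ.≤ suc k ℕ.^ d → frac a k ^ d * fromℕ q ^ e ≤ 1ℚ
frac-light a k q d e small = subst₂ _≤_ (sym (frac-*-^ a k q d e)) (unit-^ k d)
  (*-monoʳ-≤ (^-nonNeg d (<⇒≤ (0<1/suc k))) (fromℕ-mono-≤ small))

Σ-frac : ∀ (f : A → ℕ) k xs → Σ[ (λ x → frac (f x) k) ] xs ≡ frac (sum (map f xs)) k
Σ-frac f k []       = sym (*-zeroˡ (+ 1 / suc k))
Σ-frac f k (x ∷ xs) = trans (cong (λ z → frac (f x) k + z) (Σ-frac f k xs))
  (frac-+ (f x) (sum (map f xs)) k)

Σ-upTo-suc : ∀ (f : ℕ → ℚ) N → Σ[ f ] (upTo (suc N)) ≡ f 0 + Σ[ f ∘ suc ] (upTo N)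
Σ-upTo-suc f N = cong (λ z → f 0 + z)
  (trans (cong Σ[ f ] (sym (map-upTo suc N))) (Σ-map f suc (upTo N)))

-- For ρ < 1 the hypothesis c + ρ * T ≤ T says c / (1 - ρ) ≤ T.
Σ-geometric : ∀ {c ρ T} → 0ℚ ≤ c → 0ℚ ≤ ρ → 0ℚ ≤ T → c + ρ * T ≤ T → ∀ N → Σ[ (λ j → c * ρ ^ j) ] (upTo N) ≤ T
Σ-geometric                 0≤c 0≤ρ 0≤T bound zero    = 0≤T
Σ-geometric {c} {ρ} {T} 0≤c 0≤ρ 0≤T bound (suc N) = begin
  Σ[ (λ j → c * ρ ^ j) ] (upTo (suc N))                 ≡⟨ Σ-upTo-suc (λ j → c * ρ ^ j) N ⟩
  c * 1ℚ + Σ[ (λ j → c * (ρ * ρ ^ j)) ] (upTo N)        ≡⟨ cong₂ _+_ (*-identityʳ c) (Σ-cong (upTo N)) ⟩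
  c + Σ[ (λ j → ρ * (c * ρ ^ j)) ] (upTo N)             ≡⟨ cong (λ z → c + z) (Σ-* ρ (λ j → c * ρ ^ j) (upTo N)) ⟩
  c + ρ * Σ[ (λ j → c * ρ ^ j) ] (upTo N)
    ≤⟨ +-monoʳ-≤ c (*-monoˡ-≤ 0≤ρ (Σ-geometric 0≤c 0≤ρ 0≤T bound N)) ⟩
  c + ρ * T                                             ≤⟨ bound ⟩
  T                                                     ∎
  where
  open ≤-Reasoning
  open +-*-Solver using (solve; _:=_; _:*_)
  Σ-cong : ∀ js → Σ[ (λ j → c * (ρ * ρ ^ j)) ] js ≡ Σ[ (λ j → ρ * (c * ρ ^ j)) ] js
  Σ-cong []       = refl
  Σ-cong (j ∷ js) = cong₂ _+_
    (solve 3 (λ c r p → c :* (r :* p) := r :* (c :* p)) refl c ρ (ρ ^ j)) (Σ-cong js)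

-- After the listed values, f is read from its argument 0 on.
extend : List ℚ → (ℕ → ℚ) → ℕ → ℚ
extend []       f n       = f n
extend (a ∷ as) f zero    = a
extend (a ∷ as) f (suc n) = extend as f n

extend-nonNeg : ∀ {as f} → All (0ℚ ≤_) as → (∀ n → 0ℚ ≤ f n) → ∀ n → 0ℚ ≤ extend as f n
extend-nonNeg []         0≤f n       = 0≤f n
extend-nonNeg (0≤a ∷ _)  0≤f zero    = 0≤a
extend-nonNeg (_ ∷ 0≤as) 0≤f (suc n) = extend-nonNeg 0≤as 0≤f n

Σ-extend : ∀ {as f T} → All (0ℚ ≤_) as → 0ℚ ≤ T → (∀ N → Σ[ f ] (upTo N) ≤ T) →
  ∀ N → Σ[ extend as f ] (upTo N) ≤ Σ[ (λ a → a) ] as + T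
Σ-extend {[]}     {f} {T} []           0≤T f≤T N = subst (Σ[ f ] (upTo N) ≤_) (sym (+-identityˡ T)) (f≤T N)
Σ-extend {a ∷ as} {f} {T} (0≤a ∷ 0≤as) 0≤T f≤T zero    =
  +-mono-≤ (+-mono-≤ 0≤a (total 0≤as)) 0≤T
  where
  total : ∀ {as} → All (0ℚ ≤_) as → 0ℚ ≤ Σ[ (λ a → a) ] as
  total []           = ≤-refl
  total (0≤a ∷ 0≤as) = +-mono-≤ 0≤a (total 0≤as)
Σ-extend {a ∷ as} {f} {T} (0≤a ∷ 0≤as) 0≤T f≤T (suc N) = begin
  Σ[ extend (a ∷ as) f ] (upTo (suc N))      ≡⟨ Σ-upTo-suc (extend (a ∷ as) f) N ⟩
  a + Σ[ extend as f ] (upTo N)              ≤⟨ +-monoʳ-≤ a (Σ-extend 0≤as 0≤T f≤T N) ⟩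
  a + (Σ[ (λ a → a) ] as + T)                ≡⟨ +-assoc a _ T ⟨
  a + Σ[ (λ a → a) ] as + T                  ∎
  where open ≤-Reasoning

geometric-frac : ∀ c p k T j → c ℕ.* suc j ℕ.+ p ℕ.* T ℕ.≤ T ℕ.* suc j → frac c k + frac p j * frac T k ≤ frac T k
geometric-frac c p k T j bound = begin
  frac c k + frac p j * frac T k
    ≡⟨ cong (λ z → frac z k + frac p j * frac T k) (sym (ℕ.*-identityʳ c)) ⟩
  frac (c ℕ.* 1) k + frac p j * frac T k
    ≡⟨ cong₂ _+_ (trans (cong (λ z → z * δ) (fromℕ-* c 1)) (cong (λ z → fromℕ c * z * δ) (sym (frac-1 j))))
         (solve 4 (λ p e t d → p :* e :* (t :* d) := p :* t :* (d :* e)) refl (fromℕ p) ε (fromℕ T) δ) ⟩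
  fromℕ c * (fromℕ (suc j) * ε) * δ + fromℕ p * fromℕ T * (δ * ε)
    ≡⟨ solve 6 (λ c s e d p t → c :* (s :* e) :* d :+ p :* t :* (d :* e) := (c :* s :+ p :* t) :* (d :* e)) refl
         (fromℕ c) (fromℕ (suc j)) ε δ (fromℕ p) (fromℕ T) ⟩
  (fromℕ c * fromℕ (suc j) + fromℕ p * fromℕ T) * (δ * ε)
    ≡⟨ cong (_* (δ * ε)) (trans (fromℕ-+ (c ℕ.* suc j) (p ℕ.* T)) (cong₂ _+_ (fromℕ-* c (suc j)) (fromℕ-* p T))) ⟨
  fromℕ (c ℕ.* suc j ℕ.+ p ℕ.* T) * (δ * ε)
    ≤⟨ *-monoʳ-≤ (*-nonNeg (<⇒≤ (0<1/suc k)) (<⇒≤ (0<1/suc j))) (fromℕ-mono-≤ bound) ⟩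
  fromℕ (T ℕ.* suc j) * (δ * ε)
    ≡⟨ trans (cong (_* (δ * ε)) (fromℕ-* T (suc j)))
         (solve 4 (λ t s d e → t :* s :* (d :* e) := t :* d :* (s :* e)) refl (fromℕ T) (fromℕ (suc j)) δ ε) ⟩
  fromℕ T * δ * (fromℕ (suc j) * ε)
    ≡⟨ trans (cong (fromℕ T * δ *_) (frac-1 j)) (*-identityʳ (fromℕ T * δ)) ⟩
  frac T k ∎
  where
  open ≤-Reasoning
  open +-*-Solver using (solve; _:=_; _:+_; _:*_)
  δ = + 1 / suc k
  ε = + 1 / suc j

contraction-frac : ∀ s k K → s ℕ.* K ℕ.+ suc k ℕ.≤ K ℕ.* suc k → 1ℚ + frac s k * fromℕ K ≤ fromℕ K
contraction-frac s k K bound = begin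
  1ℚ + frac s k * fromℕ K
    ≡⟨ cong₂ _+_ (sym (frac-1 k)) (*-CS.xy∙z≈xz∙y (fromℕ s) δ (fromℕ K)) ⟩
  frac (suc k) k + fromℕ s * fromℕ K * δ
    ≡⟨ cong (λ z → frac (suc k) k + z * δ) (fromℕ-* s K) ⟨
  frac (suc k) k + frac (s ℕ.* K) k    ≡⟨ trans (+-comm (frac (suc k) k) _) (frac-+ (s ℕ.* K) (suc k) k) ⟩
  frac (s ℕ.* K ℕ.+ suc k) k           ≤⟨ frac-mono-≤ k bound ⟩
  fromℕ (K ℕ.* suc k) * δ              ≡⟨ trans (cong (_* δ) (fromℕ-* K (suc k))) (*-assoc (fromℕ K) (fromℕ (suc k)) δ) ⟩
  fromℕ K * frac (suc k) k             ≡⟨ trans (cong (fromℕ K *_) (frac-1 k)) (*-identityʳ (fromℕ K)) ⟩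
  fromℕ K                              ∎
  where
  open ≤-Reasoning
  δ = + 1 / suc k

-- As ρ ≥ 2^(-e/d), the weight c ρ^j is at least (2^j (2^n₀ - 1))^(-e/d), and 2^j (2^n₀ - 1) ≤
-- 2^(j+n₀) - 1.
tail-heavy : ∀ {c ρ n₀ d e} → 0ℚ ≤ c → 0ℚ ≤ ρ → 1ℚ ≤ c ^ d * fromℕ (mersenne n₀) ^ e → 1ℚ ≤ ρ ^ d * fromℕ 2 ^ e →
  ∀ j → 1ℚ ≤ (c * ρ ^ j) ^ d * fromℕ (mersenne (j ℕ.+ n₀)) ^ e
tail-heavy {c} {ρ} {n₀} {d} {e} 0≤c 0≤ρ heavy ratio j = begin
  1ℚ * 1ℚ
    ≤⟨ *-mono-≤² (<⇒≤ 0<1) heavy (<⇒≤ 0<1) (1≤x^n j ratio) ⟩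
  c ^ d * M ^ e * (ρ ^ d * fromℕ 2 ^ e) ^ j
    ≡⟨ cong (c ^ d * M ^ e *_) (trans (^-distrib-* (ρ ^ d) (fromℕ 2 ^ e) j)
         (cong₂ _*_ (^-comm ρ d j) (^-comm (fromℕ 2) e j))) ⟩
  c ^ d * M ^ e * ((ρ ^ j) ^ d * (fromℕ 2 ^ j) ^ e)
    ≡⟨ interchange (c ^ d) (M ^ e) ((ρ ^ j) ^ d) ((fromℕ 2 ^ j) ^ e) ⟩
  c ^ d * (ρ ^ j) ^ d * ((fromℕ 2 ^ j) ^ e * M ^ e)
    ≡⟨ cong₂ _*_ (^-distrib-* c (ρ ^ j) d) (^-distrib-* (fromℕ 2 ^ j) M e) ⟨
  (c * ρ ^ j) ^ d * (fromℕ 2 ^ j * M) ^ e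
    ≤⟨ *-monoˡ-≤ (^-nonNeg d (*-nonNeg 0≤c (^-nonNeg j 0≤ρ)))
         (^-mono-≤ e (*-nonNeg (^-nonNeg j (0≤fromℕ 2)) (0≤fromℕ (mersenne n₀))) growth) ⟩
  (c * ρ ^ j) ^ d * fromℕ (mersenne (j ℕ.+ n₀)) ^ e ∎
  where
  open ≤-Reasoning
  open +-*-Solver using (solve; _:=_; _:*_)
  M = fromℕ (mersenne n₀)
  interchange : ∀ a b c d → a * b * (c * d) ≡ a * c * (d * b)
  interchange = solve 4 (λ a b c d → a :* b :* (c :* d) := a :* c :* (d :* b)) refl
  growth : fromℕ 2 ^ j * M ≤ fromℕ (mersenne (j ℕ.+ n₀))
  growth = subst (_≤ fromℕ (mersenne (j ℕ.+ n₀)))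
    (trans (fromℕ-* (2 ℕ.^ j) (mersenne n₀)) (cong (_* M) (fromℕ-^ 2 j)))
    (fromℕ-mono-≤ (subst₂ ℕ._≤_ (sym (ℕ.*-distribˡ-∸ (2 ℕ.^ j) (2 ℕ.^ n₀) 1))
      (cong (ℕ._∸ 1) (sym (ℕ.^-distribˡ-+-* 2 j n₀)))
      (ℕ.∸-monoʳ-≤ (2 ℕ.^ j ℕ.* 2 ℕ.^ n₀) (subst (1 ℕ.≤_) (sym (ℕ.*-identityʳ (2 ℕ.^ j))) (ℕ.m^n>0 2 j)))))

-- Primality by trial division

trial : ℕ → ℕ → Bool
trial n (suc d@(suc (suc _))) = not (n % d ℕ.≡ᵇ 0) ∧ trial n d
trial n _                     = true

-- The bound m is exclusive: the divisors tested are 2, ..., m - 1, exactly those excluded by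
-- roughness.
trial⇒rough : ∀ n m → T (trial n m) → m Rough n
trial⇒rough n 0 _ = 0-rough
trial⇒rough n 1 _ = 1-rough
trial⇒rough n 2 _ = 2-rough
trial⇒rough n (suc d@(suc (suc _))) passed =
  let (indivisible , rest) = Equivalence.to (T-∧ {not (n % d ℕ.≡ᵇ 0)}) passed in
  ∤⇒rough-suc (λ d∣n → T-not indivisible (ℕ.≡⇒≡ᵇ (n % d) 0 (n∣m⇒m%n≡0 n d d∣n))) (trial⇒rough n d rest)
  where
  T-not : ∀ {b} → T (not b) → ¬ T b
  T-not {false} _ ()

trial⇒prime : ∀ n m .{{_ : ℕ.NonTrivial n}} → T (trial n m) → T (n ℕ.<ᵇ m ℕ.* m) → Prime n
trial⇒prime n m passed n<m² = rough∧square>⇒prime (trial⇒rough n m passed) (ℕ.<ᵇ⇒< n (m ℕ.* m) n<m²)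

¬prime : ∀ d k .{{_ : ℕ.NonTrivial d}} .{{_ : ℕ.NonZero (k ℕ.* d)}} → d ≢ k ℕ.* d → ¬ Prime (k ℕ.* d)
¬prime d k d≢n p = Prime.notComposite p (composite-≢ d d≢n (divides k refl))

-- The numerators are ⌊ 10⁵ q^(-87/143) ⌋; the exponent 87/143 is just above 0.60839.
lowerTable : List (ℕ × ℕ)
lowerTable = (3 , 51253) ∷ (7 , 30609) ∷ (31 , 12378) ∷ (127 , 5248) ∷ (8191 , 416) ∷ (131071 , 77) ∷ (524287 , 33) ∷ []

letters : List ℕ
letters = map proj₁ lowerTable

letters-mersenne : All MersennePrime letters
letters-mersenne =
    -- The second argument is the least m whose square exceeds the prime.
    (trial⇒prime 3 2 _ _ , 2 , refl)
  ∷ (trial⇒prime 7 3 _ _ , 3 , refl)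
  ∷ (trial⇒prime 31 6 _ _ , 5 , refl)
  ∷ (trial⇒prime 127 12 _ _ , 7 , refl)
  ∷ (trial⇒prime 8191 91 _ _ , 13 , refl)
  ∷ (trial⇒prime 131071 363 _ _ , 17 , refl)
  ∷ (trial⇒prime 524287 725 _ _ , 19 , refl)
  ∷ []

letters-odd : All OddLetter letters
letters-odd =
    odd-letter 0 refl ∷ odd-letter 2 refl ∷ odd-letter 14 refl ∷ odd-letter 62 refl
  ∷ odd-letter 4094 refl ∷ odd-letter 65534 refl ∷ odd-letter 262142 refl ∷ []

entry : List (ℕ × ℕ) → ℕ → ℕ
entry []            q = 0
entry ((p , a) ∷ t) q = if p ℕ.≡ᵇ q then a else entry t q

lowerNumerator : ℕ → ℕ
lowerNumerator = entry lowerTable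

Light : ℕ → Set
Light q = lowerNumerator q ℕ.^ 143 ℕ.* q ℕ.^ 87 ℕ.≤ 100000 ℕ.^ 143

letters-light : All Light letters
letters-light =
  light 3 _ ∷ light 7 _ ∷ light 31 _ ∷ light 127 _ ∷ light 8191 _ ∷ light 131071 _ ∷ light 524287 _ ∷ []
  where
  light : ∀ q → T (lowerNumerator q ℕ.^ 143 ℕ.* q ℕ.^ 87 ℕ.≤ᵇ 100000 ℕ.^ 143) → Light q
  light q = ℕ.≤ᵇ⇒≤ (lowerNumerator q ℕ.^ 143 ℕ.* q ℕ.^ 87) (100000 ℕ.^ 143)

infixr 5 _∷_

-- The inequality for an entry may assume that 2ⁿ - 1 is prime, so a zero entry is justified by a
-- proof that it is not.
data HeavyFrom (k d e : ℕ) : ℕ → List ℕ → Set where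
  []  : ∀ {n} → HeavyFrom k d e n []
  _∷_ : ∀ {n a as} → (Prime (mersenne n) → suc k ℕ.^ d ℕ.≤ a ℕ.^ d ℕ.* mersenne n ℕ.^ e) →
        HeavyFrom k d e (suc n) as → HeavyFrom k d e n (a ∷ as)

extend-heavy : ∀ {k d e n as f} → HeavyFrom k d e n as →
  (∀ j → 1ℚ ≤ f j ^ d * fromℕ (mersenne (j ℕ.+ (length as ℕ.+ n))) ^ e) →
  ∀ i → Prime (mersenne (i ℕ.+ n)) → 1ℚ ≤ extend (map (λ a → frac a k) as) f i ^ d * fromℕ (mersenne (i ℕ.+ n)) ^ e
extend-heavy                         []           tail i       p = tail i
extend-heavy {k} {d} {e} {n} {a ∷ _} (heavy ∷ _)  tail zero    p = frac-heavy a k (mersenne n) d e (heavy p)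
extend-heavy {k} {d} {e} {n} {a ∷ as} {f} (_ ∷ heavies) tail (suc i) p =
  subst (λ m → 1ℚ ≤ extend (map (λ a → frac a k) as) f i ^ d * fromℕ (mersenne m) ^ e) (ℕ.+-suc i n)
    (extend-heavy heavies
      (λ j → subst (λ m → 1ℚ ≤ f j ^ d * fromℕ (mersenne (j ℕ.+ m)) ^ e) (sym (ℕ.+-suc (length as) n)) (tail j))
      i (subst (Prime ∘ mersenne) (sym (ℕ.+-suc i n)) p))

-- ⌈ 10⁶ (2ⁿ - 1)^(-14/23) ⌉ for the n < 23 with 2ⁿ - 1 prime, and 0 for the others; the exponent
-- 14/23 is just below 0.60872.
upperTable : List ℕ
upperTable = 0 ∷ 0 ∷ 512364 ∷ 305910 ∷ 0 ∷ 123656 ∷ 0 ∷ 52412 ∷ 0 ∷ 0 ∷ 0 ∷ 0 ∷ 0 ∷ 4150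
  ∷ 0 ∷ 0 ∷ 0 ∷ 768 ∷ 0 ∷ 331 ∷ 0 ∷ 0 ∷ 0 ∷ []

upperTable-heavy : HeavyFrom 999999 23 14 0 upperTable
upperTable-heavy =
    -- `¬prime d k` exhibits the factorization 2ⁿ - 1 = k d.
    none ¬prime[0] ∷ none ¬prime[1] ∷ heavy 2 512364 _ ∷ heavy 3 305910 _ ∷ none (¬prime 3 5 λ ())
  ∷ heavy 5 123656 _ ∷ none (¬prime 3 21 λ ()) ∷ heavy 7 52412 _ ∷ none (¬prime 3 85 λ ())
  ∷ none (¬prime 7 73 λ ()) ∷ none (¬prime 3 341 λ ()) ∷ none (¬prime 23 89 λ ())
  ∷ none (¬prime 3 1365 λ ()) ∷ heavy 13 4150 _ ∷ none (¬prime 3 5461 λ ())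
  ∷ none (¬prime 7 4681 λ ()) ∷ none (¬prime 3 21845 λ ()) ∷ heavy 17 768 _
  ∷ none (¬prime 3 87381 λ ()) ∷ heavy 19 331 _ ∷ none (¬prime 3 349525 λ ())
  ∷ none (¬prime 7 299593 λ ()) ∷ none (¬prime 3 1398101 λ ()) ∷ []
  where
  none : ∀ {p} {P : Set} → ¬ Prime p → Prime p → P
  none ¬p p = contradiction p ¬p
  heavy : ∀ n a → T (1000000 ℕ.^ 23 ℕ.≤ᵇ a ℕ.^ 23 ℕ.* mersenne n ℕ.^ 14) →
    Prime (mersenne n) → 1000000 ℕ.^ 23 ℕ.≤ a ℕ.^ 23 ℕ.* mersenne n ℕ.^ 14
  heavy n a ok _ = ℕ.≤ᵇ⇒≤ (1000000 ℕ.^ 23) (a ℕ.^ 23 ℕ.* mersenne n ℕ.^ 14) ok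

-- (2²³ - 1)^(-14/23) < 62/10⁶ and 2^(-14/23) < 82/125.
upperTail : ℕ → ℚ
upperTail j = frac 62 999999 * frac 82 124 ^ j

upperWeight : ℕ → ℚ
upperWeight = extend (map (λ a → frac a 999999) upperTable) upperTail

-- Numerical conditions on the two weight functions

abstract

  all-frac-nonNeg : ∀ k as → All (0ℚ ≤_) (map (λ a → frac a k) as)
  all-frac-nonNeg k []       = []
  all-frac-nonNeg k (a ∷ as) = 0≤frac a k ∷ all-frac-nonNeg k as

  upperTail-heavy : ∀ j → 1ℚ ≤ upperTail j ^ 23 * fromℕ (mersenne (j ℕ.+ 23)) ^ 14
  upperTail-heavy = tail-heavy {frac 62 999999} {frac 82 124} {23} {23} {14} (0≤frac 62 999999) (0≤frac 82 124)
    (frac-heavy 62 999999 (mersenne 23) 23 14 (ℕ.≤ᵇ⇒≤ (1000000 ℕ.^ 23) (62 ℕ.^ 23 ℕ.* mersenne 23 ℕ.^ 14) _))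
    (frac-heavy 82 124 2 23 14 (ℕ.≤ᵇ⇒≤ (125 ℕ.^ 23) (82 ℕ.^ 23 ℕ.* 2 ℕ.^ 14) _))

  upperWeight-heavy : ∀ n → Prime (mersenne n) → 1ℚ ≤ upperWeight n ^ 23 * fromℕ (mersenne n) ^ 14
  upperWeight-heavy n p = subst (λ m → 1ℚ ≤ upperWeight n ^ 23 * fromℕ (mersenne m) ^ 14) (ℕ.+-identityʳ n)
    (extend-heavy {999999} {23} {14} {0} {upperTable} {upperTail} upperTable-heavy upperTail-heavy n
      (subst (Prime ∘ mersenne) (sym (ℕ.+-identityʳ n)) p))

  upperWeight-nonNeg : ∀ n → 0ℚ ≤ upperWeight n
  upperWeight-nonNeg = extend-nonNeg (all-frac-nonNeg 999999 upperTable)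
    (λ j → *-nonNeg (0≤frac 62 999999) (^-nonNeg j (0≤frac 82 124)))

  Σ-upperWeight : ∀ N → Σ[ upperWeight ] (upTo N) ≤ frac 999772 999999
  Σ-upperWeight N = begin
    Σ[ upperWeight ] (upTo N)
      ≤⟨ Σ-extend (all-frac-nonNeg 999999 upperTable) (0≤frac 181 999999)
           -- 62 / (1 - 82/125) = 180.2..., so the tail weighs at most 181/10⁶.
           (Σ-geometric (0≤frac 62 999999) (0≤frac 82 124) (0≤frac 181 999999)
             (geometric-frac 62 82 999999 181 124 (ℕ.≤ᵇ⇒≤ 22592 22625 _))) N ⟩
    Σ[ (λ a → a) ] (map (λ a → frac a 999999) upperTable) + frac 181 999999
      ≡⟨ cong (_+ frac 181 999999) (trans (Σ-map (λ a → a) (λ a → frac a 999999) upperTable)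
           (Σ-frac (λ a → a) 999999 upperTable)) ⟩
    frac 999591 999999 + frac 181 999999     ≡⟨ frac-+ 999591 181 999999 ⟩
    frac 999772 999999                       ∎
    where open ≤-Reasoning

  -- The sum σ leaves 1 - σ ≥ 228/10⁶ > 1/10⁴, so 10⁴ exceeds 1/(1 - σ).
  upperWeight-geometric : ∀ N → 1ℚ + Σ[ upperWeight ] (upTo N) * fromℕ 10000 ≤ fromℕ 10000
  upperWeight-geometric N = ≤-trans
    (+-monoʳ-≤ 1ℚ (*-monoʳ-≤ (0≤fromℕ 10000) (Σ-upperWeight N)))
    (contraction-frac 999772 999999 10000 (ℕ.≤ᵇ⇒≤ 9998720000 10000000000 _))

  letters-unique : Unique letters
  letters-unique = toWitness {a? = unique? letters} _

  lowerBlock : Block letters 143 87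
  lowerBlock = block 143 87 letters-unique (λ q → 0≤frac (lowerNumerator q) 99999)
    (λ {q} q∈ → frac-light (lowerNumerator q) 99999 q 143 87 (All.lookup letters-light q∈))
    -- The seven numerators sum to 100014, just above the denominator 10⁵.
    (subst₂ _<_ (frac-1 99999) (sym (Σ-frac lowerNumerator 99999 letters))
      (*-mono-<ʳ (0<1/suc 99999) (fromℕ-mono-< (ℕ.≤ᵇ⇒≤ 100001 100014 _))))

corollary1p4 : (r : ℚ) → 4 ℕ.< H r →
    ((λ B B>0 → log B B>0 ^[ 60839 / 100000 ]) ≪# MersenneValuesUpTo r)
    × (MersenneValuesUpTo r #≪ (λ B B>0 → log B B>0 ^[ 60872 / 100000 ]))
corollary1p4 r 4<H =
  let (prefix , prefix⊆ , large) = large-prefix r in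
    Lower.lower {letters} {143} {87} lowerBlock (All.lookup letters-mersenne) (All.lookup letters-odd)
      {r} prefix (All.map (All.lookup letters-mersenne ∘ ∈-++⁺ˡ) prefix⊆) large
      60839 100000 (ℕ.≤ᵇ⇒≤ (60839 ℕ.* 143) (87 ℕ.* 100000) _) (ℕ.≤ᵇ⇒≤ 60839 100000 _)
  , Upper.upper {upperWeight} upperWeight-nonNeg {fromℕ 10000} (0<fromℕ 9999) upperWeight-geometric 23 14
      upperWeight-heavy {r} 4<H
      60872 100000 (ℕ.≤ᵇ⇒≤ (14 ℕ.* 100000) (60872 ℕ.* 23) _) (ℕ.≤ᵇ⇒≤ 60872 100000 _)
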